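{- Let $\mathbb{A}$ be a finite signature of constructors, and let $f$ be a function defined by general ramified simultaneous recurrence, i.e. $f\in\mathrm{SimRec}(\mathbb{A})$ and $f\rhd\mathbb{A}_{p_1}\times\cdots\times\mathbb{A}_{p_k}\to\mathbb{A}_m$ is derivable for some natural numbers $p_1,\dots,p_k,m$. Then there exists a polynomial $p_f:\mathbb{N}^k\to\mathbb{N}$ such that, for all inputs $v_1,\dots,v_k\in\mathbb{A}$, a DAG representation of $f(v_1,\dots,v_k)$ is computable from $v_1,\dots,v_k$ in time $p_f(|v_1|,\dots,|v_k|)$.
   Context: **Algebra.** $\mathbb{A}$ denotes a finite signature of constructors $\mathsf{c}_1,\dots,\mathsf{c}_K$, each with an arity $\mathrm{ar}(\mathsf{c}_i)$; the set of ground terms over it is also written $\mathbb{A}$. $|v|$ is the number of symbol occurrences in the term $v$, i.e. $|\mathsf{c}(v_1,\dots,v_k)|=1+\sum_i|v_i|$. **Simultaneous recursive functions.** $\mathrm{SimRec}(\mathbb{A})$ is the smallest class of functions $\mathbb{A}^n\to\mathbb{A}$ containing the basic functions - constructor functions $f_{\mathsf{c}}(x_1,\dots,x_{\mathrm{ar}(\mathsf{c})})=\mathsf{c}(x_1,\dots,x_{\mathrm{ar}(\mathsf{c})})$; - projections $\Pi^m_n(x_1,\dots,x_m)=x_n$ for $1\le n\le m$; and closed under - composition: from $f:\mathbb{A}^n\to\mathbb{A}$ and $g_1,\dots,g_n:\mathbb{A}^m\to\mathbb{A}$, the function $f\circ(g_1,\dots,g_n)$, $\vec x\mapsto f(g_1(\vec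 x),\dots,g_n(\vec x))$; - case distinction: from $f_i:\mathbb{A}^{\mathrm{ar}(\mathsf{c}_i)}\times\mathbb{A}^n\to\mathbb{A}$ ($1\le i\le K$), the function $g=\mathrm{case}(\{f_i\}_i)$ with $g(\mathsf{c}_i(\vec x),\vec y)=f_i(\vec x,\vec y)$; - simultaneous primitive recursion: from $f_i^j:\mathbb{A}^{\mathrm{ar}(\mathsf{c}_i)}\times\mathbb{A}^{n\cdot\mathrm{ar}(\mathsf{c}_i)}\times\mathbb{A}^m\to\mathbb{A}$ ($1\le i\le K$, $1\le j\le n$), the functions $g_1,\dots,g_n:\mathbb{A}\times\mathbb{A}^m\to\mathbb{A}$, $\{g_j\}_j=\mathrm{simrec}(\{f_i^j\}_{i,j})$, with, for $\vec x=x_1,\dots,x_a$ and $a=\mathrm{ar}(\mathsf{c}_i)$, $$g_j(\mathsf{c}_i(\vec x),\vec y)=f_i^j(\vec x,g_1(x_1,\vec y),\dots,g_1(x_a,\vec y),\dots,g_n(x_1,\vec y),\dots,g_n(x_a,\vec y),\vec y).$$ **Tiering.** Judgments $f\rhd\mathbb{A}_{p_1}\times\cdots\times\mathbb{A}_{p_k}\to\mathbb{A}_m$ (tiers $p_i,m\in\mathbb{N}$; $k$ the arity of $f$) are derived, following the definition of $f$, by the rules below, where $\mathbf{A}$ ranges over expressions $\mathbb{A}_{q_1}\times\cdots\times\mathbb{A}_{q_l}$: - $f_{\mathsf{c}}\rhd\mathbb{A}_n^{\mathrm{ar}(\mathsf{c})}\to\mathbb{A}_n$; - $\Pi^m_n\rhd\mathbb{A}_{p_1}\times\cdots\times\mathbb{A}_{p_m}\to\mathbb{A}_{p_n}$;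 - if $f_i\rhd\mathbb{A}_p^{\mathrm{ar}(\mathsf{c}_i)}\times\mathbf{A}\to\mathbb{A}_m$ for all $i$, then $\mathrm{case}(\{f_i\}_i)\rhd\mathbb{A}_p\times\mathbf{A}\to\mathbb{A}_m$; - if $f\rhd\mathbb{A}_{p_1}\times\cdots\times\mathbb{A}_{p_n}\to\mathbb{A}_m$ and $g_i\rhd\mathbf{A}\to\mathbb{A}_{p_i}$ for all $i$, then $f\circ(g_1,\dots,g_n)\rhd\mathbf{A}\to\mathbb{A}_m$; - if $f_i^j\rhd\mathbb{A}_p^{\mathrm{ar}(\mathsf{c}_i)}\times\mathbb{A}_m^{n\cdot\mathrm{ar}(\mathsf{c}_i)}\times\mathbf{A}\to\mathbb{A}_m$ for all $i,j$ and $p>m$, then each function $g_j$ of $\mathrm{simrec}(\{f_i^j\}_{i,j})$ satisfies $g_j\rhd\mathbb{A}_p\times\mathbf{A}\to\mathbb{A}_m$. **DAG representation.** A DAG representation of a term $v\in\mathbb{A}$ is a (string encoding of a) rooted directed acyclic graph with nodes labeled by constructors and ordered outgoing edges (as many as the arity of the label), maximally shared (no two distinct nodes have the same label and the same successor list), whose unfolding from the root is $v$. Inputs are given as ordinary terms; time is measured on a standard model such as Turing machines. -}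

module Defs where

open import Data.Fin using (Fin; zero; suc; toℕ)
open import Data.List as List using (List; []; _∷_; [_])
open import Data.Maybe using (Maybe; just; nothing)
open import Data.Nat using (ℕ; zero; suc; _+_; _*_; _≤_; _<_)
open import Data.Product using (Σ-syntax; ∃-syntax; _×_; _,_; proj₁; proj₂)
open import Data.Sum using (_⊎_; inj₁)
open import Data.Vec as Vec using (Vec; []; _∷_; lookup; tabulate; replicate; toList)
open import Data.Vec.Membership.Propositional using (_∈_)
open import Data.Vec.Relation.Binary.Pointwise.Inductive using (Pointwise)
open import Function.Definitions using (Injective)
open import Relation.Binary.Construct.Closure.ReflexiveTransitive using (Star)
open import Relation.Binary.Construct.Closure.Transitive using (TransClosure)
open import Relation.Binary.PropositionalEquality using (_≡_)
open import Relation.Nullary using (¬_)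

record Signature : Set where
  field
    K  : ℕ
    ar : Fin K → ℕ

open Signature public

data Term (𝔸 : Signature) : Set where
  con : (c : Fin (K 𝔸)) → Vec (Term 𝔸) (ar 𝔸 c) → Term 𝔸

size  : ∀ {𝔸} → Term 𝔸 → ℕ
sizes : ∀ {𝔸 n} → Vec (Term 𝔸) n → ℕ
size (con c ts) = suc (sizes ts)
sizes []        = 0
sizes (t ∷ ts)  = size t + sizes ts

-- SimRec 𝔸 n is the type of definitions of n-ary functions; tiering proceeds
-- along the definition, ⟦_⟧ below is the function defined.  The recursive
-- results are laid out as g₁(x₁),…,g₁(xₐ),…,gₙ(x₁),…,gₙ(xₐ).
data SimRec (𝔸 : Signature) : ℕ → Set where
  constr : (c : Fin (K 𝔸)) → SimRec 𝔸 (ar 𝔸 c)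
  proj   : ∀ {m} → Fin m → SimRec 𝔸 m
  comp   : ∀ {n m} → SimRec 𝔸 n → (Fin n → SimRec 𝔸 m) → SimRec 𝔸 m
  case   : ∀ {n} → ((i : Fin (K 𝔸)) → SimRec 𝔸 (ar 𝔸 i + n)) →
           SimRec 𝔸 (suc n)
  simrec : ∀ {n m} →
           ((i : Fin (K 𝔸)) → Fin n → SimRec 𝔸 (ar 𝔸 i + (n * ar 𝔸 i + m))) →
           Fin n → SimRec 𝔸 (suc m)

Fun : Signature → ℕ → Set
Fun 𝔸 n = Vec (Term 𝔸) n → Term 𝔸

module _ {𝔸 : Signature} {n m : ℕ}
         (f : (i : Fin (K 𝔸)) → Fin n → Fun 𝔸 (ar 𝔸 i + (n * ar 𝔸 i + m)))
         (ys : Vec (Term 𝔸) m) where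

  simrecOn  : Fin n → Term 𝔸 → Term 𝔸
  simrecOns : ∀ {a} → Fin n → Vec (Term 𝔸) a → Vec (Term 𝔸) a
  simrecOn j (con i xs) =
    f i j (xs Vec.++ (Vec.concat (tabulate λ j′ → simrecOns j′ xs) Vec.++ ys))
  simrecOns j []       = []
  simrecOns j (x ∷ xs) = simrecOn j x ∷ simrecOns j xs

⟦_⟧ : ∀ {𝔸 n} → SimRec 𝔸 n → Fun 𝔸 n
⟦ constr c ⟧   xs              = con c xs
⟦ proj i ⟧     xs              = lookup xs i
⟦ comp f g ⟧   xs              = ⟦ f ⟧ (tabulate λ i → ⟦ g i ⟧ xs)
⟦ case f ⟧     (con i xs ∷ ys) = ⟦ f i ⟧ (xs Vec.++ ys)
⟦ simrec f j ⟧ (x ∷ ys)        = simrecOn (λ i j′ → ⟦ f i j′ ⟧) ys j x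

-- f ▷ p₁ ∷ … ∷ pₖ ∷ [] ⟶ m stands for f ▷ 𝔸_p₁ × … × 𝔸_pₖ → 𝔸_m.
infix 4 _▷_⟶_

data _▷_⟶_ {𝔸 : Signature} : ∀ {k} → SimRec 𝔸 k → Vec ℕ k → ℕ → Set where
  constr : ∀ {c n} → constr c ▷ replicate (ar 𝔸 c) n ⟶ n
  proj   : ∀ {m} {i : Fin m} {ps} → proj i ▷ ps ⟶ lookup ps i
  comp   : ∀ {n l} {f : SimRec 𝔸 n} {g : Fin n → SimRec 𝔸 l} {ps qs m} →
           f ▷ ps ⟶ m → (∀ i → g i ▷ qs ⟶ lookup ps i) →
           comp f g ▷ qs ⟶ m
  case   : ∀ {l} {f : (i : Fin (K 𝔸)) → SimRec 𝔸 (ar 𝔸 i + l)} {p qs m} →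
           (∀ i → f i ▷ replicate (ar 𝔸 i) p Vec.++ qs ⟶ m) →
           case f ▷ p ∷ qs ⟶ m
  simrec : ∀ {n l}
           {f : (i : Fin (K 𝔸)) → Fin n → SimRec 𝔸 (ar 𝔸 i + (n * ar 𝔸 i + l))}
           {p qs m} (j : Fin n) →
           m < p →
           (∀ i j′ → f i j′ ▷ replicate (ar 𝔸 i) p Vec.++
                              (replicate (n * ar 𝔸 i) m Vec.++ qs) ⟶ m) →
           simrec f j ▷ p ∷ qs ⟶ m

Node : Signature → ℕ → Set
Node 𝔸 N = Σ[ c ∈ Fin (K 𝔸) ] Vec (Fin N) (ar 𝔸 c)

record Graph (𝔸 : Signature) : Set where
  field
    order : ℕ
    node  : Fin order → Node 𝔸 order
    root  : Fin order

  label : Fin order → Fin (K 𝔸)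
  label v = proj₁ (node v)

  succs : (v : Fin order) → Vec (Fin order) (ar 𝔸 (label v))
  succs v = proj₂ (node v)

  Edge : Fin order → Fin order → Set
  Edge v w = w ∈ succs v

  data UnfoldsTo (v : Fin order) : Term 𝔸 → Set where
    unfold : ∀ {ts} → Pointwise UnfoldsTo (succs v) ts →
             UnfoldsTo v (con (label v) ts)

record IsDAGOf {𝔸 : Signature} (t : Term 𝔸) (G : Graph 𝔸) : Set where
  open Graph G
  field
    acyclic       : ∀ v → ¬ TransClosure Edge v v
    rooted        : ∀ v → Star Edge root v
    maximalShared : Injective _≡_ _≡_ node
    rootUnfolds   : UnfoldsTo root t

-- The number of input/output letters: one per constructor and two auxiliary
-- ones, tick and sep.
letters : Signature → ℕ
letters 𝔸 = 2 + K 𝔸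

pattern tick  = zero
pattern sep   = suc zero
pattern ctr c = suc (suc c)

-- Polish notation: the word of t has length |t|.
encodeTerm  : ∀ {𝔸} → Term 𝔸 → List (Fin (letters 𝔸))
encodeTerms : ∀ {𝔸 n} → Vec (Term 𝔸) n → List (Fin (letters 𝔸))
encodeTerm (con c ts)  = ctr c ∷ encodeTerms ts
encodeTerms []         = []
encodeTerms (t ∷ ts)   = encodeTerm t List.++ encodeTerms ts

encodeInputs : ∀ {𝔸 k} → Vec (Term 𝔸) k → List (Fin (letters 𝔸))
encodeInputs vs = List.concatMap (λ v → encodeTerm v List.++ [ sep ]) (toList vs)

-- A graph is written as its root followed by its nodes in order, each node as
-- its label followed by its successors; a node is referred to by its index in
-- unary.
module _ {𝔸 : Signature} where

  encodeIndex : ∀ {N} → Fin N → List (Fin (letters 𝔸))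
  encodeIndex v = List.replicate (toℕ v) tick List.++ [ sep ]

  encodeNode : ∀ {N} → Node 𝔸 N → List (Fin (letters 𝔸))
  encodeNode (c , ws) = ctr c ∷ List.concatMap encodeIndex (toList ws)

  encodeGraph : Graph 𝔸 → List (Fin (letters 𝔸))
  encodeGraph G =
    encodeIndex root List.++ List.concatMap encodeNode (toList (tabulate node))
    where open Graph G

data Move : Set where
  left right stay : Move

-- A two-way infinite tape over the symbols S; the cell nothing is blank.  It
-- lists the cells to the left of the head (nearest first), the scanned cell and
-- the cells to the right; everything beyond the lists is blank.
record Tape (S : Set) : Set where
  constructor tape
  field
    before  : List (Maybe S)
    scanned : Maybe S
    after   : List (Maybe S)

open Tape public

module _ {S : Set} where

  blankTape : Tape S
  blankTape = tape [] nothing []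

  move : Move → Tape S → Tape S
  move left  (tape []       c rs)       = tape [] nothing (c ∷ rs)
  move left  (tape (l ∷ ls) c rs)       = tape ls l (c ∷ rs)
  move right (tape ls       c [])       = tape (c ∷ ls) nothing []
  move right (tape ls       c (r ∷ rs)) = tape (c ∷ ls) r rs
  move stay  t                          = t

  act : Maybe S × Move → Tape S → Tape S
  act (c , d) (tape ls _ rs) = move d (tape ls c rs)

-- Deterministic multitape machines over the input/output alphabet Fin a.
record TM (a : ℕ) : Set where
  field
    extraTapes   : ℕ
    extraSymbols : ℕ
    states       : ℕ

  tapes : ℕ
  tapes = suc extraTapes

  TapeSymbol : Set
  TapeSymbol = Fin a ⊎ Fin extraSymbols

  -- δ q cs ≡ nothing means that the machine halts.
  field
    start : Fin states
    δ     : Fin states → Vec (Maybe TapeSymbol) tapes →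
            Maybe (Fin states × Vec (Maybe TapeSymbol × Move) tapes)

  Config : Set
  Config = Fin states × Vec (Tape TapeSymbol) tapes

  step : Config → Maybe Config
  step (q , ts) with δ q (Vec.map scanned ts)
  ... | nothing         = nothing
  ... | just (q′ , acs) = just (q′ , Vec.zipWith act acs ts)

  data HaltsIn : ℕ → Config → Config → Set where
    halt : ∀ {c} → step c ≡ nothing → HaltsIn 0 c c
    next : ∀ {n c c′ d} → step c ≡ just c′ → HaltsIn n c′ d → HaltsIn (suc n) c d

  inputTape : List (Fin a) → Tape TapeSymbol
  inputTape []      = blankTape
  inputTape (x ∷ w) = tape [] (just (inj₁ x)) (List.map (λ y → just (inj₁ y)) w)

  initial : List (Fin a) → Config
  initial w = start , inputTape w ∷ replicate extraTapes blankTape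

  -- The output is the longest word over Fin a that starts at the head of the
  -- first tape.
  readWord : List (Maybe TapeSymbol) → List (Fin a)
  readWord (just (inj₁ x) ∷ cs) = x ∷ readWord cs
  readWord _                    = []

  output : Config → List (Fin a)
  output (_ , t ∷ _) = readWord (scanned t ∷ after t)

OutputsWithin : ∀ {a} → TM a → List (Fin a) → List (Fin a) → ℕ → Set
OutputsWithin M w u T =
  ∃[ n ] ∃[ d ] (n ≤ T × HaltsIn n (initial w) d × output d ≡ u)
  where open TM M

data Poly (k : ℕ) : Set where
  const     : ℕ → Poly k
  var       : Fin k → Poly k
  _:+_ _:*_ : Poly k → Poly k → Poly k

eval : ∀ {k} → Poly k → Vec ℕ k → ℕ
eval (const c) xs = c
eval (var i)   xs = lookup xs i
eval (p :+ q)  xs = eval p xs + eval q xs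
eval (p :* q)  xs = eval p xs * eval q xs

ComputesDAGIn : ∀ {𝔸 k} → TM (letters 𝔸) → Fun 𝔸 k → Poly k → Set
ComputesDAGIn {𝔸} {k} M f p =
  (vs : Vec (Term 𝔸) k) →
  Σ[ G ∈ Graph 𝔸 ]
    IsDAGOf (f vs) G ×
    OutputsWithin M (encodeInputs vs) (encodeGraph G) (eval p (Vec.map size vs))

-- Terms are represented by pointers into an append-only store of hash-consed
-- nodes, and a simultaneous recursion on a node visits the nodes reachable from
-- it once each, in increasing order, tabulating the values of all its functions.
--
-- Tiering keeps the store small: up to the subterms of its arguments of tier m, a
-- function f ▷ p₁ × … × pₖ ⟶ m has only polynomially many subterms in its value,
-- in terms of the numbers of distinct subterms of its arguments of tiers greater
-- than m.  In a recursion on an argument of tier p > m the previous results have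
-- tier m, so every visited node adds a number of subterms that does not depend on
-- these results, and the numbers add up instead of multiplying.  Hence all
-- intermediate values have polynomially many distinct subterms, the evaluation
-- creates polynomially many nodes, and all indices can be kept in unary on the
-- tapes, used as stacks, of a machine that finds nodes and table entries by linear
-- search.

module Submission where

open import Defs
open import Data.Bool using (Bool; true; false; if_then_else_; not; _∧_; T)
open import Data.Fin as Fin using (Fin; zero; suc; toℕ; fromℕ<; splitAt; _↑ˡ_; _↑ʳ_)
import Data.Fin.Properties as Fin
open import Data.List as List using (List; []; _∷_; [_]; _++_; length; _ʳ++_; map; head; concatMap)
import Data.List.Properties as List
open import Data.List.Membership.Propositional using () renaming (_∈_ to _∈ᴸ_)
open import Data.List.Membership.Propositional.Properties using (∈-++⁺ˡ; ∈-++⁺ʳ; ∈-++⁻; ∈-lookup)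
open import Data.List.Relation.Unary.All as All using (All; []; _∷_)
import Data.List.Relation.Unary.All.Properties as All
open import Data.List.Relation.Unary.AllPairs using (AllPairs; []; _∷_)
open import Data.List.Relation.Unary.Any using (here; there; index)
open import Data.List.Relation.Unary.Any.Properties using (lookup-index)
open import Data.Maybe using (Maybe; just; nothing; maybe)
open import Data.Nat using (ℕ; zero; suc; _+_; _*_; _≤_; _<_; z≤n; s≤s)
open import Data.Nat.Properties
open import Data.Product using (Σ-syntax; ∃; ∃-syntax; _×_; _,_; proj₁; proj₂; map₁)
open import Data.Sum using (_⊎_; inj₁; inj₂)
open import Data.Unit using (⊤; tt)
open import Data.Vec as Vec using (Vec; []; _∷_; lookup; tabulate; replicate; toList; updateAt; _[_]≔_)
import Data.Vec.Properties as Vec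
open import Data.Vec.Relation.Binary.Pointwise.Inductive as Pointwise using (Pointwise; []; _∷_)
open import Data.Vec.Relation.Unary.All as VAll using ([]; _∷_) renaming (All to VAll)
import Data.Vec.Relation.Unary.All.Properties as VAll
open import Data.Vec.Membership.Propositional using () renaming (_∈_ to _∈ᵛ_)
open import Data.Vec.Relation.Unary.Any using (here; there)
open import Function using (_∘_; id)
open import Relation.Binary.Construct.Closure.ReflexiveTransitive using (Star; ε; _◅_) renaming (_◅◅_ to _◅◅ˢ_)
open import Relation.Binary.Construct.Closure.Transitive as Plus using (TransClosure)
open import Relation.Binary.PropositionalEquality
  using (_≡_; _≢_; refl; sym; trans; cong; cong₂; subst; module ≡-Reasoning)
open import Relation.Nullary using (¬_; yes; no; does; contradiction)
open import Relation.Nullary.Decidable using (dec-true; dec-false)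

-- Two bounds are kept apart. `SizeBound` counts the subterms of a value; `Computes` counts the
-- nodes that an evaluation adds to the store, including those of intermediate values that are
-- dropped later. The tiers enter through the former only. It has to come beforehand: the growth at
-- one node of a recursion depends on the sizes of the previous results, and reading these sizes off
-- the growth would be circular. Once they are bounded, growth is estimated for arguments bounded by
-- a common `s`, whatever their tiers. A term may be exponentially larger than its DAG, so bounds
-- are witnessed by subterm-closed lists, and the induction for a recursion runs along such a list.
-- Time needs no analysis of its own: it is a polynomial, read off the text of the program, in one
-- parameter `N` bounding the order of the final store and the length of the input. As the final
-- store is known only at the end, runs are stated for every sufficiently large `N`. The final store
-- also holds nodes that the result does not reach, whereas a DAG is rooted; hence the reachable
-- part is renumbered before it is written.

infix 8 _at_

_at_ : Poly 1 → ℕ → ℕ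
p at N = eval p (N ∷ [])

-- Structured programs

module Machine (a : ℕ) where

  Sym : Set
  Sym = Fin a ⊎ Fin 1

  -- An iterated product rather than a vector: by eta, reading and updating a stack at a concrete
  -- index reduces for every state.
  St : ℕ → Set
  St zero    = ⊤
  St (suc n) = List Sym × St n

  get : ∀ {n} → Fin n → St n → List Sym
  get zero    σ = proj₁ σ
  get (suc A) σ = get A (proj₂ σ)

  set : ∀ {n} → Fin n → List Sym → St n → St n
  set zero    x σ = x , proj₂ σ
  set (suc A) x σ = proj₁ σ , set A x (proj₂ σ)

  tops : ∀ {n} → St n → Vec (Maybe Sym) n
  tops {zero}  _       = []
  tops {suc n} (x , σ) = head x ∷ tops σ

  lookup-tops : ∀ {n} (A : Fin n) (σ : St n) → lookup (tops σ) A ≡ head (get A σ)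
  lookup-tops zero    σ = refl
  lookup-tops (suc A) σ = lookup-tops A (proj₂ σ)

  get-set : ∀ {n} (A : Fin n) x σ → get A (set A x σ) ≡ x
  get-set zero    x σ = refl
  get-set (suc A) x σ = get-set A x (proj₂ σ)

  get-set-≢ : ∀ {n} (A B : Fin n) x σ → A ≢ B → get A (set B x σ) ≡ get A σ
  get-set-≢ zero    zero    x σ A≢B = contradiction refl A≢B
  get-set-≢ zero    (suc B) x σ A≢B = refl
  get-set-≢ (suc A) zero    x σ A≢B = refl
  get-set-≢ (suc A) (suc B) x σ A≢B = get-set-≢ A B x (proj₂ σ) (A≢B ∘ cong suc)

  set-set : ∀ {n} (A : Fin n) x y σ → set A x (set A y σ) ≡ set A x σ
  set-set zero    x y σ = refl
  set-set (suc A) x y σ = cong (proj₁ σ ,_) (set-set A x y (proj₂ σ))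

  set-get : ∀ {n} (A : Fin n) σ → set A (get A σ) σ ≡ σ
  set-get zero    σ = refl
  set-get (suc A) σ = cong (proj₁ σ ,_) (set-get A (proj₂ σ))

  set-comm : ∀ {n} (A B : Fin n) x y σ → A ≢ B →
             set A x (set B y σ) ≡ set B y (set A x σ)
  set-comm zero    zero    x y σ A≢B = contradiction refl A≢B
  set-comm zero    (suc B) x y σ A≢B = refl
  set-comm (suc A) zero    x y σ A≢B = refl
  set-comm (suc A) (suc B) x y σ A≢B =
    cong (proj₁ σ ,_) (set-comm A B x y (proj₂ σ) (A≢B ∘ cong suc))

  -- The polynomial in a loop bounds its number of iterations in terms of a
  -- parameter N of the whole run; it does not influence the execution.
  data Prog (r : ℕ) : Set where
    nop    : Prog r
    push   : Fin r → Sym → Prog r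
    dup    : Fin r → Fin r → Prog r
    pop    : Fin r → Prog r
    _⨾_    : Prog r → Prog r → Prog r
    branch : (Vec (Maybe Sym) r → Bool) → Prog r → Prog r → Prog r
    while  : (Vec (Maybe Sym) r → Bool) → Poly 1 → Prog r → Prog r

  infixr 5 _⨾_

  private variable
    r t t′ m n : ℕ
    P Q : Prog r
    σ σ′ σ″ : St r

  -- The index is the exact number of steps of the compiled program. `push` and `dup` take two, one
  -- to move left and one to write. In between, `dup` must still scan the symbol to be copied,
  -- whence `A ≢ B`.
  data Exec {r} : Prog r → St r → ℕ → St r → Set where
    nop     : Exec nop σ 1 σ
    push    : ∀ {A s} → Exec (push A s) σ 2 (set A (s ∷ get A σ) σ)
    dup     : ∀ {A B s w} → A ≢ B → get A σ ≡ s ∷ w →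
              Exec (dup A B) σ 2 (set B (s ∷ get B σ) σ)
    pop     : ∀ {A s w} → get A σ ≡ s ∷ w → Exec (pop A) σ 1 (set A w σ)
    seq     : Exec P σ t σ′ → Exec Q σ′ t′ σ″ → Exec (P ⨾ Q) σ (t + t′) σ″
    branchT : ∀ {b} → b (tops σ) ≡ true → Exec P σ t σ′ →
              Exec (branch b P Q) σ (suc t) σ′
    branchF : ∀ {b} → b (tops σ) ≡ false → Exec Q σ t σ′ →
              Exec (branch b P Q) σ (suc t) σ′
    whileF  : ∀ {b κ} → b (tops σ) ≡ false → Exec (while b κ P) σ 1 σ
    whileT  : ∀ {b κ} → b (tops σ) ≡ true → Exec P σ t σ′ →
              Exec (while b κ P) σ′ t′ σ″ →
              Exec (while b κ P) σ (suc (t + t′)) σ″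

  -- `Poly` has no maximum, so a branch is charged for both arms. A loop is charged one test per
  -- iteration and the final test that fails.
  cost : Prog r → Poly 1
  cost nop            = const 1
  cost (push _ _)     = const 2
  cost (dup _ _)      = const 2
  cost (pop _)        = const 1
  cost (P ⨾ Q)        = cost P :+ cost Q
  cost (branch _ P Q) = const 1 :+ (cost P :+ cost Q)
  cost (while _ κ P)  = const 1 :+ (κ :* (const 1 :+ cost P))

  -- Compilation to multitape machines.  A stack is kept on the scanned cell and
  -- the cells to its right; what is on the left of the head is irrelevant.

  Actions : ℕ → Set
  Actions r = Vec (Maybe Sym × Move) r

  -- The successor `nothing` means leaving the program fragment. When fragments are put together,
  -- `goto` relocates the inner states and redirects this exit.
  Control : ℕ → ℕ → Set
  Control r m = Fin m → Vec (Maybe Sym) r → Maybe (Fin m) × Actions r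

  idle : Vec (Maybe Sym) r → Actions r
  idle = Vec.map (_, stay)

  only : Fin r → Maybe Sym × Move → Vec (Maybe Sym) r → Actions r
  only A x cs = idle cs [ A ]≔ x

  count : Prog r → ℕ
  count nop            = 1
  count (push _ _)     = 2
  count (dup _ _)      = 2
  count (pop _)        = 1
  count (P ⨾ Q)        = count P + count Q
  count (branch _ P Q) = suc (count P + count Q)
  count (while _ _ P)  = suc (count P)

  entry : (P : Prog r) → Fin (count P)
  entry nop            = zero
  entry (push _ _)     = zero
  entry (dup _ _)      = zero
  entry (pop _)        = zero
  entry (P ⨾ Q)        = entry P ↑ˡ count Q
  entry (branch _ _ _) = zero
  entry (while _ _ _)  = zero

  goto : {X : Set} → (Fin m → Fin n) → Maybe (Fin n) →
         Maybe (Fin m) × X → Maybe (Fin n) × X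
  goto f k = map₁ (maybe (just ∘ f) k)

  control : (P : Prog r) → Control r (count P)
  control nop            _          cs = nothing , idle cs
  control (push A s)     zero       cs = just (suc zero) , only A (lookup cs A , left) cs
  control (push A s)     (suc zero) cs = nothing , only A (just s , stay) cs
  control (dup A B)      zero       cs = just (suc zero) , only B (lookup cs B , left) cs
  control (dup A B)      (suc zero) cs = nothing , only B (lookup cs A , stay) cs
  control (pop A)        _          cs = nothing , only A (lookup cs A , right) cs
  control (P ⨾ Q)        q          cs with splitAt (count P) q
  ... | inj₁ p  = goto (_↑ˡ count Q) (just (count P ↑ʳ entry Q)) (control P p cs)
  ... | inj₂ p  = goto (count P ↑ʳ_) nothing (control Q p cs)
  control (branch b P Q) zero       cs =
    just (suc (if b cs then entry P ↑ˡ count Q else count P ↑ʳ entry Q)) , idle cs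
  control (branch b P Q) (suc q)    cs with splitAt (count P) q
  ... | inj₁ p  = goto (λ p → suc (p ↑ˡ count Q)) nothing (control P p cs)
  ... | inj₂ p  = goto (λ p → suc (count P ↑ʳ p)) nothing (control Q p cs)
  control (while b κ P)  zero       cs =
    (if b cs then just (suc (entry P)) else nothing) , idle cs
  control (while b κ P)  (suc q)    cs = goto suc (just zero) (control P q cs)

  Tapes : ℕ → Set
  Tapes r = Vec (Tape Sym) r

  infix 3 _⊢_⟶[_]_
  data _⊢_⟶[_]_ (δ : Control r m) : Maybe (Fin m) × Tapes r → ℕ → Maybe (Fin m) × Tapes r → Set where
    stop : ∀ {c} → δ ⊢ c ⟶[ 0 ] c
    step : ∀ {q ts c} →
           δ ⊢ proj₁ (δ q (Vec.map scanned ts)) ,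
               Vec.zipWith act (proj₂ (δ q (Vec.map scanned ts))) ts ⟶[ t ] c →
           δ ⊢ just q , ts ⟶[ suc t ] c

  infixr 5 _◅◅_
  _◅◅_ : ∀ {δ : Control r m} {c d e} → δ ⊢ c ⟶[ t ] d → δ ⊢ d ⟶[ t′ ] e → δ ⊢ c ⟶[ t + t′ ] e
  stop   ◅◅ s′ = s′
  step s ◅◅ s′ = step (s ◅◅ s′)

  embed : ∀ {δ : Control r m} {δ′ : Control r n} (f : Fin m → Fin n) (k : Maybe (Fin n)) →
          (∀ q cs → δ′ (f q) cs ≡ goto f k (δ q cs)) →
          ∀ {c d ts ts′} → δ ⊢ c , ts ⟶[ t ] d , ts′ →
          δ′ ⊢ maybe (just ∘ f) k c , ts ⟶[ t ] maybe (just ∘ f) k d , ts′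
  embed f k h stop = stop
  embed {t = suc t} {δ = δ} {δ′} f k h (step {q = q} {ts = ts} s) = step
    (subst (λ x → δ′ ⊢ proj₁ x , Vec.zipWith act (proj₂ x) ts ⟶[ t ] _)
      (sym (h q (Vec.map scanned ts))) (embed f k h s))

  -- Trailing blanks have to be allowed: an empty stack scans an explicit blank, and a later push
  -- leaves this blank on its right.
  record Rep₁ (t : Tape Sym) (w : List Sym) : Set where
    constructor rep
    field
      padding : ℕ
      content : scanned t ∷ after t ≡ map just w ++ List.replicate padding nothing

  Rep : ∀ {r} → Tapes r → St r → Set
  Rep {zero}  []       _       = ⊤
  Rep {suc r} (t ∷ ts) (w , σ) = Rep₁ t w × Rep ts σ

  scanned-head : ∀ {t w} → Rep₁ t w → scanned t ≡ head w
  scanned-head {w = []}    (rep (suc n) eq) = List.∷-injectiveˡ eq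
  scanned-head {w = s ∷ w} (rep n eq)       = List.∷-injectiveˡ eq

  scanned-tops : ∀ {r} {ts : Tapes r} {σ} → Rep ts σ → Vec.map scanned ts ≡ tops σ
  scanned-tops {zero}  {[]}     _         = refl
  scanned-tops {suc r} {t ∷ ts} (ρ , ρs) = cong₂ _∷_ (scanned-head ρ) (scanned-tops {ts = ts} ρs)

  Rep-get : ∀ {r} {ts : Tapes r} {σ} (A : Fin r) → Rep ts σ → Rep₁ (lookup ts A) (get A σ)
  Rep-get {ts = t ∷ ts} zero    (ρ , ρs) = ρ
  Rep-get {ts = t ∷ ts} (suc A) (ρ , ρs) = Rep-get A ρs

  Rep-set : ∀ {r} {ts : Tapes r} {σ} (A : Fin r) {f w} → Rep ts σ → Rep₁ (f (lookup ts A)) w →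
            Rep (updateAt ts A f) (set A w σ)
  Rep-set {ts = t ∷ ts} zero    (ρ , ρs) ρ′ = ρ′ , ρs
  Rep-set {ts = t ∷ ts} (suc A) (ρ , ρs) ρ′ = ρ , Rep-set A ρs ρ′

  act-idle : (ts : Tapes r) → Vec.zipWith act (idle (Vec.map scanned ts)) ts ≡ ts
  act-idle []       = refl
  act-idle (t ∷ ts) = cong (t ∷_) (act-idle ts)

  act-only : (A : Fin r) (x : Maybe Sym × Move) (ts : Tapes r) →
             Vec.zipWith act (only A x (Vec.map scanned ts)) ts ≡ updateAt ts A (act x)
  act-only zero    x (t ∷ ts) = cong (act x t ∷_) (act-idle ts)
  act-only (suc A) x (t ∷ ts) = cong (t ∷_) (act-only A x ts)

  Rep₁-push : ∀ {s t w} → Rep₁ t w → Rep₁ (act (just s , stay) (act (scanned t , left) t)) (s ∷ w)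
  Rep₁-push {t = tape []       _ _} (rep n eq) = rep n (cong (_ ∷_) eq)
  Rep₁-push {t = tape (_ ∷ _) _ _} (rep n eq) = rep n (cong (_ ∷_) eq)

  Rep₁-pop : ∀ {s t w} → Rep₁ t (s ∷ w) → Rep₁ (act (scanned t , right) t) w
  Rep₁-pop {t = tape _ _ (_ ∷ _)} {w}  (rep n eq) = rep n (List.∷-injectiveʳ eq)
  Rep₁-pop {t = tape _ _ []}      {[]} (rep n eq) = rep 1 refl

  step-only : ∀ {δ : Control r m} {q ts c A x} →
              let cs = Vec.map scanned ts in
              proj₂ (δ q cs) ≡ only A x cs →
              δ ⊢ proj₁ (δ q cs) , updateAt ts A (act x) ⟶[ t ] c →
              δ ⊢ just q , ts ⟶[ suc t ] c
  step-only {t = t} {δ = δ} {q} {ts} {c} {A} {x} eq s = step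
    (subst (λ ts′ → δ ⊢ proj₁ (δ q (Vec.map scanned ts)) , ts′ ⟶[ t ] c)
      (sym (trans (cong (λ as → Vec.zipWith act as ts) eq) (act-only A x ts))) s)

  step-idle : ∀ {δ : Control r m} {q ts c} k →
              let cs = Vec.map scanned ts in
              δ q cs ≡ (k , idle cs) →
              δ ⊢ k , ts ⟶[ t ] c → δ ⊢ just q , ts ⟶[ suc t ] c
  step-idle {t = t} {δ = δ} {q} {ts} {c} k eq s = step
    (subst (λ x → δ ⊢ proj₁ x , Vec.zipWith act (proj₂ x) ts ⟶[ t ] c) (sym eq)
      (subst (λ ts′ → δ ⊢ k , ts′ ⟶[ t ] c) (sym (act-idle ts)) s))

  compiled : ∀ {r} {P : Prog r} {σ σ′} → Exec P σ t σ′ → ∀ {ts} → Rep ts σ →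
             ∃[ ts′ ] (Rep ts′ σ′ × (control P ⊢ just (entry P) , ts ⟶[ t ] nothing , ts′))
  compiled nop {ts} ρ = ts , ρ , step-idle nothing refl stop
  compiled (push {A = A} {s}) {ts} ρ = _ , ρ″ , step-only refl (step-only refl stop)
    where
    ts₁ = updateAt ts A (act (lookup (Vec.map scanned ts) A , left))
    ρ″ : Rep (updateAt ts₁ A (act (just s , stay))) _
    ρ″ = subst (λ ts′ → Rep ts′ _) (sym (Vec.updateAt-updateAt A ts))
      (Rep-set A ρ (subst (λ c → Rep₁ (act (just s , stay) (act (c , left) (lookup ts A))) _)
        (sym (Vec.lookup-map A scanned ts)) (Rep₁-push (Rep-get A ρ))))
  compiled (dup {A = A} {B} {s} {w} A≢B eq) {ts} ρ = _ , ρ″ , step-only refl (step-only refl stop)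
    where
    ts₁ = updateAt ts B (act (lookup (Vec.map scanned ts) B , left))
    top : lookup (Vec.map scanned ts₁) A ≡ just s
    top = begin
      lookup (Vec.map scanned ts₁) A ≡⟨ Vec.lookup-map A scanned ts₁ ⟩
      scanned (lookup ts₁ A)         ≡⟨ cong scanned (Vec.lookup∘updateAt′ A B A≢B ts) ⟩
      scanned (lookup ts A)          ≡⟨ scanned-head (Rep-get A ρ) ⟩
      head (get A _)                 ≡⟨ cong head eq ⟩
      just s                         ∎
      where open ≡-Reasoning
    ρ″ : Rep (updateAt ts₁ B (act (lookup (Vec.map scanned ts₁) A , stay))) _
    ρ″ = subst (λ c → Rep (updateAt ts₁ B (act (c , stay))) _) (sym top)
      (subst (λ ts′ → Rep ts′ _) (sym (Vec.updateAt-updateAt B ts))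
        (Rep-set B ρ (subst (λ c → Rep₁ (act (just s , stay) (act (c , left) (lookup ts B))) _)
          (sym (Vec.lookup-map B scanned ts)) (Rep₁-push (Rep-get B ρ)))))
  compiled (pop {A = A} {s} {w} eq) {ts} ρ = _ , ρ′ , step-only refl stop
    where
    ρ′ : Rep (updateAt ts A (act (lookup (Vec.map scanned ts) A , right))) _
    ρ′ = Rep-set A ρ (subst (λ c → Rep₁ (act (c , right) (lookup ts A)) w)
      (sym (Vec.lookup-map A scanned ts)) (Rep₁-pop (subst (Rep₁ (lookup ts A)) eq (Rep-get A ρ))))
  compiled (seq {P = P} {Q = Q} e e′) ρ =
    let ts′ , ρ′ , s  = compiled e ρ
        ts″ , ρ″ , s′ = compiled e′ ρ′
    in ts″ , ρ″ , embed (_↑ˡ count Q) _ inˡ s ◅◅ embed (count P ↑ʳ_) nothing inʳ s′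
    where
    inˡ : ∀ q cs → control (P ⨾ Q) (q ↑ˡ count Q) cs ≡ _
    inˡ q cs rewrite Fin.splitAt-↑ˡ (count P) q (count Q) = refl
    inʳ : ∀ q cs → control (P ⨾ Q) (count P ↑ʳ q) cs ≡ _
    inʳ q cs rewrite Fin.splitAt-↑ʳ (count P) (count Q) q = refl
  compiled (branchT {σ = σ} {P = P} {Q = Q} {b = b} eq e) {ts} ρ =
    let ts′ , ρ′ , s = compiled e ρ
    in ts′ , ρ′ , step-idle _
         (cong (λ x → just (suc (if x then entry P ↑ˡ count Q else count P ↑ʳ entry Q)) , idle (Vec.map scanned ts))
           (trans (cong b (scanned-tops ρ)) eq))
         (embed (λ p → suc (p ↑ˡ count Q)) nothing inˡ s)
    where
    inˡ : ∀ q cs → control (branch b P Q) (suc (q ↑ˡ count Q)) cs ≡ _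
    inˡ q cs rewrite Fin.splitAt-↑ˡ (count P) q (count Q) = refl
  compiled (branchF {σ = σ} {Q = Q} {P = P} {b = b} eq e) {ts} ρ =
    let ts′ , ρ′ , s = compiled e ρ
    in ts′ , ρ′ , step-idle _
         (cong (λ x → just (suc (if x then entry P ↑ˡ count Q else count P ↑ʳ entry Q)) , idle (Vec.map scanned ts))
           (trans (cong b (scanned-tops ρ)) eq))
         (embed (λ p → suc (count P ↑ʳ p)) nothing inʳ s)
    where
    inʳ : ∀ q cs → control (branch b P Q) (suc (count P ↑ʳ q)) cs ≡ _
    inʳ q cs rewrite Fin.splitAt-↑ʳ (count P) (count Q) q = refl
  compiled (whileF {P = P} {b = b} eq) {ts} ρ = ts , ρ , step-idle nothing
    (cong (λ x → (if x then just (suc (entry P)) else nothing) , idle (Vec.map scanned ts))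
      (trans (cong b (scanned-tops ρ)) eq)) stop
  compiled (whileT {P = P} {b = b} eq e e′) {ts} ρ =
    let ts′ , ρ′ , s  = compiled e ρ
        ts″ , ρ″ , s′ = compiled e′ ρ′
    in ts″ , ρ″ , step-idle (just (suc (entry P)))
         (cong (λ x → (if x then just (suc (entry P)) else nothing) , idle (Vec.map scanned ts))
           (trans (cong b (scanned-tops ρ)) eq))
         (embed suc (just zero) (λ _ _ → refl) s ◅◅ s′)

  -- The added state `zero` is the halting state, entered when control leaves the program. The one
  -- extra symbol is the end mark of words on the stacks.
  machine : ∀ {r} → Prog (suc r) → TM a
  machine {r} P = record
    { extraTapes   = r
    ; extraSymbols = 1
    ; states       = suc (count P)
    ; start        = suc (entry P)
    ; δ            = λ where
        zero    cs → nothing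
        (suc q) cs → just (maybe suc zero (proj₁ (control P q cs)) , proj₂ (control P q cs))
    }

  halts : ∀ {r} (P : Prog (suc r)) {q ts ts′} → control P ⊢ q , ts ⟶[ t ] nothing , ts′ →
          TM.HaltsIn (machine P) t (maybe suc zero q , ts) (zero , ts′)
  halts P stop     = TM.halt refl
  halts P (step s) = TM.next refl (halts P s)

  blanks : ∀ {n} → St n
  blanks {zero}  = tt
  blanks {suc n} = [] , blanks

  Rep-blanks : ∀ {n} → Rep (replicate n blankTape) blanks
  Rep-blanks {zero}  = tt
  Rep-blanks {suc n} = rep 1 refl , Rep-blanks

  Rep-input : ∀ {r} (P : Prog (suc r)) w → Rep₁ (TM.inputTape (machine P) w) (map inj₁ w)
  Rep-input P []      = rep 1 refl
  Rep-input P (x ∷ w) = rep 0 (cong (just (inj₁ x) ∷_)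
    (trans (List.map-∘ w) (sym (List.++-identityʳ _))))

  readWord-map : ∀ {r} (P : Prog (suc r)) w n →
    TM.readWord (machine P) (map just (map inj₁ w) ++ List.replicate n nothing) ≡ w
  readWord-map P []      zero    = refl
  readWord-map P []      (suc n) = refl
  readWord-map P (x ∷ w) n       = cong (x ∷_) (readWord-map P w n)

  machine-correct : ∀ {r} (P : Prog (suc r)) {w u T σ} →
    Exec P (map inj₁ w , blanks) t (map inj₁ u , σ) → t ≤ T → OutputsWithin (machine P) w u T
  machine-correct {t = t} {r} P {w} {u} e t≤T
    with compiled {r = suc r} {P = P} e {inputTape w ∷ replicate r blankTape} (Rep-input P w , Rep-blanks)
    where open TM (machine P) using (inputTape)
  ... | t₀ ∷ ts , (rep n eq , _) , s =
    t , _ , t≤T , halts P s , trans (cong (TM.readWord (machine P)) eq) (readWord-map P u n)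

-- Derived execution rules with time bounds

module Macros (a : ℕ) where

  open Machine a public

  private variable
    r n N : ℕ

  -- The bound depends on the program and `N` only, so it composes automatically; the sole
  -- arithmetic obligation is the number of iterations in `while!`.
  record Run (N : ℕ) (P : Prog r) (σ σ′ : St r) : Set where
    constructor run
    field
      {time} : ℕ
      bound  : time ≤ cost P at N
      exec   : Exec P σ time σ′

  infixr 5 _▸_
  _▸_ : ∀ {P Q : Prog r} {σ σ′ σ″} → Run N P σ σ′ → Run N Q σ′ σ″ → Run N (P ⨾ Q) σ σ″
  run le e ▸ run le′ e′ = run (+-mono-≤ le le′) (seq e e′)

  nop! : {σ : St r} → Run N nop σ σ
  nop! = run ≤-refl nop

  push! : ∀ {A : Fin r} {s σ} → Run N (push A s) σ (set A (s ∷ get A σ) σ)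
  push! = run ≤-refl push

  pop! : ∀ {A : Fin r} {s w σ} → get A σ ≡ s ∷ w → Run N (pop A) σ (set A w σ)
  pop! eq = run ≤-refl (pop eq)

  dup! : ∀ {A B : Fin r} {s w σ} → A ≢ B → get A σ ≡ s ∷ w →
         Run N (dup A B) σ (set B (s ∷ get B σ) σ)
  dup! A≢B eq = run ≤-refl (dup A≢B eq)

  then! : ∀ {b} {P Q : Prog r} {σ σ′} → b (tops σ) ≡ true → Run N P σ σ′ → Run N (branch b P Q) σ σ′
  then! eq (run le e) = run (s≤s (≤-trans le (m≤m+n _ _))) (branchT eq e)

  else! : ∀ {b} {P Q : Prog r} {σ σ′} → b (tops σ) ≡ false → Run N Q σ σ′ → Run N (branch b P Q) σ σ′
  else! eq (run le e) = run (s≤s (≤-trans le (m≤n+m _ _))) (branchF eq e)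

  infixr 5 _▹_
  data Iter (N : ℕ) (b : Vec (Maybe Sym) r → Bool) (P : Prog r) : St r → ℕ → St r → Set where
    done : ∀ {σ} → Iter N b P σ 0 σ
    _▹_  : ∀ {σ σ′ σ″} → b (tops σ) ≡ true × Run N P σ σ′ → Iter N b P σ′ n σ″ → Iter N b P σ (suc n) σ″

  _▹▹_ : ∀ {b m} {P : Prog r} {σ σ′ σ″} → Iter N b P σ m σ′ → Iter N b P σ′ n σ″ → Iter N b P σ (m + n) σ″
  done    ▹▹ y = y
  (e ▹ x) ▹▹ y = e ▹ (x ▹▹ y)

  while! : ∀ {b κ} {P : Prog r} {σ σ′} → Iter N b P σ n σ′ → b (tops σ′) ≡ false → n ≤ κ at N →
           Run N (while b κ P) σ σ′
  while! {N = N} {n = n} {b = b} {κ} {P} it off n≤κ =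
    let t , le , e = loop it {off} in run (≤-trans le (s≤s (*-monoˡ-≤ _ n≤κ))) e
    where
    loop : ∀ {σ n σ′} → Iter N b P σ n σ′ → {b (tops σ′) ≡ false} →
           ∃[ t ] (t ≤ suc (n * suc (cost P at N)) × Exec (while b κ P) σ t σ′)
    loop done {off} = 1 , ≤-refl , whileF off
    loop {n = suc n} ((eq , run {t} le e) ▹ it) {off} =
      let t′ , le′ , e′ = loop it {off} in
      suc (t + t′) ,
      s≤s (≤-trans (+-mono-≤ le le′) (≤-reflexive (+-suc (cost P at N) (n * suc (cost P at N))))) ,
      whileT eq e e′

  -- Subroutines on a selection of the stacks

  distinct : Vec (Fin r) n → Bool
  fresh    : Fin r → Vec (Fin r) n → Bool
  distinct []       = true
  distinct (A ∷ As) = fresh A As ∧ distinct As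
  fresh A []       = true
  fresh A (B ∷ Bs) = not (does (A Fin.≟ B)) ∧ fresh A Bs

  rename : Vec (Fin r) n → Prog n → Prog r
  rename As nop            = nop
  rename As (push A s)     = push (lookup As A) s
  rename As (dup A B)      = dup (lookup As A) (lookup As B)
  rename As (pop A)        = pop (lookup As A)
  rename As (P ⨾ Q)        = rename As P ⨾ rename As Q
  rename As (branch b P Q) = branch (λ cs → b (Vec.map (lookup cs) As)) (rename As P) (rename As Q)
  rename As (while b κ P)  = while (λ cs → b (Vec.map (lookup cs) As)) κ (rename As P)

  readAll : Vec (Fin r) n → St r → St n
  readAll []       σ = tt
  readAll (A ∷ As) σ = get A σ , readAll As σ

  writeAll : Vec (Fin r) n → St n → St r → St r
  writeAll []       s       σ = σ
  writeAll (A ∷ As) (x , s) σ = set A x (writeAll As s σ)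

  cost-rename : (As : Vec (Fin r) n) (P : Prog n) → cost (rename As P) ≡ cost P
  cost-rename As nop            = refl
  cost-rename As (push A s)     = refl
  cost-rename As (dup A B)      = refl
  cost-rename As (pop A)        = refl
  cost-rename As (P ⨾ Q)        = cong₂ _:+_ (cost-rename As P) (cost-rename As Q)
  cost-rename As (branch b P Q) =
    cong₂ (λ x y → const 1 :+ (x :+ y)) (cost-rename As P) (cost-rename As Q)
  cost-rename As (while b κ P)  = cong (λ x → const 1 :+ (κ :* (const 1 :+ x))) (cost-rename As P)

  distinct-tail : ∀ (A : Fin r) (As : Vec (Fin r) n) → T (distinct (A ∷ As)) → T (distinct As)
  distinct-tail A As d with fresh A As
  ... | true = d

  fresh-lookup : ∀ (A : Fin r) (As : Vec (Fin r) n) → T (distinct (A ∷ As)) →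
                 ∀ i → lookup As i ≢ A
  fresh-lookup A (B ∷ As) d i eq with A Fin.≟ B
  fresh-lookup A (B ∷ As) d zero    eq | no A≢B = A≢B (sym eq)
  fresh-lookup A (B ∷ As) d (suc i) eq | no A≢B = fresh-lookup A As d′ i eq
    where
    d′ : T (distinct (A ∷ As))
    d′ with fresh A As
    ... | true = distinct-tail B As d

  lookup-injective : ∀ (As : Vec (Fin r) n) → T (distinct As) → ∀ i j → lookup As i ≡ lookup As j → i ≡ j
  lookup-injective (A ∷ As) d zero    zero    eq = refl
  lookup-injective (A ∷ As) d zero    (suc j) eq = contradiction (sym eq) (fresh-lookup A As d j)
  lookup-injective (A ∷ As) d (suc i) zero    eq = contradiction eq (fresh-lookup A As d i)
  lookup-injective (A ∷ As) d (suc i) (suc j) eq =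
    cong suc (lookup-injective As (distinct-tail A As d) i j eq)

  get-writeAll : (As : Vec (Fin r) n) → T (distinct As) → ∀ i s σ →
                 get (lookup As i) (writeAll As s σ) ≡ get i s
  get-writeAll (A ∷ As) d zero    (x , s) σ = get-set A x _
  get-writeAll (A ∷ As) d (suc i) (x , s) σ =
    trans (get-set-≢ (lookup As i) A x _ (fresh-lookup A As d i))
          (get-writeAll As (distinct-tail A As d) i s σ)

  set-writeAll : (As : Vec (Fin r) n) → T (distinct As) → ∀ i y s σ →
                 set (lookup As i) y (writeAll As s σ) ≡ writeAll As (set i y s) σ
  set-writeAll (A ∷ As) d zero    y (x , s) σ = set-set A y x _
  set-writeAll (A ∷ As) d (suc i) y (x , s) σ =
    trans (set-comm (lookup As i) A y x _ (fresh-lookup A As d i))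
          (cong (set A x) (set-writeAll As (distinct-tail A As d) i y s σ))

  write-read : (As : Vec (Fin r) n) (σ : St r) → writeAll As (readAll As σ) σ ≡ σ
  write-read []       σ = refl
  write-read (A ∷ As) σ = trans (cong (set A (get A σ)) (write-read As σ)) (set-get A σ)

  tops-writeAll : ∀ {m} (As : Vec (Fin r) n) → T (distinct As) →
                  ∀ s σ (is : Vec (Fin n) m) →
                  Vec.map (lookup (tops (writeAll As s σ))) (Vec.map (lookup As) is) ≡
                  Vec.map (lookup (tops s)) is
  tops-writeAll As d s σ []       = refl
  tops-writeAll As d s σ (i ∷ is) = cong₂ _∷_
    (trans (lookup-tops (lookup As i) (writeAll As s σ))
      (trans (cong head (get-writeAll As d i s σ)) (sym (lookup-tops i s))))
    (tops-writeAll As d s σ is)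

  rename-tops : (As : Vec (Fin r) n) → T (distinct As) → ∀ s σ →
                Vec.map (lookup (tops (writeAll As s σ))) As ≡ tops s
  rename-tops As d s σ = begin
    Vec.map (lookup (tops (writeAll As s σ))) As
      ≡⟨ cong (Vec.map _) (sym (Vec.map-lookup-allFin As)) ⟩
    Vec.map (lookup (tops (writeAll As s σ))) (Vec.map (lookup As) (Vec.allFin _))
      ≡⟨ tops-writeAll As d s σ (Vec.allFin _) ⟩
    Vec.map (lookup (tops s)) (Vec.allFin _)
      ≡⟨ Vec.map-lookup-allFin (tops s) ⟩
    tops s ∎
    where open ≡-Reasoning

  renamed : (As : Vec (Fin r) n) → T (distinct As) → ∀ {P t s s′} σ → Exec P s t s′ →
            Exec (rename As P) (writeAll As s σ) t (writeAll As s′ σ)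
  renamed As d σ nop = nop
  renamed As d σ (push {σ = s} {A = A} {x}) =
    subst (Exec _ _ _) (trans (cong (λ w → set (lookup As A) (x ∷ w) (writeAll As s σ)) (get-writeAll As d A s σ))
                              (set-writeAll As d A _ s σ)) push
  renamed As d σ (dup {σ = s} {A = A} {B} {x} A≢B eq) =
    subst (Exec _ _ _) (trans (cong (λ w → set (lookup As B) (x ∷ w) (writeAll As s σ)) (get-writeAll As d B s σ))
                              (set-writeAll As d B _ s σ))
      (dup (A≢B ∘ lookup-injective As d A B) (trans (get-writeAll As d A s σ) eq))
  renamed As d σ (pop {σ = s} {A = A} eq) =
    subst (Exec _ _ _) (set-writeAll As d A _ s σ) (pop (trans (get-writeAll As d A s σ) eq))
  renamed As d σ (seq e e′) = seq (renamed As d σ e) (renamed As d σ e′)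
  renamed As d σ (branchT {σ = s} {b = b} eq e) =
    branchT (trans (cong b (rename-tops As d s σ)) eq) (renamed As d σ e)
  renamed As d σ (branchF {σ = s} {b = b} eq e) =
    branchF (trans (cong b (rename-tops As d s σ)) eq) (renamed As d σ e)
  renamed As d σ (whileF {σ = s} {b = b} eq) = whileF (trans (cong b (rename-tops As d s σ)) eq)
  renamed As d σ (whileT {σ = s} {b = b} eq e e′) =
    whileT (trans (cong b (rename-tops As d s σ)) eq) (renamed As d σ e) (renamed As d σ e′)

  -- Stacks outside `As` are framed, so a subroutine is specified on its own stacks alone. For
  -- concrete `As`, `T (distinct As)` computes to the unit type and `d` is inferred.
  call : (As : Vec (Fin r) n) {d : T (distinct As)} {P : Prog n} {σ : St r} {s′ : St n} →
         Run N P (readAll As σ) s′ → Run N (rename As P) σ (writeAll As s′ σ)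
  call {N = N} As {d} {P} {σ} {s′} (run {t} le e) = run
    (subst (λ p → t ≤ p at N) (sym (cost-rename As P)) le)
    (subst (λ σ₀ → Exec (rename As P) σ₀ t (writeAll As s′ σ)) (write-read As σ) (renamed As d σ e))

-- Words on stacks

module Words (a : ℕ) where

  open Macros a public

  Word : Set
  Word = List (Fin a)

  pattern end = inj₂ zero

  infixr 5 _∙_
  _∙_ : Word → List Sym → List Sym
  w ∙ x = map inj₁ w ++ end ∷ x

  infixr 5 _◁_
  _◁_ : List Word → List Sym → List Sym
  []       ◁ x = x
  (w ∷ ws) ◁ x = w ∙ ws ◁ x

  ∙-++ : ∀ v w {x} → map inj₁ v ++ (w ∙ x) ≡ (v ++ w) ∙ x
  ∙-++ []      w = refl
  ∙-++ (s ∷ v) w = cong (inj₁ s ∷_) (∙-++ v w)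

  pattern t0 = zero
  pattern t1 = suc zero
  pattern t2 = suc (suc zero)
  pattern t3 = suc (suc (suc zero))
  pattern t4 = suc (suc (suc (suc zero)))
  pattern t5 = suc (suc (suc (suc (suc zero))))
  pattern t6 = suc (suc (suc (suc (suc (suc zero)))))

  private variable
    N : ℕ

  on : ∀ {r} → Fin r → (Maybe Sym → Bool) → Vec (Maybe Sym) r → Bool
  on A p cs = p (lookup cs A)

  on₂ : ∀ {r} → Fin r → Fin r → (Maybe Sym → Maybe Sym → Bool) → Vec (Maybe Sym) r → Bool
  on₂ A B p cs = p (lookup cs A) (lookup cs B)

  letter? : Maybe Sym → Bool
  letter? (just (inj₁ _)) = true
  letter? _               = false

  nonempty? : Maybe Sym → Bool
  nonempty? (just _) = true
  nonempty? nothing  = false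

  -- A transfer reverses what it moves; hence a word that must keep its orientation travels through
  -- a scratch stack, in two transfers.
  transfer : Poly 1 → (Maybe Sym → Bool) → Prog 2
  transfer ℓ p = while (on t0 p) ℓ (dup t0 t1 ⨾ pop t0)

  transfer! : ∀ {ℓ p} w {x y} → All (λ s → p (just s) ≡ true) w → p (head x) ≡ false →
              length w ≤ ℓ at N →
              Run N (transfer ℓ p) (w ++ x , y , tt) (x , w ʳ++ y , tt)
  transfer! {N} {ℓ} {p} w {x} all off le = while! (loop w all) off le
    where
    loop : ∀ w {y} → All (λ s → p (just s) ≡ true) w →
           Iter N (on t0 p) (dup t0 t1 ⨾ pop t0) (w ++ x , y , tt) (length w) (x , w ʳ++ y , tt)
    loop []      []         = done
    loop (s ∷ w) (ok ∷ all) = (ok , dup! (λ ()) refl ▸ pop! refl) ▹ loop w all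

  all-letters : ∀ (w : Word) → All (λ s → letter? (just s) ≡ true) (map inj₁ w)
  all-letters w = All.map⁺ (All.universal (λ _ → refl) w)

  all-nonempty : ∀ w → All (λ s → nonempty? (just s) ≡ true) w
  all-nonempty = All.universal (λ _ → refl)

  transferWord! : ∀ {ℓ} w {x y} → length w ≤ ℓ at N →
    Run N (transfer ℓ letter?) (w ∙ x , y , tt) (end ∷ x , map inj₁ w ʳ++ y , tt)
  transferWord! w le = transfer! {p = letter?} (map inj₁ w) (all-letters w) refl
    (≤-trans (≤-reflexive (List.length-map inj₁ w)) le)

  length-spilled : ∀ (w : Word) → length (map {B = Sym} inj₁ w ʳ++ []) ≡ length w
  length-spilled w = trans (List.length-ʳ++ (map inj₁ w))
    (trans (+-identityʳ _) (List.length-map inj₁ w))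

  transferBack! : ∀ {ℓ} w {y} → length w ≤ ℓ at N →
    Run N (transfer ℓ nonempty?) (map inj₁ w ʳ++ [] , y , tt) ([] , map inj₁ w ++ y , tt)
  transferBack! {N} {ℓ} w {y} le =
    subst (λ y′ → Run N (transfer ℓ nonempty?) (z , y , tt) ([] , y′ , tt)) (List.ʳ++-ʳ++ (map inj₁ w))
      (subst (λ z′ → Run N (transfer ℓ nonempty?) (z′ , y , tt) ([] , z ʳ++ y , tt)) (List.++-identityʳ z)
        (transfer! {p = nonempty?} z (all-nonempty z) refl (≤-trans (≤-reflexive (length-spilled w)) le)))
    where z = map inj₁ w ʳ++ []

  copyTransfer : Poly 1 → Prog 3
  copyTransfer ℓ = while (on t0 nonempty?) ℓ (dup t0 t1 ⨾ dup t0 t2 ⨾ pop t0)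

  copyTransferBack! : ∀ {ℓ} w {x y} → length w ≤ ℓ at N →
    Run N (copyTransfer ℓ) (map inj₁ w ʳ++ [] , x , y , tt) ([] , map inj₁ w ++ x , map inj₁ w ++ y , tt)
  copyTransferBack! {N} {ℓ} w {x} {y} le =
    subst (λ f → Run N (copyTransfer ℓ) (z , x , y , tt) ([] , proj₁ f , proj₂ f , tt))
      (cong₂ _,_ (List.ʳ++-ʳ++ (map inj₁ w)) (List.ʳ++-ʳ++ (map inj₁ w)))
      (while! (loop z) refl (≤-trans (≤-reflexive (length-spilled w)) le))
    where
    z = map inj₁ w ʳ++ []
    loop : ∀ z {x y} → Iter N (on t0 nonempty?) (dup t0 t1 ⨾ dup t0 t2 ⨾ pop t0)
           (z , x , y , tt) (length z) ([] , z ʳ++ x , z ʳ++ y , tt)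
    loop []      = done
    loop (s ∷ z) = (refl , dup! (λ ()) refl ▸ dup! (λ ()) refl ▸ pop! refl) ▹ loop z

  -- The last tape is used as scratch space.

  moveItem₃ : Poly 1 → Prog 3
  moveItem₃ ℓ = rename (t0 ∷ t2 ∷ []) (transfer ℓ letter?) ⨾ pop t0 ⨾ push t1 end ⨾
                rename (t2 ∷ t1 ∷ []) (transfer ℓ nonempty?)

  moveItem₃! : ∀ {ℓ} w {x y} → length w ≤ ℓ at N →
               Run N (moveItem₃ ℓ) (w ∙ x , y , [] , tt) (x , w ∙ y , [] , tt)
  moveItem₃! w le =
    call (t0 ∷ t2 ∷ []) (transferWord! w le) ▸ pop! refl ▸ push! ▸
    call (t2 ∷ t1 ∷ []) (transferBack! w le)

  copyItem₃ : Poly 1 → Prog 3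
  copyItem₃ ℓ = rename (t0 ∷ t2 ∷ []) (transfer ℓ letter?) ⨾ push t1 end ⨾
                rename (t2 ∷ t0 ∷ t1 ∷ []) (copyTransfer ℓ)

  copyItem₃! : ∀ {ℓ} w {x y} → length w ≤ ℓ at N →
               Run N (copyItem₃ ℓ) (w ∙ x , y , [] , tt) (w ∙ x , w ∙ y , [] , tt)
  copyItem₃! w le =
    call (t0 ∷ t2 ∷ []) (transferWord! w le) ▸ push! ▸
    call (t2 ∷ t0 ∷ t1 ∷ []) (copyTransferBack! w le)

  dropItem₁ : Poly 1 → Prog 1
  dropItem₁ ℓ = while (on t0 letter?) ℓ (pop t0) ⨾ pop t0

  dropItem₁! : ∀ {ℓ} w {x} → length w ≤ ℓ at N → Run N (dropItem₁ ℓ) (w ∙ x , tt) (x , tt)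
  dropItem₁! {N} w {x} le = while! (loop w) refl le ▸ pop! refl
    where
    loop : ∀ w → Iter N (on t0 letter?) (pop t0) (w ∙ x , tt) (length w) (end ∷ x , tt)
    loop []      = done
    loop (s ∷ w) = (refl , pop! refl) ▹ loop w

  -- Comparison of words and linear search

  agree? : Maybe Sym → Maybe Sym → Bool
  agree? (just (inj₁ x)) (just (inj₁ y)) = does (x Fin.≟ y)
  agree? _               _               = false

  bothEnd? : Maybe Sym → Maybe Sym → Bool
  bothEnd? (just end) (just end) = true
  bothEnd? _          _          = false

  -- The point where the parallel scan of two words stops. Since `agree?` fails on `end`, even on
  -- two of them, the words are equal exactly if both remainders are empty, which `bothEnd?` sees on
  -- top of the stacks.
  record Comparison (v w : Word) : Set where
    field
      common v′ w′ : Word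
      v-split  : v ≡ common ++ v′
      w-split  : w ≡ common ++ w′
      disagree : ∀ {x y} → agree? (head (v′ ∙ x)) (head (w′ ∙ y)) ≡ false

  compare : ∀ v w → Comparison v w
  compare []      w       = record { common = [] ; v-split = refl ; w-split = refl ; disagree = refl }
  compare (x ∷ v) []      = record { common = [] ; v-split = refl ; w-split = refl ; disagree = refl }
  compare (x ∷ v) (y ∷ w) with x Fin.≟ y
  ... | no x≢y   = record { common = [] ; v-split = refl ; w-split = refl ; disagree = dec-false (x Fin.≟ y) x≢y }
  ... | yes refl = record
    { common = x ∷ c.common ; v-split = cong (x ∷_) c.v-split ; w-split = cong (x ∷_) c.w-split
    ; disagree = c.disagree }
    where module c = Comparison (compare v w)

  compareTransfer : Poly 1 → Prog 3
  compareTransfer ℓ = while (on₂ t0 t1 agree?) ℓ (dup t0 t2 ⨾ pop t0 ⨾ pop t1)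

  compareTransfer! : ∀ {ℓ x y} c v w → length c ≤ ℓ at N →
    agree? (head (v ∙ x)) (head (w ∙ y)) ≡ false →
    Run N (compareTransfer ℓ) ((c ++ v) ∙ x , (c ++ w) ∙ y , [] , tt) (v ∙ x , w ∙ y , map inj₁ c ʳ++ [] , tt)
  compareTransfer! {N} {x = x} {y} c v w le off = while! (loop c) off le
    where
    loop : ∀ c {z} → Iter N (on₂ t0 t1 agree?) (dup t0 t2 ⨾ pop t0 ⨾ pop t1)
           ((c ++ v) ∙ x , (c ++ w) ∙ y , z , tt) (length c) (v ∙ x , w ∙ y , map inj₁ c ʳ++ z , tt)
    loop []      = done
    loop (s ∷ c) = (dec-true (s Fin.≟ s) refl , dup! (λ ()) refl ▸ pop! refl ▸ pop! refl) ▹ loop c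

  All-ʳ++ : {A : Set} {P : A → Set} {xs ys : List A} → All P xs → All P ys → All P (xs ʳ++ ys)
  All-ʳ++ []       qs = qs
  All-ʳ++ (p ∷ ps) qs = All-ʳ++ ps (p ∷ qs)

  Short : ℕ → Word → Set
  Short l w = length w ≤ l

  restoreItems₃ : Poly 1 → Poly 1 → Prog 3
  restoreItems₃ ℓ m = while (on t0 nonempty?) m (moveItem₃ ℓ)

  restoreItems₃! : ∀ {ℓ m} ws {vs x} → All (Short (ℓ at N)) ws → length ws ≤ m at N →
    Run N (restoreItems₃ ℓ m) (ws ◁ [] , vs ◁ x , [] , tt) ([] , (ws ʳ++ vs) ◁ x , [] , tt)
  restoreItems₃! {N} {ℓ} ws {x = x} short le = while! (loop ws short) refl le
    where
    nonempty : ∀ w {x} → nonempty? (head (w ∙ x)) ≡ true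
    nonempty []      = refl
    nonempty (_ ∷ _) = refl
    loop : ∀ ws {vs} → All (Short (ℓ at N)) ws →
           Iter N (on t0 nonempty?) (moveItem₃ ℓ) (ws ◁ [] , vs ◁ x , [] , tt) (length ws)
                ([] , (ws ʳ++ vs) ◁ x , [] , tt)
    loop []       []       = done
    loop (w ∷ ws) (s ∷ ss) = (nonempty w , moveItem₃! w s) ▹ loop ws ss

  clear₁ : Poly 1 → Poly 1 → Prog 1
  clear₁ ℓ m = while (on t0 letter?) m (dropItem₁ ℓ)

  clear₁! : ∀ {ℓ m} ws {x} → All (Short (ℓ at N)) ws → All (_≢ []) ws → letter? (head x) ≡ false →
    length ws ≤ m at N → Run N (clear₁ ℓ m) (ws ◁ x , tt) (x , tt)
  clear₁! {N} {ℓ} ws {x} short nonempty off le = while! (loop ws short nonempty) off le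
    where
    letter : ∀ {w x} → w ≢ [] → letter? (head (w ∙ x)) ≡ true
    letter {[]}    w≢[] = contradiction refl w≢[]
    letter {_ ∷ _} _    = refl
    loop : ∀ ws → All (Short (ℓ at N)) ws → All (_≢ []) ws →
           Iter N (on t0 letter?) (dropItem₁ ℓ) (ws ◁ x , tt) (length ws) (x , tt)
    loop []       []       []       = done
    loop (w ∷ ws) (s ∷ ss) (n ∷ ns) = (letter n , dropItem₁! w s) ▹ loop ws ss ns

  -- In the search below, the loop condition is tested right after a comparison,
  -- before the common prefix is put back.

  unfinished? : Maybe Sym → Maybe Sym → Bool
  unfinished? x y = nonempty? x ∧ not (bothEnd? x y)

  compareTop restoreTop : Poly 1 → Prog 4
  compareTop ℓ = rename (t0 ∷ t1 ∷ t3 ∷ []) (compareTransfer ℓ)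
  restoreTop ℓ = rename (t3 ∷ t0 ∷ t1 ∷ []) (copyTransfer ℓ)

  advance : Poly 1 → Prog 4
  advance ℓ = restoreTop ℓ ⨾ rename (t0 ∷ t2 ∷ t3 ∷ []) (moveItem₃ ℓ) ⨾ compareTop ℓ

  search₄ : Poly 1 → Poly 1 → Prog 4
  search₄ ℓ m = compareTop ℓ ⨾ while (on₂ t0 t1 unfinished?) m (advance ℓ) ⨾ restoreTop ℓ

  module _ (k : Word) {e : List Sym} where

    compared : Word → List Sym → List Sym → St 4
    compared w y x = w′ ∙ y , k′ ∙ e , x , map inj₁ c.common ʳ++ [] , tt
      where module c = Comparison (compare w k) ; w′ = c.v′ ; k′ = c.w′

    module _ {ℓ : Poly 1} where

      common-short : ∀ w → Short (ℓ at N) k → Short (ℓ at N) (Comparison.common (compare w k))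
      common-short w s = ≤-trans (m≤m+n _ _)
        (≤-trans (≤-reflexive (trans (sym (List.length-++ common)) (cong length (sym w-split)))) s)
        where open Comparison (compare w k)

      compareTop! : ∀ w {x y} → Short (ℓ at N) k →
        Run N (compareTop ℓ) (w ∙ y , k ∙ e , x , [] , tt) (compared w y x)
      compareTop! {N} w {x} {y} s =
        subst (λ ws → Run N (compareTop ℓ) (proj₁ ws ∙ y , proj₂ ws ∙ e , x , [] , tt) (compared w y x))
          (sym (cong₂ _,_ v-split w-split))
          (call (t0 ∷ t1 ∷ t3 ∷ []) (compareTransfer! common v′ w′ (common-short w s) disagree))
        where open Comparison (compare w k)

      restoreTop! : ∀ w {x y} → Short (ℓ at N) k →
        Run N (restoreTop ℓ) (compared w y x) (w ∙ y , k ∙ e , x , [] , tt)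
      restoreTop! {N} w {x} {y} s =
        subst (λ ws → Run N (restoreTop ℓ) (compared w y x) (proj₁ ws , proj₂ ws , x , [] , tt))
          (cong₂ _,_ (trans (∙-++ common v′) (cong (_∙ y) (sym v-split)))
                     (trans (∙-++ common w′) (cong (_∙ e) (sym w-split))))
          (call (t3 ∷ t0 ∷ t1 ∷ []) (copyTransferBack! common (common-short w s)))
        where open Comparison (compare w k)

    differs : ∀ w {y x} → w ≢ k → on₂ t0 t1 unfinished? (tops (compared w y x)) ≡ true
    differs w w≢k with compare w k
    ... | record { common = c ; v′ = [] ; w′ = [] ; v-split = p ; w-split = q } =
      contradiction (trans p (sym q)) w≢k
    ... | record { v′ = [] ; w′ = _ ∷ _ } = refl
    ... | record { v′ = _ ∷ _ } = refl

    matches : ∀ {y x} → on₂ t0 t1 unfinished? (tops (compared k y x)) ≡ false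
    matches with compare k k
    ... | record { v′ = [] ; w′ = [] } = refl
    ... | record { common = c ; v′ = [] ; w′ = _ ∷ _ ; v-split = p ; w-split = q }
      with () ← List.++-cancelˡ c _ _ (trans (sym p) q)
    ... | record { common = c ; v′ = s ∷ v ; w′ = w′ ; v-split = p ; w-split = q ; disagree = d }
      with refl ← List.++-cancelˡ c (s ∷ v) w′ (trans (sym p) q)
      with () ← trans (sym (dec-true (s Fin.≟ s) refl)) (d {[]} {[]})

  search₄-found! : ∀ {ℓ m} k ws {vs e x xs} → All (_≢ k) ws → All (Short (ℓ at N)) ws → Short (ℓ at N) k →
    length ws ≤ m at N →
    Run N (search₄ ℓ m) ((ws ++ k ∷ vs) ◁ x , k ∙ e , xs ◁ [] , [] , tt)
                        ((k ∷ vs) ◁ x , k ∙ e , (ws ʳ++ xs) ◁ [] , [] , tt)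
  search₄-found! {N} {ℓ} k ws {vs} {e} {x} {xs} differ short s le =
    resume ws ▸ while! (loop ws differ short) (matches k {e} {vs ◁ x} {(ws ʳ++ xs) ◁ []}) le ▸ restoreTop! k k s
    where
    state : List Word → List Word → St 4
    state []       xs = compared k k (vs ◁ x) (xs ◁ [])
    state (w ∷ ws) xs = compared k w ((ws ++ k ∷ vs) ◁ x) (xs ◁ [])
    resume : ∀ ws {xs} → Run N (compareTop ℓ) ((ws ++ k ∷ vs) ◁ x , k ∙ e , xs ◁ [] , [] , tt) (state ws xs)
    resume []       = compareTop! k k s
    resume (w ∷ ws) = compareTop! k w s
    loop : ∀ ws {xs} → All (_≢ k) ws → All (Short (ℓ at N)) ws →
           Iter N (on₂ t0 t1 unfinished?) (advance ℓ) (state ws xs) (length ws) (state [] (ws ʳ++ xs))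
    loop []       []       []        = done
    loop (w ∷ ws) {xs} (d ∷ ds) (s′ ∷ ss) =
      (differs k {e} w {(ws ++ k ∷ vs) ◁ x} {xs ◁ []} d , restoreTop! k w s ▸ call (t0 ∷ t2 ∷ t3 ∷ []) (moveItem₃! w s′) ▸ resume ws) ▹ loop ws ds ss

  -- Failure shows as an empty stack, so here, unlike in a successful search, nothing may lie below
  -- the list.
  search₄-missing! : ∀ {ℓ m} k ws {e xs} → All (_≢ k) ws → All (Short (ℓ at N)) ws → Short (ℓ at N) k →
    length ws ≤ m at N →
    Run N (search₄ ℓ m) (ws ◁ [] , k ∙ e , xs ◁ [] , [] , tt) ([] , k ∙ e , (ws ʳ++ xs) ◁ [] , [] , tt)
  search₄-missing! {N} {ℓ} k ws {e} differ short s le =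
    resume ws ▸ while! (loop ws differ short) refl le ▸
    -- The last comparison met an empty stack and consumed nothing, so there is no prefix to put
    -- back.
    call (t3 ∷ t0 ∷ t1 ∷ []) {P = copyTransfer ℓ} {s′ = [] , [] , k ∙ e , tt} (while! done refl z≤n)
    where
    state : List Word → List Word → St 4
    state []       xs = [] , k ∙ e , xs ◁ [] , [] , tt
    state (w ∷ ws) xs = compared k w (ws ◁ []) (xs ◁ [])
    resume : ∀ ws {xs} → Run N (compareTop ℓ) (ws ◁ [] , k ∙ e , xs ◁ [] , [] , tt) (state ws xs)
    resume []       = call (t0 ∷ t1 ∷ t3 ∷ []) {P = compareTransfer ℓ} (while! done refl z≤n)
    resume (w ∷ ws) = compareTop! k w s
    loop : ∀ ws {xs} → All (_≢ k) ws → All (Short (ℓ at N)) ws →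
           Iter N (on₂ t0 t1 unfinished?) (advance ℓ) (state ws xs) (length ws) (state [] (ws ʳ++ xs))
    loop []       []       []        = done
    loop (w ∷ ws) {xs} (d ∷ ds) (s′ ∷ ss) =
      (differs k {e} w {ws ◁ []} {xs ◁ []} d , restoreTop! k w s ▸ call (t0 ∷ t2 ∷ t3 ∷ []) (moveItem₃! w s′) ▸ resume ws) ▹ loop ws ds ss

  assoc₄ : Poly 1 → Poly 1 → Prog 4
  assoc₄ ℓ m =
    search₄ ℓ m ⨾ rename (t1 ∷ []) (dropItem₁ ℓ) ⨾ rename (t0 ∷ t2 ∷ t3 ∷ []) (moveItem₃ ℓ) ⨾
    -- One more word than the search passed over: the key itself has been moved aside to expose its
    -- value.
    rename (t0 ∷ t1 ∷ t3 ∷ []) (copyItem₃ ℓ) ⨾ rename (t2 ∷ t0 ∷ t3 ∷ []) (restoreItems₃ ℓ (const 1 :+ m))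

  -- The search compares the key with every word, so all words before it, values included, have to
  -- differ from it. The encodings below are chosen accordingly.
  record Maps (l m : ℕ) (k v : Word) (ws : List Word) : Set where
    constructor maps
    field
      {pre post} : List Word
      split      : ws ≡ pre ++ k ∷ v ∷ post
      differ     : All (_≢ k) pre
      short      : All (Short l) pre
      k-short    : Short l k
      v-short    : Short l v
      length-pre : length pre ≤ m

  assoc₄! : ∀ {ℓ m} k v ws {x e} → Maps (ℓ at N) (m at N) k v ws →
    Run N (assoc₄ ℓ m) (ws ◁ x , k ∙ e , [] , [] , tt) (ws ◁ x , v ∙ e , [] , [] , tt)
  assoc₄! {N} {ℓ} {m} k v .(ws ++ k ∷ v ∷ vs) {x} {e} (maps {ws} {vs} refl d ss ks vs′ le) =
    search₄-found! k ws {v ∷ vs} {xs = []} d ss ks le ▸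
    call (t1 ∷ []) (dropItem₁! k ks) ▸
    call (t0 ∷ t2 ∷ t3 ∷ []) (moveItem₃! k ks) ▸
    call (t0 ∷ t1 ∷ t3 ∷ []) (copyItem₃! v vs′) ▸
    call (t2 ∷ t0 ∷ t3 ∷ []) (subst (λ us → Run N (restoreItems₃ ℓ (const 1 :+ m))
        (k ∙ (ws ʳ++ []) ◁ [] , v ∙ vs ◁ x , [] , tt) ([] , us ◁ x , [] , tt))
      (List.ʳ++-ʳ++ ws)
      (restoreItems₃! (k ∷ ws ʳ++ []) (ks ∷ All-ʳ++ ss [])
        (s≤s (≤-trans (≤-reflexive (trans (List.length-ʳ++ ws) (+-identityʳ _))) le))))

-- Stores of shared nodes

-- Indices are natural numbers rather than elements of a `Fin`, so that they stay the same when the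
-- store grows.
data At {A : Set} : List A → ℕ → A → Set where
  here  : ∀ {x xs} → At (x ∷ xs) 0 x
  there : ∀ {x y xs i} → At xs i y → At (x ∷ xs) (suc i) y

module _ {A : Set} where

  At-< : ∀ {xs : List A} {i x} → At xs i x → i < length xs
  At-< here      = s≤s z≤n
  At-< (there p) = s≤s (At-< p)

  At-++ : ∀ {xs ys : List A} {i x} → At xs i x → At (xs ++ ys) i x
  At-++ here      = here
  At-++ (there p) = there (At-++ p)

  At-shift : ∀ (xs : List A) {ys i x} → At ys i x → At (xs ++ ys) (length xs + i) x
  At-shift []       p = p
  At-shift (_ ∷ xs) p = there (At-shift xs p)

  At-last : ∀ (xs : List A) {x} → At (xs ++ [ x ]) (length xs) x
  At-last []       = here
  At-last (_ ∷ xs) = there (At-last xs)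

  At-snoc⁻ : ∀ (xs : List A) {x i y} → At (xs ++ [ x ]) i y → At xs i y ⊎ (i ≡ length xs × y ≡ x)
  At-snoc⁻ []       here      = inj₂ (refl , refl)
  At-snoc⁻ (_ ∷ xs) here      = inj₁ here
  At-snoc⁻ (_ ∷ xs) (there p) with At-snoc⁻ xs p
  ... | inj₁ q          = inj₁ (there q)
  ... | inj₂ (refl , e) = inj₂ (refl , e)

  At-functional : ∀ {xs : List A} {i x y} → At xs i x → At xs i y → x ≡ y
  At-functional here      here      = refl
  At-functional (there p) (there q) = At-functional p q

  At-exists : ∀ {xs : List A} {i} → i < length xs → ∃ (At xs i)
  At-exists {x ∷ xs} {zero}  _         = x , here
  At-exists {x ∷ xs} {suc i} (s≤s i<n) = let y , p = At-exists i<n in y , there p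

  At-lookup : ∀ {n} (xs : Vec A n) i {ys} → At (toList xs ++ ys) (toℕ i) (lookup xs i)
  At-lookup (x ∷ xs) zero    = here
  At-lookup (x ∷ xs) (suc i) = there (At-lookup xs i)

module Stores (𝔸 : Signature) where

  StoreNode : Set
  StoreNode = Σ[ c ∈ Fin (K 𝔸) ] Vec ℕ (ar 𝔸 c)

  -- `below` makes increasing index order a topological order, children first; `unique` is maximal
  -- sharing.
  record Store (G : List StoreNode) : Set where
    field
      below  : ∀ {i c is} → At G i (c , is) → All (_< i) (toList is)
      unique : ∀ {i j n} → At G i n → At G j n → i ≡ j

  data Unf (G : List StoreNode) (i : ℕ) : Term 𝔸 → Set where
    unf : ∀ {c is ts} → At G i (c , is) → Pointwise (Unf G) is ts → Unf G i (con c ts)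

  empty-store : Store []
  empty-store = record { below = λ () ; unique = λ () }

  snoc-store : ∀ {G c is} → Store G → All (_< length G) (toList is) →
               (∀ {i} → ¬ At G i (c , is)) → Store (G ++ [ c , is ])
  snoc-store {G} {c} {is} store is< new = record { below = below′ ; unique = unique′ }
    where
    open Store store
    below′ : ∀ {i c′ is′} → At (G ++ [ c , is ]) i (c′ , is′) → All (_< i) (toList is′)
    below′ p with At-snoc⁻ G p
    ... | inj₁ q             = below q
    ... | inj₂ (refl , refl) = is<
    unique′ : ∀ {i j n} → At (G ++ [ c , is ]) i n → At (G ++ [ c , is ]) j n → i ≡ j
    unique′ p q with At-snoc⁻ G p | At-snoc⁻ G q
    ... | inj₁ p′            | inj₁ q′            = unique p′ q′
    ... | inj₁ p′            | inj₂ (refl , refl) = contradiction p′ new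
    ... | inj₂ (refl , refl) | inj₁ q′            = contradiction q′ new
    ... | inj₂ (refl , _)    | inj₂ (refl , _)    = refl

  Unf-< : ∀ {G i t} → Unf G i t → i < length G
  Unf-< (unf p _) = At-< p

  Unfs-< : ∀ {G n} {is : Vec ℕ n} {ts : Vec (Term 𝔸) n} → Pointwise (Unf G) is ts → All (_< length G) (toList is)
  Unfs-< []       = []
  Unfs-< (u ∷ us) = Unf-< u ∷ Unfs-< us

  Unf-++  : ∀ {G H i t} → Unf G i t → Unf (G ++ H) i t
  Unfs-++ : ∀ {G H n} {is : Vec ℕ n} {ts : Vec (Term 𝔸) n} → Pointwise (Unf G) is ts → Pointwise (Unf (G ++ H)) is ts
  Unf-++ (unf p us) = unf (At-++ p) (Unfs-++ us)
  Unfs-++ []        = []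
  Unfs-++ (u ∷ us)  = Unf-++ u ∷ Unfs-++ us

  Unf-functional  : ∀ {G i t u} → Unf G i t → Unf G i u → t ≡ u
  Unfs-functional : ∀ {G n} {is : Vec ℕ n} {ts us : Vec (Term 𝔸) n} → Pointwise (Unf G) is ts → Pointwise (Unf G) is us → ts ≡ us
  Unf-functional (unf p us) (unf q vs) with refl ← At-functional p q = cong (con _) (Unfs-functional us vs)
  Unfs-functional []       []       = refl
  Unfs-functional (u ∷ us) (v ∷ vs) = cong₂ _∷_ (Unf-functional u v) (Unfs-functional us vs)

  -- By induction on the unfoldings: equal subterms sit at equal indices, so the two nodes have the
  -- same content and `unique` applies.
  Unf-injective  : ∀ {G} → Store G → ∀ {t i j} → Unf G i t → Unf G j t → i ≡ j
  Unfs-injective : ∀ {G} → Store G → ∀ {n} {ts : Vec _ n} {is js : Vec ℕ n} →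
                   Pointwise (Unf G) is ts → Pointwise (Unf G) js ts → is ≡ js
  Unf-injective store (unf p us) (unf q vs) with refl ← Unfs-injective store us vs = Store.unique store p q
  Unfs-injective store []       []       = refl
  Unfs-injective store (u ∷ us) (v ∷ vs) = cong₂ _∷_ (Unf-injective store u v) (Unfs-injective store us vs)

  -- Words for indices, nodes and table keys

  open Words (letters 𝔸) public

  -- One tick more than the index. Popping ticks until none is left thus passes through the words of
  -- `i`, ..., `0`, and the empty word remains free as the predecessor of `idw 0`.
  idw : ℕ → Word
  idw i = List.replicate (suc i) tick

  body : ∀ {n} → Vec ℕ n → Word
  body []       = []
  body (i ∷ is) = idw i ++ sep ∷ body is

  nodew : StoreNode → Word
  nodew (c , is) = ctr c ∷ body is

  -- Every key begins with `sep` and every index word with `tick`, so a search for a key in a table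
  -- cannot stop at a value. Node words begin with a constructor for the same reason.
  key : ℕ → ℕ → Word
  key j i = List.replicate (suc j) sep ++ idw i

  -- Each node comes with its index on both sides, so that one and the same
  -- lookup procedure finds a node from its index and an index from its node.  The
  -- empty word in front serves as predecessor of the index of the first node.
  entries : ℕ → List StoreNode → List Word
  entries k []      = []
  entries k (n ∷ G) = idw k ∷ nodew n ∷ idw k ∷ entries (suc k) G

  storeWords : List StoreNode → List Word
  storeWords G = [] ∷ entries 0 G

  idw-injective : ∀ {i j} → idw i ≡ idw j → i ≡ j
  idw-injective {i} {j} eq = suc-injective
    (trans (sym (List.length-replicate (suc i))) (trans (cong length eq) (List.length-replicate (suc j))))

  ticks-injective : ∀ i j {v w : Word} → List.replicate i tick ++ sep ∷ v ≡ List.replicate j tick ++ sep ∷ w → i ≡ j × v ≡ w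
  ticks-injective zero    zero    refl = refl , refl
  ticks-injective (suc i) (suc j) eq   =
    let p , q = ticks-injective i j (List.∷-injectiveʳ eq) in cong suc p , q

  body-injective : ∀ {n} (is js : Vec ℕ n) → body is ≡ body js → is ≡ js
  body-injective []       []       eq = refl
  body-injective (i ∷ is) (j ∷ js) eq =
    let p , q = ticks-injective (suc i) (suc j) eq in cong₂ _∷_ (suc-injective p) (body-injective is js q)

  nodew-injective : ∀ m n → nodew m ≡ nodew n → m ≡ n
  nodew-injective (c , is) (d , js) eq
    with refl ← Fin.suc-injective (Fin.suc-injective (List.∷-injectiveˡ eq)) =
    cong (c ,_) (body-injective is js (List.∷-injectiveʳ eq))

  key-injective : ∀ j k {i i′} → key j i ≡ key k i′ → j ≡ k × i ≡ i′
  key-injective zero    zero    eq = refl , idw-injective (List.∷-injectiveʳ eq)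
  key-injective (suc j) (suc k) eq =
    let p , q = key-injective j k (List.∷-injectiveʳ eq) in cong suc p , q

  maxArity : ℕ
  maxArity = Vec.sum (tabulate (ar 𝔸))

  ar≤maxArity : ∀ c → ar 𝔸 c ≤ maxArity
  ar≤maxArity = bound (ar 𝔸)
    where
    bound : ∀ {n} (f : Fin n → ℕ) i → f i ≤ Vec.sum (tabulate f)
    bound f zero    = m≤m+n _ _
    bound f (suc i) = ≤-trans (bound (f ∘ suc) i) (m≤n+m _ _)

  -- Bounds the keys whose first component is less than J, and the words of nodes
  -- and indices, in a store with N nodes.
  wordLength : ℕ → Poly 1
  wordLength J = const J :+ (var zero :+ (const 1 :+ (const maxArity :* (const 1 :+ var zero))))

  module _ {N : ℕ} (J : ℕ) where

    idw-short : ∀ {i} → i < N → Short (wordLength J at N) (idw i)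
    idw-short {i} i<N = ≤-trans (≤-reflexive (List.length-replicate (suc i)))
      (≤-trans i<N (≤-trans (m≤m+n N _) (m≤n+m _ J)))

    key-short : ∀ {j i} → j < J → i < N → Short (wordLength J at N) (key j i)
    key-short {j} {i} j<J i<N = ≤-trans (≤-reflexive eq) (+-mono-≤ j<J (≤-trans i<N (m≤m+n N _)))
      where
      eq : length (key j i) ≡ suc j + suc i
      eq = trans (List.length-++ (List.replicate (suc j) sep))
             (cong₂ _+_ (List.length-replicate (suc j)) (List.length-replicate (suc i)))

    body-length : ∀ {n} (is : Vec ℕ n) → All (_< N) (toList is) → length (body is) ≤ n * suc N
    body-length []       []         = z≤n
    body-length (i ∷ is) (i< ∷ is<) = begin
      length (idw i ++ sep ∷ body is)        ≡⟨ List.length-++ (idw i) ⟩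
      length (idw i) + suc (length (body is)) ≡⟨ +-suc (length (idw i)) (length (body is)) ⟩
      suc (length (idw i)) + length (body is) ≡⟨ cong (λ l → suc l + length (body is)) (List.length-replicate (suc i)) ⟩
      suc (suc i) + length (body is)          ≤⟨ +-mono-≤ (s≤s i<) (body-length is is<) ⟩
      _                                       ∎
      where open ≤-Reasoning

    nodew-short : ∀ c (is : Vec ℕ (ar 𝔸 c)) → All (_< N) (toList is) → Short (wordLength J at N) (nodew (c , is))
    nodew-short c is is< = begin
      suc (length (body is))    ≤⟨ s≤s (body-length is is<) ⟩
      suc (ar 𝔸 c * suc N)      ≤⟨ s≤s (*-monoˡ-≤ (suc N) (ar≤maxArity c)) ⟩
      suc (maxArity * suc N)    ≤⟨ m≤n+m _ N ⟩
      N + suc (maxArity * suc N) ≤⟨ m≤n+m _ J ⟩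
      _                         ∎
      where open ≤-Reasoning

    body-short : ∀ c (is : Vec ℕ (ar 𝔸 c)) → All (_< N) (toList is) → Short (wordLength J at N) (body is)
    body-short c is is< = ≤-trans (n≤1+n _) (nodew-short c is is<)

    entries-short : ∀ k G → length G + k ≤ N → (∀ {i c is} → At G i (c , is) → All (_< N) (toList is)) →
                    All (Short (wordLength J at N)) (entries k G)
    entries-short k []             le is< = []
    entries-short k ((c , is) ∷ G) le is< =
      i ∷ nodew-short c is (is< here) ∷ i ∷
      entries-short (suc k) G (≤-trans (≤-reflexive (+-suc (length G) k)) le) (is< ∘ there)
      where i = idw-short (≤-trans (s≤s (m≤n+m k (length G))) le)

    store-children : ∀ {G} → Store G → length G ≤ N → ∀ {i c is} → At G i (c , is) → All (_< N) (toList is)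
    store-children store le p =
      All.map (λ j<i → ≤-trans j<i (≤-trans (<⇒≤ (At-< p)) le)) (Store.below store p)

    storeWords-short : ∀ {G} → Store G → length G ≤ N → All (Short (wordLength J at N)) (storeWords G)
    storeWords-short {G} store le =
      z≤n ∷ entries-short 0 G (≤-trans (≤-reflexive (+-identityʳ _)) le) (store-children store le)

  length-entries : ∀ k G → length (entries k G) ≡ length G * 3
  length-entries k []      = refl
  length-entries k (_ ∷ G) = cong (3 +_) (length-entries (suc k) G)

  entries-++ : ∀ k G {n} → entries k (G ++ [ n ]) ≡ entries k G ++ (idw (length G + k) ∷ nodew n ∷ idw (length G + k) ∷ [])
  entries-++ k []      = refl
  entries-++ k (m ∷ G) {n} = cong (λ ws → idw k ∷ nodew m ∷ idw k ∷ ws)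
    (trans (entries-++ (suc k) G)
      (cong (λ l → entries (suc k) G ++ (idw l ∷ nodew n ∷ idw l ∷ [])) (+-suc (length G) k)))

  storeWords-++ : ∀ G {n} → storeWords (G ++ [ n ]) ≡ storeWords G ++ (idw (length G) ∷ nodew n ∷ idw (length G) ∷ [])
  storeWords-++ G {n} = cong ([] ∷_) (trans (entries-++ 0 G)
    (cong (λ l → entries 0 G ++ (idw l ∷ nodew n ∷ idw l ∷ [])) (+-identityʳ _)))

  -- This is how `intern` obtains a fresh index without a counter: it adds a tick to the last word
  -- of the store. For the empty store that word is the empty one in front.
  last-index : ∀ k G → ∃[ ws ] List.replicate k tick ∷ entries k G ≡ ws ++ [ List.replicate (length G + k) tick ]
  last-index k []      = [] , refl
  last-index k (n ∷ G) =
    let ws , eq = last-index (suc k) G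
    in List.replicate k tick ∷ idw k ∷ nodew n ∷ ws ,
       cong (λ vs → List.replicate k tick ∷ idw k ∷ nodew n ∷ vs)
         (trans eq (cong (λ l → ws ++ [ List.replicate l tick ]) (+-suc (length G) k)))

  -- The empty word in front and three words per node.
  storeItems : Poly 1
  storeItems = const 1 :+ (var zero :* const 3)

  Maps-∷ : ∀ {l m k v w ws} → w ≢ k → Short l w → Maps l m k v ws → Maps l (suc m) k v (w ∷ ws)
  Maps-∷ w≢k s (maps refl ds ss ks vs le) = maps refl (w≢k ∷ ds) (s ∷ ss) ks vs (s≤s le)

  Maps-≤ : ∀ {l m m′ k v ws} → m ≤ m′ → Maps l m k v ws → Maps l m′ k v ws
  Maps-≤ m≤m′ (maps eq ds ss ks vs le) = maps eq ds ss ks vs (≤-trans le m≤m′)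

  module _ {l : ℕ} where

    entries-node : ∀ k G {i n} → At G i n → All (Short l) (entries k G) →
                   Maps l (i * 3) (idw (i + k)) (nodew n) (entries k G)
    entries-node k (n ∷ G) here (s₁ ∷ s₂ ∷ ss) = maps {pre = []} refl [] [] s₁ s₂ z≤n
    entries-node k (n ∷ G) {suc i} {m} (there p) (s₁ ∷ s₂ ∷ s₃ ∷ ss) =
      Maps-∷ k≢ s₁ (Maps-∷ (λ ()) s₂ (Maps-∷ k≢ s₃
        (subst (λ j → Maps l (i * 3) (idw j) (nodew m) (entries (suc k) G)) (+-suc i k) (entries-node (suc k) G p ss))))
      where
      k≢ : idw k ≢ idw (suc i + k)
      k≢ eq = <⇒≢ (s≤s (m≤n+m k i)) (idw-injective eq)

    entries-index : ∀ k G n → All (Short l) (entries k G) → 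
                    (∃[ i ] (At G i n × Maps l (length G * 3) (nodew n) (idw (i + k)) (entries k G))) ⊎
                    ((∀ {i} → ¬ At G i n) × All (_≢ nodew n) (entries k G))
    entries-index k []      n []                   = inj₂ ((λ ()) , [])
    entries-index k (m ∷ G) n (s₁ ∷ s₂ ∷ s₃ ∷ ss) with List.≡-dec Fin._≟_ (nodew m) (nodew n)
    ... | yes eq with refl ← nodew-injective m n eq =
      inj₁ (0 , here , maps {pre = [ idw k ]} refl ((λ ()) ∷ []) (s₁ ∷ []) s₂ s₃ (s≤s z≤n))
    ... | no m≢n with entries-index (suc k) G n ss
    ...   | inj₁ (i , p , f) = inj₁ (suc i , there p ,
              Maps-∷ (λ ()) s₁ (Maps-∷ m≢n s₂ (Maps-∷ (λ ()) s₃
                (subst (λ j → Maps l (length G * 3) (nodew n) (idw j) (entries (suc k) G)) (+-suc i k) f))))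
    ...   | inj₂ (new , ds) = inj₂ ((λ { here → m≢n refl ; (there p) → new p }) , (λ ()) ∷ m≢n ∷ (λ ()) ∷ ds)

    store-node : ∀ G {i n} → At G i n → All (Short l) (storeWords G) →
                 Maps l (suc (length G * 3)) (idw i) (nodew n) (storeWords G)
    store-node G {i} {n} p (s ∷ ss) = Maps-∷ (λ ()) s
      (Maps-≤ (*-monoˡ-≤ 3 (<⇒≤ (At-< p)))
        (subst (λ j → Maps l (i * 3) (idw j) (nodew n) (entries 0 G)) (+-identityʳ i) (entries-node 0 G p ss)))

    store-index : ∀ G n → All (Short l) (storeWords G) →
                  (∃[ i ] (At G i n × Maps l (suc (length G * 3)) (nodew n) (idw i) (storeWords G))) ⊎
                  ((∀ {i} → ¬ At G i n) × All (_≢ nodew n) (storeWords G))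
    store-index G n (s ∷ ss) with entries-index 0 G n ss
    ... | inj₁ (i , p , f)  = inj₁ (i , p , Maps-∷ (λ ()) s
            (subst (λ j → Maps l (length G * 3) (nodew n) (idw j) (entries 0 G)) (+-identityʳ i) f))
    ... | inj₂ (new , ds) = inj₂ (new , (λ ()) ∷ ds)

    store-index-of : ∀ {G i n} → Store G → At G i n → All (Short l) (storeWords G) →
                     Maps l (suc (length G * 3)) (nodew n) (idw i) (storeWords G)
    store-index-of {G} {i} {n} store p ss with store-index G n ss
    ... | inj₁ (j , q , f) =
      subst (λ j → Maps l (suc (length G * 3)) (nodew n) (idw j) (storeWords G)) (Store.unique store q p) f
    ... | inj₂ (new , _)   = contradiction p new

-- Operations on the store

module Operations (𝔸 : Signature) where

  open Stores 𝔸 public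

  -- The tapes: symbol scratch (also input and output), store, operands, table of
  -- recursive results, indices to be processed, and two tapes of item scratch.
  pattern tC = t0
  pattern tS = t1
  pattern tE = t2
  pattern tT = t3
  pattern tQ = t4
  pattern tX = t5
  pattern tY = t6

  st : (s e τ q x y : List Sym) → St 7
  st s e τ q x y = [] , s , e , τ , q , x , y , tt

  storeTape : List StoreNode → List Sym
  storeTape G = storeWords G ◁ []

  infixr 5 _◂_
  _◂_ : List ℕ → List Sym → List Sym
  is ◂ e = map idw is ◁ e

  ◂-++ : ∀ is js {e} → (is ++ js) ◂ e ≡ is ◂ js ◂ e
  ◂-++ []       js = refl
  ◂-++ (i ∷ is) js = cong (idw i ∙_) (◂-++ is js)

  infix 4 _⊑_
  _⊑_ : List StoreNode → List StoreNode → Set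
  G ⊑ H = ∃[ D ] H ≡ G ++ D

  ⊑-refl : ∀ {G} → G ⊑ G
  ⊑-refl = [] , sym (List.++-identityʳ _)

  ⊑-trans : ∀ {G H I} → G ⊑ H → H ⊑ I → G ⊑ I
  ⊑-trans {G} (D , refl) (D′ , refl) = D ++ D′ , List.++-assoc G D D′

  ⊑-length : ∀ {G H} → G ⊑ H → length G ≤ length H
  ⊑-length {G} (D , refl) = ≤-trans (m≤m+n _ _) (≤-reflexive (sym (List.length-++ G)))

  At-⊑ : ∀ {G H i n} → G ⊑ H → At G i n → At H i n
  At-⊑ (D , refl) = At-++

  Unf-⊑ : ∀ {G H i t} → G ⊑ H → Unf G i t → Unf H i t
  Unf-⊑ (D , refl) = Unf-++

  Unfs-⊑ : ∀ {G H n} {is : Vec ℕ n} {ts : Vec (Term 𝔸) n} → G ⊑ H →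
           Pointwise (Unf G) is ts → Pointwise (Unf H) is ts
  Unfs-⊑ (D , refl) = Unfs-++

  private variable
    N : ℕ
    s e τ q x y : List Sym

  cases : Fin 7 → ∀ {n} → (Fin n → Fin (K 𝔸)) → (Fin n → Prog 7) → Prog 7
  constructor? : Fin (K 𝔸) → Maybe Sym → Bool
  constructor? c (just (inj₁ (ctr d))) = does (d Fin.≟ c)
  constructor? c _                     = false
  cases A {zero}  f P = nop
  cases A {suc n} f P = branch (on A (constructor? (f zero))) (P zero) (cases A (f ∘ suc) (P ∘ suc))

  cases! : ∀ A {n} (f : Fin n → Fin (K 𝔸)) (P : Fin n → Prog 7) {σ σ′} → (∀ {i j} → f i ≡ f j → i ≡ j) →
           ∀ i → head (get A σ) ≡ just (inj₁ (ctr (f i))) →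
           Run N (P i) σ σ′ → Run N (cases A f P) σ σ′
  cases! A f P {σ} inj zero    eq r = then!
    (trans (cong (constructor? (f zero)) (trans (lookup-tops A σ) eq)) (dec-true (f zero Fin.≟ f zero) refl)) r
  cases! A f P {σ} inj (suc i) eq r = else!
    (trans (cong (constructor? (f zero)) (trans (lookup-tops A σ) eq))
      (dec-false (f (suc i) Fin.≟ f zero) (λ eq → Fin.0≢1+n (sym (inj eq)))))
    (cases! A (f ∘ suc) (P ∘ suc) (Fin.suc-injective ∘ inj) i eq r)

  module _ (J : ℕ) where

    private
      ℓ = wordLength J

    moveItem copyItem : (A B : Fin 7) → Prog 7
    moveItem A B = rename (A ∷ B ∷ tC ∷ []) (moveItem₃ ℓ)
    copyItem A B = rename (A ∷ B ∷ tC ∷ []) (copyItem₃ ℓ)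

    dropItem : Fin 7 → Prog 7
    dropItem A = rename (A ∷ []) (dropItem₁ ℓ)

    assoc : Fin 7 → Poly 1 → Prog 7
    assoc A m = rename (A ∷ tE ∷ tX ∷ tC ∷ []) (assoc₄ ℓ m)

    pick′ pick : ℕ → Prog 7
    pick′ zero    = copyItem tE tY
    pick′ (suc p) = moveItem tE tX ⨾ pick′ p ⨾ moveItem tX tE
    pick p = pick′ p ⨾ moveItem tY tE

    pick′! : ∀ {is p i} → At is p i → All (_< N) is →
             Run N (pick′ p) (st s (is ◂ e) τ q x y) (st s (is ◂ e) τ q x (idw i ∙ y))
    pick′! {is = i ∷ is} here      (i< ∷ _)   = call (tE ∷ tY ∷ tC ∷ []) (copyItem₃! (idw i) (idw-short J i<))
    pick′! {is = i ∷ is} (there p) (i< ∷ is<) =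
      call (tE ∷ tX ∷ tC ∷ []) (moveItem₃! (idw i) (idw-short J i<)) ▸ pick′! p is< ▸
      call (tX ∷ tE ∷ tC ∷ []) (moveItem₃! (idw i) (idw-short J i<))

    At-All : ∀ {P : ℕ → Set} {is p i} → At is p i → All P is → P i
    At-All here      (x ∷ _)  = x
    At-All (there p) (_ ∷ xs) = At-All p xs

    pick! : ∀ {is p i} → At is p i → All (_< N) is →
            Run N (pick p) (st s (is ◂ e) τ q x y) (st s ((i ∷ is) ◂ e) τ q x y)
    pick! {i = i} p is< =
      pick′! p is< ▸ call (tY ∷ tE ∷ tC ∷ []) (moveItem₃! (idw i) (idw-short J (At-All p is<)))

    -- Positions refer to the original operand stack. The last item is pushed first, so `n` items
    -- already lie on top when the head of the vector is picked.
    build : ∀ {n} → Vec ℕ n → Prog 7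
    build []               = nop
    build {suc n} (p ∷ ps) = build ps ⨾ pick (n + p)

    At-shift′ : ∀ {n} (js : Vec ℕ n) {is : List ℕ} {p i} → At is p i → At (toList js ++ is) (n + p) i
    At-shift′ []       p = p
    At-shift′ (_ ∷ js) p = there (At-shift′ js p)

    build! : ∀ {n is} {ps js : Vec ℕ n} → Pointwise (At is) ps js → All (_< N) is →
             Run N (build ps) (st s (is ◂ e) τ q x y) (st s ((toList js ++ is) ◂ e) τ q x y)
    build! []                     is< = nop!
    build! {js = _ ∷ js} (p ∷ ps) is< =
      build! ps is< ▸ pick! (At-shift′ js p) (All.++⁺ (valid ps) is<)
      where
      valid : ∀ {n} {ps js : Vec ℕ n} → Pointwise (At _) ps js → All (_< _) (toList js)
      valid []       = []
      valid (p ∷ ps) = At-All p is< ∷ valid ps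

    fetch : Prog 7
    fetch = assoc tS storeItems

    fetch! : ∀ {G i n} → Store G → length G ≤ N → At G i n →
             Run N fetch (st (storeTape G) (idw i ∙ e) τ q [] y) (st (storeTape G) (nodew n ∙ e) τ q [] y)
    fetch! {G = G} {i} {n} store le p = call (tS ∷ tE ∷ tX ∷ tC ∷ [])
      (assoc₄! (idw i) (nodew n) (storeWords G)
        (Maps-≤ (s≤s (*-monoˡ-≤ 3 le)) (store-node G p (storeWords-short J store le))))

    packArgs unpackArgs : ℕ → Prog 2
    packArgs zero    = nop
    packArgs (suc n) = transfer ℓ letter? ⨾ pop t0 ⨾ push t1 (inj₁ sep) ⨾ packArgs n

    tick? : Maybe Sym → Bool
    tick? (just (inj₁ tick)) = true
    tick? _                  = false

    unpackArgs zero    = nop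
    unpackArgs (suc n) = unpackArgs n ⨾ pop t1 ⨾ push t0 end ⨾ rename (t1 ∷ t0 ∷ []) (transfer ℓ tick?)

    spilled : ∀ v w {x : List Sym} → map inj₁ (v ++ sep ∷ w) ʳ++ x ≡ map inj₁ w ʳ++ inj₁ sep ∷ (map inj₁ v ʳ++ x)
    spilled v w = trans (cong (_ʳ++ _) (List.map-++ inj₁ v (sep ∷ w))) (List.++-ʳ++ (map inj₁ v))

    packArgs! : ∀ {n} (is : Vec ℕ n) → All (_< N) (toList is) →
                Run N (packArgs n) (toList is ◂ e , x , tt) (e , map inj₁ (body is) ʳ++ x , tt)
    packArgs! []       []         = nop!
    packArgs! {N} {e = e} {x} (i ∷ is) (i< ∷ is<) =
      transferWord! (idw i) (idw-short J i<) ▸ pop! refl ▸ push! ▸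
      subst (λ z → Run N (packArgs _) (toList is ◂ e , inj₁ sep ∷ (map inj₁ (idw i) ʳ++ x) , tt) (e , z , tt))
        (sym (spilled (idw i) (body is))) (packArgs! is is<)

    -- A run of ticks is its own reversal, which makes a single transfer enough for an index.
    ticks-ʳ++ : ∀ n {x : List Sym} → map inj₁ (List.replicate n tick) ʳ++ x ≡ map inj₁ (List.replicate n tick) ++ x
    ticks-ʳ++ zero        = refl
    ticks-ʳ++ (suc n) {x} = trans (ticks-ʳ++ n) (shift n)
      where
      shift : ∀ n → map inj₁ (List.replicate n tick) ++ inj₁ tick ∷ x ≡ inj₁ tick ∷ map inj₁ (List.replicate n tick) ++ x
      shift zero    = refl
      shift (suc n) = cong (inj₁ tick ∷_) (shift n)

    unpackArgs! : ∀ {n} (is : Vec ℕ n) → All (_< N) (toList is) → tick? (head x) ≡ false →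
                  Run N (unpackArgs n) (e , map inj₁ (body is) ʳ++ x , tt) (toList is ◂ e , x , tt)
    unpackArgs! []       []         off = nop!
    unpackArgs! {N} {x = x} {e} (i ∷ is) (i< ∷ is<) off =
      subst (λ z → Run N (unpackArgs _) (e , z , tt) (toList is ◂ e , inj₁ sep ∷ (map inj₁ (idw i) ʳ++ x) , tt))
        (sym (spilled (idw i) (body is))) (unpackArgs! is is< refl) ▸
      pop! refl ▸ push! ▸
      call (t1 ∷ t0 ∷ []) unpackTicks
      where
      e′ = toList is ◂ e
      all-ticks : ∀ n → All (λ s → tick? (just s) ≡ true) (map inj₁ (List.replicate n tick))
      all-ticks zero    = []
      all-ticks (suc n) = refl ∷ all-ticks n
      unpackTicks : Run N (transfer ℓ tick?) (map inj₁ (idw i) ʳ++ x , end ∷ e′ , tt) (x , idw i ∙ e′ , tt)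
      unpackTicks = subst (λ z → Run N (transfer ℓ tick?) (proj₁ z , end ∷ e′ , tt) (x , proj₂ z , tt))
        (cong₂ _,_ (sym (ticks-ʳ++ (suc i))) (ticks-ʳ++ (suc i)))
        (transfer! {p = tick?} (map inj₁ (idw i)) (all-ticks (suc i)) off
          (≤-trans (≤-reflexive (List.length-map inj₁ (idw i))) (idw-short J i<)))

    pack unpack : Fin (K 𝔸) → Prog 2
    pack c   = packArgs (ar 𝔸 c) ⨾ push t0 end ⨾ rename (t1 ∷ t0 ∷ []) (transfer ℓ nonempty?) ⨾
               push t0 (inj₁ (ctr c))
    unpack c = pop t0 ⨾ transfer ℓ letter? ⨾ pop t0 ⨾ unpackArgs (ar 𝔸 c)

    pack! : ∀ c (is : Vec ℕ (ar 𝔸 c)) → All (_< N) (toList is) →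
            Run N (pack c) (toList is ◂ e , [] , tt) (nodew (c , is) ∙ e , [] , tt)
    pack! c is is< =
      packArgs! is is< ▸ push! ▸ call (t1 ∷ t0 ∷ []) (transferBack! (body is) (body-short J c is is<)) ▸ push!

    unpack! : ∀ c (is : Vec ℕ (ar 𝔸 c)) → All (_< N) (toList is) →
              Run N (unpack c) (nodew (c , is) ∙ e , [] , tt) (toList is ◂ e , [] , tt)
    unpack! c is is< =
      pop! refl ▸ transferWord! (body is) (body-short J c is is<) ▸ pop! refl ▸ unpackArgs! is is< refl

    onNode : (Fin (K 𝔸) → Prog 7) → Prog 7
    onNode P = cases tE id (λ c → rename (tE ∷ tX ∷ []) (unpack c) ⨾ P c)

    onNode! : ∀ {P c} {is : Vec ℕ (ar 𝔸 c)} {σ} → All (_< N) (toList is) →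
              Run N (P c) (st s (toList is ◂ e) τ q [] y) σ →
              Run N (onNode P) (st s (nodew (c , is) ∙ e) τ q [] y) σ
    onNode! {P = P} {c} {is} is< r =
      cases! tE id _ id c refl (call (tE ∷ tX ∷ []) (unpack! c is is<) ▸ r)

    private
      m = const 1 :+ storeItems

    -- After the search, `tS` is nonempty exactly if the node exists, and its index is the word
    -- behind it. Otherwise all words lie reversed on `tX` with the last index on top; a tick is
    -- added to a copy, and index, node and index are put on the empty `tS` before the old words
    -- return above them.
    intern : Prog 7
    intern =
      rename (tS ∷ tE ∷ tX ∷ tC ∷ []) (search₄ ℓ m) ⨾
      branch (on tS nonempty?)
        (dropItem tE ⨾ moveItem tS tX ⨾ copyItem tS tE)
        (copyItem tX tY ⨾ push tY (inj₁ tick) ⨾ copyItem tY tS ⨾ moveItem tE tS ⨾ copyItem tY tS ⨾ moveItem tY tE) ⨾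
      rename (tX ∷ tS ∷ tC ∷ []) (restoreItems₃ ℓ (const 1 :+ m))

    makeNode : Fin (K 𝔸) → Prog 7
    makeNode c = rename (tE ∷ tX ∷ []) (pack c) ⨾ intern

    length-reversed : {A : Set} (xs : List A) → length (xs ʳ++ []) ≡ length xs
    length-reversed xs = trans (List.length-ʳ++ xs) (+-identityʳ _)

    intern-found! : ∀ {a k v ws} → Maps (ℓ at N) (m at N) (a ∷ k) v ws →
      Run N intern (st (ws ◁ []) ((a ∷ k) ∙ e) τ q [] y) (st (ws ◁ []) (v ∙ e) τ q [] y)
    intern-found! {N} {e} {τ} {q} {y} {a} {k} {v} (maps {us} {vs} refl ds ss ks s le) =
      call (tS ∷ tE ∷ tX ∷ tC ∷ []) (search₄-found! (a ∷ k) us {v ∷ vs} {xs = []} ds ss ks le) ▸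
      then! refl
        (call (tE ∷ []) (dropItem₁! (a ∷ k) ks) ▸
         call (tS ∷ tX ∷ tC ∷ []) (moveItem₃! (a ∷ k) ks) ▸
         call (tS ∷ tE ∷ tC ∷ []) (copyItem₃! v s)) ▸
      subst (λ ws → Run N (rename (tX ∷ tS ∷ tC ∷ []) (restoreItems₃ ℓ (const 1 :+ m)))
                      (st ((v ∷ vs) ◁ []) (v ∙ e) τ q ((a ∷ k) ∙ (us ʳ++ []) ◁ []) y)
                      (st (ws ◁ []) (v ∙ e) τ q [] y))
        (List.ʳ++-ʳ++ us)
        (call (tX ∷ tS ∷ tC ∷ []) (restoreItems₃! ((a ∷ k) ∷ us ʳ++ []) (ks ∷ All-ʳ++ ss [])
          (s≤s (≤-trans (≤-reflexive (length-reversed us)) le))))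

    intern-missing! : ∀ {k ws us u} → ws ≡ us ++ [ u ] → All (_≢ k) ws →
      All (Short (ℓ at N)) ws → Short (ℓ at N) k → Short (ℓ at N) (tick ∷ u) → length ws ≤ m at N →
      Run N intern (st (ws ◁ []) (k ∙ e) τ q [] y)
        (st ((ws ++ (tick ∷ u) ∷ k ∷ (tick ∷ u) ∷ []) ◁ []) ((tick ∷ u) ∙ e) τ q [] y)
    intern-missing! {N} {e} {τ} {q} {y} {k} {ws} {us} {u} split ds ss ks us′ le =
      call (tS ∷ tE ∷ tX ∷ tC ∷ []) (search₄-missing! k ws {xs = []} ds ss ks le) ▸
      else! refl
        (subst (λ vs → Run N (copyItem tX tY) (st [] (k ∙ e) τ q (vs ◁ []) y) (st [] (k ∙ e) τ q (vs ◁ []) (u ∙ y)))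
           (sym last) (call (tX ∷ tY ∷ tC ∷ []) (copyItem₃! u (≤-trans (n≤1+n _) us′))) ▸
         push! ▸
         call (tY ∷ tS ∷ tC ∷ []) (copyItem₃! (tick ∷ u) us′) ▸
         call (tE ∷ tS ∷ tC ∷ []) (moveItem₃! k ks) ▸
         call (tY ∷ tS ∷ tC ∷ []) (copyItem₃! (tick ∷ u) us′) ▸
         call (tY ∷ tE ∷ tC ∷ []) (moveItem₃! (tick ∷ u) us′)) ▸
      subst (λ vs → Run N (rename (tX ∷ tS ∷ tC ∷ []) (restoreItems₃ ℓ (const 1 :+ m)))
                      (st (((tick ∷ u) ∷ k ∷ (tick ∷ u) ∷ []) ◁ []) ((tick ∷ u) ∙ e) τ q ((ws ʳ++ []) ◁ []) y)
                      (st (vs ◁ []) ((tick ∷ u) ∙ e) τ q [] y))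
        (List.ʳ++-ʳ++ ws)
        (call (tX ∷ tS ∷ tC ∷ []) (restoreItems₃! (ws ʳ++ []) (All-ʳ++ ss [])
          (≤-trans (≤-reflexive (length-reversed ws)) (≤-trans le (n≤1+n _)))))
      where
      last : ws ʳ++ [] ≡ u ∷ us ʳ++ []
      last = trans (cong (_ʳ++ []) split) (List.++-ʳ++ us)

    makeNode! : ∀ {G c} {is : Vec ℕ (ar 𝔸 c)} {ts} → Store G → Pointwise (Unf G) is ts →
      ∃[ H ] ∃[ i ] (Store H × G ⊑ H × length H ≤ suc (length G) × Unf H i (con c ts) ×
        (∀ {N e τ q y} → length H ≤ N →
          Run N (makeNode c) (st (storeTape G) (toList is ◂ e) τ q [] y) (st (storeTape H) (idw i ∙ e) τ q [] y)))
    makeNode! {G} {c} {is} {ts} store us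
      with store-index G (c , is) (storeWords-short J store ≤-refl)
    ... | inj₁ (i , p , _) =
      G , i , store , ⊑-refl , n≤1+n _ , unf p us , λ {N} le →
        call (tE ∷ tX ∷ []) (pack! c is (is< le)) ▸
        intern-found! (Maps-≤ (s≤s (≤-trans (*-monoˡ-≤ 3 le) (n≤1+n _)))
          (store-index-of store p (storeWords-short {N} J store le)))
      where
      is< : ∀ {N} → length G ≤ N → All (_< N) (toList is)
      is< le = All.map (λ i< → ≤-trans i< le) (Unfs-< us)
    ... | inj₂ (new , ds) =
      G ++ [ c , is ] , length G , store′ , (_ , refl) , ≤-reflexive length′ , unf (At-last G) (Unfs-++ us) , λ {N} {e} {τ} {q} {y} le →
        let le′ = ≤-trans (≤-reflexive (sym length′)) le in
        call (tE ∷ tX ∷ []) (pack! c is (is< (<⇒≤ le′))) ▸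
        subst (λ ws → Run N intern (st (storeTape G) (nodew (c , is) ∙ e) τ q [] y)
                                   (st (ws ◁ []) (idw (length G) ∙ e) τ q [] y))
          (sym (storeWords-++ G))
          (intern-missing! split ds (storeWords-short {N} J store (<⇒≤ le′))
            (nodew-short J c is (is< (<⇒≤ le′))) (idw-short J le′)
            (s≤s (≤-trans (≤-reflexive (length-entries 0 G)) (≤-trans (*-monoˡ-≤ 3 (<⇒≤ le′)) (n≤1+n _)))))
      where
      is< : ∀ {N} → length G ≤ N → All (_< N) (toList is)
      is< le = All.map (λ i< → ≤-trans i< le) (Unfs-< us)
      store′ = snoc-store store (Unfs-< us) new
      length′ : length (G ++ [ c , is ]) ≡ suc (length G)
      length′ = trans (List.length-++ G) (+-comm _ 1)
      split : storeWords G ≡ proj₁ (last-index 0 G) ++ [ List.replicate (length G) tick ]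
      split = trans (proj₂ (last-index 0 G))
        (cong (λ l → proj₁ (last-index 0 G) ++ [ List.replicate l tick ]) (+-identityʳ _))

-- Reachable nodes

module Reachability (𝔸 : Signature) where

  open Operations 𝔸 public
  open import Data.List.Membership.DecPropositional _≟_ using (_∈?_)

  ∈-ʳ++ʳ : ∀ {A : Set} (xs : List A) {ys x} → x ∈ᴸ ys → x ∈ᴸ xs ʳ++ ys
  ∈-ʳ++ʳ []       p = p
  ∈-ʳ++ʳ (_ ∷ xs) p = ∈-ʳ++ʳ xs (there p)

  ∈-ʳ++ˡ : ∀ {A : Set} (xs : List A) {ys x} → x ∈ᴸ xs → x ∈ᴸ xs ʳ++ ys
  ∈-ʳ++ˡ (x ∷ xs) (here refl) = ∈-ʳ++ʳ xs (here refl)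
  ∈-ʳ++ˡ (x ∷ xs) (there p)   = ∈-ʳ++ˡ xs p

  Closed : List StoreNode → (ℕ → Set) → Set
  Closed G P = ∀ {i c is} → P i → At G i (c , is) → All P (toList is)

  -- Reachability appears as the least closed set rather than through paths: `least` is directly the
  -- induction principle by which properties spread from the source to all visited nodes.
  record Reachable (G : List StoreNode) (x : ℕ) (Q : List ℕ) : Set₁ where
    field
      ascending : AllPairs _<_ Q
      source    : x ∈ᴸ Q
      closed    : Closed G (_∈ᴸ Q)
      least     : ∀ P → P x → Closed G P → All P Q

  -- The nodes are visited in the order of decreasing indices; R lists, with
  -- repetitions, the source and the children of the nodes Q found so far.
  record Visiting (G : List StoreNode) (x i : ℕ) (R Q : List ℕ) : Set₁ where
    field
      ascending : AllPairs _<_ Q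
      visited   : All (i ≤_) Q
      pending   : All (λ r → r < i ⊎ r ∈ᴸ Q) R
      source    : x ∈ᴸ R
      found     : All (_∈ᴸ R) Q
      children  : ∀ {j c is} → j ∈ᴸ Q → At G j (c , is) → All (_∈ᴸ R) (toList is)
      least     : ∀ P → P x → Closed G P → All P R
      length-R  : length R + maxArity * i ≤ suc (maxArity * suc x)

  -- The descent begins at the source itself, since edges lead to smaller indices.
  start : ∀ {G x} → Visiting G x (suc x) [ x ] []
  start = record
    { ascending = [] ; visited = [] ; pending = inj₁ ≤-refl ∷ [] ; source = here refl ; found = []
    ; children = λ () ; least = λ P p _ → p ∷ [] ; length-R = ≤-refl }

  finish : ∀ {G x R Q} → Visiting G x 0 R Q → Reachable G x Q
  finish {Q = Q} v = record
    { ascending = ascending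
    ; source    = in-Q source
    ; closed    = λ p a → All.map in-Q (children p a)
    ; least     = λ P p c → All.map (All.lookup (least P p c)) found }
    where
    open Visiting v
    in-Q : ∀ {r} → r ∈ᴸ _ → r ∈ᴸ Q
    in-Q r∈R with All.lookup pending r∈R
    ... | inj₂ r∈Q = r∈Q

  skip : ∀ {G x i R Q} → ¬ i ∈ᴸ R → Visiting G x (suc i) R Q → Visiting G x i R Q
  skip {i = i} {R} {Q} i∉R v = record
    { ascending = ascending ; visited = All.map (≤-trans (n≤1+n i)) visited ; pending = pending′ R id pending
    ; source = source ; found = found ; children = children ; least = least
    ; length-R = ≤-trans (+-monoʳ-≤ (length R) (*-monoʳ-≤ maxArity (n≤1+n i))) length-R }
    where
    open Visiting v
    pending′ : ∀ R′ → (∀ {r} → r ∈ᴸ R′ → r ∈ᴸ R) → All (λ r → r < suc i ⊎ r ∈ᴸ Q) R′ → All (λ r → r < i ⊎ r ∈ᴸ Q) R′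
    pending′ []       sub []       = []
    pending′ (r ∷ R′) sub (p ∷ ps) = earlier p ∷ pending′ R′ (sub ∘ there) ps
      where
      earlier : r < suc i ⊎ r ∈ᴸ Q → r < i ⊎ r ∈ᴸ Q
      earlier (inj₁ (s≤s r≤i)) = inj₁ (≤∧≢⇒< r≤i λ { refl → i∉R (sub (here refl)) })
      earlier (inj₂ r∈Q)       = inj₂ r∈Q

  visit : ∀ {G x i R Q c is} → Store G → At G i (c , is) → i ∈ᴸ R →
          Visiting G x (suc i) R Q → Visiting G x i (toList is ʳ++ R) (i ∷ Q)
  visit {G} {x} {i} {R} {Q} {c} {is} store a i∈R v = record
    { ascending = visited ∷ ascending
    ; visited   = ≤-refl ∷ All.map (≤-trans (n≤1+n i)) visited
    -- The children have smaller indices than `i`, so the descent has yet to come to them.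
    ; pending   = All-ʳ++ (All.map inj₁ (Store.below store a)) (All.map earlier pending)
    ; source    = ∈-ʳ++ʳ (toList is) source
    ; found     = ∈-ʳ++ʳ (toList is) i∈R ∷ All.map (∈-ʳ++ʳ (toList is)) found
    ; children  = children′
    ; least     = λ P p cl → All-ʳ++ (cl (All.lookup (least P p cl) i∈R) a) (least P p cl)
    ; length-R  = length-R′ }
    where
    open Visiting v
    earlier : ∀ {r} → r < suc i ⊎ r ∈ᴸ Q → r < i ⊎ r ∈ᴸ i ∷ Q
    earlier (inj₂ r∈Q) = inj₂ (there r∈Q)
    earlier {r} (inj₁ (s≤s r≤i)) with r ≟ i
    ... | yes refl = inj₂ (here refl)
    ... | no r≢i   = inj₁ (≤∧≢⇒< r≤i r≢i)
    children′ : ∀ {j c is′} → j ∈ᴸ i ∷ Q → At G j (c , is′) → All (_∈ᴸ (toList is ʳ++ R)) (toList is′)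
    children′ (here refl) a′ with refl ← At-functional a a′ = All.tabulate (∈-ʳ++ˡ (toList is))
    children′ (there p)   a′ = All.map (∈-ʳ++ʳ (toList is)) (children p a′)
    -- Repetitions in `R` are harmless: each index that the descent passes pays for at most
    -- `maxArity` children, so `R` stays linear in the source.
    length-R′ : length (toList is ʳ++ R) + maxArity * i ≤ suc (maxArity * suc x)
    length-R′ = begin
      length (toList is ʳ++ R) + maxArity * i ≡⟨ cong (_+ maxArity * i) (List.length-ʳ++ (toList is)) ⟩
      length (toList is) + length R + maxArity * i
        ≡⟨ cong (λ l → l + length R + maxArity * i) (Vec.length-toList is) ⟩
      ar 𝔸 c + length R + maxArity * i   ≤⟨ +-monoˡ-≤ _ (+-monoˡ-≤ (length R) (ar≤maxArity c)) ⟩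
      maxArity + length R + maxArity * i ≡⟨ cong (_+ maxArity * i) (+-comm maxArity (length R)) ⟩
      length R + maxArity + maxArity * i ≡⟨ +-assoc (length R) maxArity _ ⟩
      length R + (maxArity + maxArity * i) ≡⟨ cong (length R +_) (sym (*-suc maxArity i)) ⟩
      length R + maxArity * suc i        ≤⟨ length-R ⟩
      suc (maxArity * suc x)             ∎
      where open ≤-Reasoning

  first-occurrence : ∀ {i R} → i ∈ᴸ R → ∃[ R₁ ] ∃[ R₂ ] (R ≡ R₁ ++ i ∷ R₂ × All (_≢ i) R₁)
  first-occurrence {i} {r ∷ R} p with r ≟ i
  ... | yes refl = [] , R , refl , []
  first-occurrence {i} {r ∷ R} (here refl) | no r≢i = contradiction refl r≢i
  first-occurrence {i} {r ∷ R} (there p)   | no r≢i =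
    let R₁ , R₂ , eq , ds = first-occurrence p in r ∷ R₁ , R₂ , cong (r ∷_) eq , r≢i ∷ ds

  module _ (J : ℕ) where

    private
      ℓ m : Poly 1
      ℓ = wordLength J
      m = const 1 :+ (const maxArity :* var zero)

    moveItems : ℕ → Prog 7
    moveItems zero    = nop
    moveItems (suc n) = moveItem J tE tY ⨾ moveItems n

    moveItems! : ∀ {N n s e τ q} (is : Vec ℕ n) {R} → All (_< N) (toList is) →
      Run N (moveItems n) (st s (toList is ◂ e) τ q [] (R ◂ [])) (st s e τ q [] ((toList is ʳ++ R) ◂ []))
    moveItems! []       []         = nop!
    moveItems! (i ∷ is) (i< ∷ is<) =
      call (tE ∷ tY ∷ tC ∷ []) (moveItem₃! (idw i) (idw-short J i<)) ▸ moveItems! is is<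

    visitNode : Prog 7
    visitNode =
      rename (tY ∷ tE ∷ tX ∷ tC ∷ []) (search₄ ℓ m) ⨾
      branch (on tY nonempty?)
        (rename (tX ∷ tY ∷ tC ∷ []) (restoreItems₃ ℓ m) ⨾
         copyItem J tE tQ ⨾ pick J 0 ⨾ fetch J ⨾ onNode J (λ c → moveItems (ar 𝔸 c)))
        (rename (tX ∷ tY ∷ tC ∷ []) (restoreItems₃ ℓ m)) ⨾
      pop tE

    reach : Prog 7
    reach =
      copyItem J tE tY ⨾ pick J 0 ⨾
      while (on tE letter?) (var zero) visitNode ⨾
      pop tE ⨾ rename (tY ∷ []) (clear₁ ℓ m)

    module _ {G : List StoreNode} (store : Store G) where

      ids-short : ∀ {N R} → All (_< N) R → All (Short (ℓ at N)) (map idw R)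
      ids-short = All.map⁺ ∘ All.map (idw-short J)

      restoreIds! : ∀ {N s e τ q} R R′ → All (_< N) R → length R ≤ m at N →
        Run N (rename (tX ∷ tY ∷ tC ∷ []) (restoreItems₃ ℓ m))
          (st s e τ q ((map idw R ʳ++ []) ◁ []) (R′ ◂ [])) (st s e τ q [] ((R ++ R′) ◂ []))
      restoreIds! {N} {s} {e} {τ} {q} R R′ R< le =
        subst (λ ws → Run N (rename (tX ∷ tY ∷ tC ∷ []) (restoreItems₃ ℓ m))
                 (st s e τ q ((map idw R ʳ++ []) ◁ []) (R′ ◂ [])) (st s e τ q [] (ws ◁ [])))
          (trans (List.ʳ++-ʳ++ (map idw R)) (sym (List.map-++ idw R R′)))
          (call (tX ∷ tY ∷ tC ∷ []) (restoreItems₃! (map idw R ʳ++ []) (All-ʳ++ (ids-short R<) [])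
            (≤-trans (≤-reflexive (trans (length-reversed J (map idw R)) (List.length-map idw R))) le)))

      visitNode-found! : ∀ {N e τ q i c is R Q} → length G ≤ N → i ∈ᴸ R → At G i (c , is) →
        All (_< N) R → length R ≤ m at N →
        Run N visitNode (st (storeTape G) (idw i ∙ e) τ (Q ◂ q) [] (R ◂ []))
          (st (storeTape G) (List.replicate i tick ∙ e) τ ((i ∷ Q) ◂ q) [] ((toList is ʳ++ R) ◂ []))
      visitNode-found! {N} {e} {τ} {q} {i} {c} {is} {R} {Q} le i∈R a R< len
        with first-occurrence i∈R
      ... | R₁ , R₂ , refl , ds =
        subst (λ ws → Run N (rename (tY ∷ tE ∷ tX ∷ tC ∷ []) (search₄ ℓ m))
                 (st s (idw i ∙ e) τ (Q ◂ q) [] (ws ◁ []))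
                 (st s (idw i ∙ e) τ (Q ◂ q) ((map idw R₁ ʳ++ []) ◁ []) ((i ∷ R₂) ◂ [])))
          (sym (List.map-++ idw R₁ (i ∷ R₂)))
          (call (tY ∷ tE ∷ tX ∷ tC ∷ [])
            (search₄-found! (idw i) (map idw R₁) {map idw R₂} {xs = []}
              (All.map⁺ (All.map (_∘ idw-injective) ds)) (ids-short R₁<) i-short
              (≤-trans (≤-reflexive (List.length-map idw R₁)) len₁))) ▸
        then! refl
          (restoreIds! R₁ (i ∷ R₂) R₁< len₁ ▸
           call (tE ∷ tQ ∷ tC ∷ []) (copyItem₃! (idw i) i-short) ▸
           pick! J {is = [ i ]} here (i< ∷ []) ▸
           fetch! J store le a ▸
           onNode! J {c = c} is< (moveItems! is is<)) ▸
        pop! refl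
        where
        s = storeTape G
        i< : i < N
        i< = All.lookup R< i∈R
        i-short = idw-short J i<
        R₁< = All.++⁻ˡ R₁ R<
        len₁ : length R₁ ≤ m at N
        len₁ = ≤-trans (≤-trans (m≤m+n _ _) (≤-reflexive (sym (List.length-++ R₁)))) len
        is< = store-children J store le a

      visitNode-missing! : ∀ {N e τ q i R Q} → ¬ i ∈ᴸ R → i < N → All (_< N) R → length R ≤ m at N →
        Run N visitNode (st (storeTape G) (idw i ∙ e) τ (Q ◂ q) [] (R ◂ []))
          (st (storeTape G) (List.replicate i tick ∙ e) τ (Q ◂ q) [] (R ◂ []))
      visitNode-missing! {N} {e} {τ} {q} {i} {R} {Q} i∉R i< R< len =
        call (tY ∷ tE ∷ tX ∷ tC ∷ [])
          (search₄-missing! (idw i) (map idw R) {xs = []}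
            (All.map⁺ (All.tabulate (λ r∈R eq → i∉R (subst (_∈ᴸ R) (idw-injective eq) r∈R))))
            (ids-short R<) (idw-short J i<) (≤-trans (≤-reflexive (List.length-map idw R)) len)) ▸
        else! refl
          (subst (λ R′ → Run N _ (st _ _ _ _ ((map idw R ʳ++ []) ◁ []) ([] ◂ [])) (st _ _ _ _ [] (R′ ◂ [])))
            (List.++-identityʳ R) (restoreIds! R [] R< len)) ▸
        pop! refl

      R-valid : ∀ {x i R Q N} → x < length G → Visiting G x i R Q → length G ≤ N → All (_< N) R
      R-valid x< v le = Visiting.least v _ (≤-trans x< le) (λ _ → store-children J store le)

      R-length : ∀ {x i R Q N} → x < length G → Visiting G x i R Q → length G ≤ N → length R ≤ m at N
      R-length x< v le = ≤-trans (m≤m+n _ _)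
        (≤-trans (Visiting.length-R v) (s≤s (*-monoʳ-≤ maxArity (≤-trans x< le))))

      visitAll : ∀ {x} i {R Q} → x < length G → i ≤ suc x → Visiting G x i R Q →
        ∃[ R′ ] ∃[ Q′ ] (Visiting G x 0 R′ Q′ × (∀ {N e τ q} → length G ≤ N →
          Iter N (on tE letter?) visitNode
            (st (storeTape G) (List.replicate i tick ∙ e) τ (Q ◂ q) [] (R ◂ [])) i
            (st (storeTape G) ([] ∙ e) τ (Q′ ◂ q) [] (R′ ◂ []))))
      visitAll zero _ _ v = _ , _ , v , λ _ → done
      visitAll {x} (suc i) {R} {Q} x< (s≤s i≤x) v with i ∈? R
      ... | no i∉R =
        let R′ , Q′ , v′ , it = visitAll i x< (≤-trans i≤x (n≤1+n x)) (skip i∉R v)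
        in R′ , Q′ , v′ , λ {_} {_} {_} {q} le → (refl , visitNode-missing! {q = q} {Q = Q} i∉R (i<N le) (R<N le) (len le)) ▹ it le
        where
        i<N : ∀ {N} → length G ≤ N → i < N
        i<N le = ≤-trans (s≤s i≤x) (≤-trans x< le)
        R<N : ∀ {N} → length G ≤ N → All (_< N) R
        R<N = R-valid x< v
        len : ∀ {N} → length G ≤ N → length R ≤ m at N
        len = R-length x< v
      ... | yes i∈R with (c , is) , a ← At-exists {xs = G} (≤-trans (s≤s i≤x) x<) =
        let R′ , Q′ , v′ , it = visitAll i x< (≤-trans i≤x (n≤1+n x)) (visit store a i∈R v)
        in R′ , Q′ , v′ , λ {_} {_} {_} {q} le → (refl , visitNode-found! {q = q} {Q = Q} le i∈R a (R-valid x< v le) (R-length x< v le)) ▹ it le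

      Reaches : ℕ → List ℕ → Set
      Reaches x Q = ∀ {N e τ q} → length G ≤ N →
        Run N reach (st (storeTape G) (idw x ∙ e) τ q [] []) (st (storeTape G) (idw x ∙ e) τ (Q ◂ q) [] [])

      reach! : ∀ {x} → x < length G → ∃[ Q ] (Reachable G x Q × Reaches x Q)
      reach! {x} x< with visitAll (suc x) x< ≤-refl start
      ... | R , Q , v , it = Q , finish v , λ {N} le →
        call (tE ∷ tY ∷ tC ∷ []) (copyItem₃! (idw x) (idw-short J (≤-trans x< le))) ▸
        pick! J {is = [ x ]} here (≤-trans x< le ∷ []) ▸
        while! (it le) refl (≤-trans x< le) ▸
        pop! refl ▸
        call (tY ∷ []) (clear₁! (map idw R) (ids-short (R-valid x< v le)) (All.map⁺ (All.universal (λ _ ()) R)) refl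
          (≤-trans (≤-reflexive (List.length-map idw R)) (R-length x< v le)))

-- Polynomials

infixr 9 _⊚_

_⊚_ : ∀ {k} → Poly 1 → Poly k → Poly k
const c  ⊚ r = const c
var i    ⊚ r = r
(p :+ q) ⊚ r = (p ⊚ r) :+ (q ⊚ r)
(p :* q) ⊚ r = (p ⊚ r) :* (q ⊚ r)

eval-⊚ : ∀ {k} p (r : Poly k) xs → eval (p ⊚ r) xs ≡ p at eval r xs
eval-⊚ (const c)  r xs = refl
eval-⊚ (var zero) r xs = refl
eval-⊚ (p :+ q)   r xs = cong₂ _+_ (eval-⊚ p r xs) (eval-⊚ q r xs)
eval-⊚ (p :* q)   r xs = cong₂ _*_ (eval-⊚ p r xs) (eval-⊚ q r xs)

-- Besides adding up growth, it replaces the maximum of finitely many bounds.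
∑ : ∀ {n k} → (Fin n → Poly k) → Poly k
∑ {zero}  p = const 0
∑ {suc n} p = p zero :+ ∑ (p ∘ suc)

≤-∑ : ∀ {n} (p : Fin n → Poly 1) i s → p i at s ≤ ∑ p at s
≤-∑ p zero    s = m≤m+n _ _
≤-∑ p (suc i) s = ≤-trans (≤-∑ (p ∘ suc) i s) (m≤n+m _ _)

-- The number of subterms of the value of a tiered function

module Sharing (𝔸 : Signature) where

  infix 4 _⊆_
  _⊆_ : List (Term 𝔸) → List (Term 𝔸) → Set
  L ⊆ M = ∀ {t} → t ∈ᴸ L → t ∈ᴸ M

  -- A subterm-closed list with children after their parents, that is, a DAG in topological order.
  -- Repetitions are allowed, so concatenation preserves it; the length still bounds the number of
  -- distinct subterms from above.
  data Shared : List (Term 𝔸) → Set where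
    []  : Shared []
    _∷_ : ∀ {c ts L} → VAll (_∈ᴸ L) ts → Shared L → Shared (con c ts ∷ L)

  record Bounded (s : ℕ) (t : Term 𝔸) : Set where
    constructor bounded
    field
      {terms} : List (Term 𝔸)
      shared  : Shared terms
      few     : length terms ≤ s
      member  : t ∈ᴸ terms

  children-∈ : ∀ {L c ts} → Shared L → con c ts ∈ᴸ L → VAll (_∈ᴸ L) ts
  children-∈ (ts∈ ∷ sh) (here refl) = VAll.map there ts∈
  children-∈ (_ ∷ sh)   (there p)   = VAll.map there (children-∈ sh p)

  children-bounded : ∀ {s c ts} → Bounded s (con c ts) → VAll (Bounded s) ts
  children-bounded (bounded sh few p) = VAll.map (bounded sh few) (children-∈ sh p)

  bounded-≤ : ∀ {s s′ t} → s ≤ s′ → Bounded s t → Bounded s′ t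
  bounded-≤ le (bounded sh few p) = bounded sh (≤-trans few le) p

  Shared-++ : ∀ {L M} → Shared L → Shared M → Shared (L ++ M)
  Shared-++ []         sh′ = sh′
  Shared-++ (ts∈ ∷ sh) sh′ = VAll.map (λ p → ∈-++ˡ p) ts∈ ∷ Shared-++ sh sh′
    where
    ∈-++ˡ : ∀ {L M} → L ⊆ L ++ M
    ∈-++ˡ (here p)  = here p
    ∈-++ˡ (there p) = there (∈-++ˡ p)

  record Extension (L : List (Term 𝔸)) (b : ℕ) (P : List (Term 𝔸) → Set) : Set where
    constructor extension
    field
      {terms} : List (Term 𝔸)
      shared  : Shared terms
      extends : L ⊆ terms
      few     : length terms ≤ b + length L
      holds   : P terms

  Monotone : (List (Term 𝔸) → Set) → Set
  Monotone P = ∀ {L M} → L ⊆ M → P L → P M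

  extendAll : ∀ {n s L} (b : Fin n → Poly 1) (P : Fin n → List (Term 𝔸) → Set) → (∀ i → Monotone (P i)) →
    Shared L → (∀ i {M} → Shared M → L ⊆ M → Extension M (b i at s) (P i)) →
    Extension L (∑ b at s) (λ M → ∀ i → P i M)
  extendAll {zero}  b P mono sh ext = extension sh id ≤-refl λ ()
  extendAll {suc n} {s} {L} b P mono sh ext with ext zero sh id
  ... | extension sh₁ sub₁ le₁ p₁ with extendAll (b ∘ suc) (P ∘ suc) (mono ∘ suc) sh₁
                                      (λ i sh sub → ext (suc i) sh (sub ∘ sub₁))
  ...   | extension sh₂ sub₂ le₂ p₂ = extension sh₂ (sub₂ ∘ sub₁)
    (≤-trans le₂ (≤-trans (+-monoʳ-≤ (∑ (b ∘ suc) at s) le₁)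
      (≤-reflexive (trans (sym (+-assoc (∑ (b ∘ suc) at s) (b zero at s) (length L)))
        (cong (_+ length L) (+-comm (∑ (b ∘ suc) at s) (b zero at s)))))))
    λ { zero → mono zero sub₂ p₁ ; (suc i) → p₂ i }

  -- Nothing is known about an argument whose tier p is less than the tier m of
  -- the value.
  record Arg (L : List (Term 𝔸)) (s m p : ℕ) (t : Term 𝔸) : Set where
    field
      equal  : p ≡ m → t ∈ᴸ L
      higher : m < p → Bounded s t

  open Arg

  same : ∀ {L s m t} → t ∈ᴸ L → Arg L s m m t
  same t∈ = record { equal = λ _ → t∈ ; higher = λ m<m → contradiction m<m (n≮n _) }

  above : ∀ {L s m p t} → m < p → Bounded s t → Arg L s m p t
  above m<p t≤ = record { equal = λ { refl → contradiction m<p (n≮n _) } ; higher = λ _ → t≤ }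

  Env : ∀ {k} → List (Term 𝔸) → ℕ → ℕ → Vec ℕ k → Vec (Term 𝔸) k → Set
  Env L s m = Pointwise (Arg L s m)

  Arg-⊆ : ∀ {L M s m p t} → L ⊆ M → Arg L s m p t → Arg M s m p t
  Arg-⊆ sub a = record { equal = sub ∘ equal a ; higher = higher a }

  Env-⊆ : ∀ {k L M s m} {ps : Vec ℕ k} {ts} → L ⊆ M → Env L s m ps ts → Env M s m ps ts
  Env-⊆ sub = Pointwise.map (Arg-⊆ sub)

  replicated : ∀ {k p} {R : ℕ → Term 𝔸 → Set} {ts : Vec (Term 𝔸) k} → VAll (R p) ts → Pointwise R (replicate k p) ts
  replicated []       = []
  replicated (r ∷ rs) = r ∷ replicated rs

  unreplicated : ∀ {k p} {R : ℕ → Term 𝔸 → Set} {ts : Vec (Term 𝔸) k} → Pointwise R (replicate k p) ts → VAll (R p) ts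
  unreplicated {ts = []}    []       = []
  unreplicated {ts = _ ∷ _} (r ∷ rs) = r ∷ unreplicated rs

  record Raised {k} (s m : ℕ) (ps : Vec ℕ k) (ts : Vec (Term 𝔸) k) : Set where
    field
      {terms} : List (Term 𝔸)
      shared  : Shared terms
      few     : length terms ≤ k * s
      env     : ∀ {p} → m < p → Env terms s p ps ts

  -- A function with value of tier `p > m` makes demands only on arguments of tier at least `p`. All
  -- these are bounded by `s`, so the lists witnessing their bounds, put together, replace `L`,
  -- whose length is unknown.
  raise : ∀ {k L s m} {ps : Vec ℕ k} {ts} → Env L s m ps ts → Raised s m ps ts
  raise [] = record { shared = [] ; few = z≤n ; env = λ _ → [] }
  raise {m = m} (_∷_ {x = p} a as) with raise as | m <? p
  ... | r | no m≮p = record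
    { shared = shared ; few = ≤-trans few (m≤n+m _ _)
    ; env = λ m<q → record { equal = λ { refl → contradiction m<q m≮p }
                           ; higher = λ q<p → contradiction (<-trans m<q q<p) m≮p } ∷ env m<q }
    where open Raised r
  ... | r | yes m<p with higher a m<p
  ...   | bounded {L} sh le t∈ = record
    { shared = Shared-++ sh shared
    ; few    = ≤-trans (≤-reflexive (List.length-++ L)) (+-mono-≤ le few)
    ; env    = λ m<q → record { equal = λ _ → ∈-++⁺ˡ t∈ ; higher = λ _ → bounded sh le t∈ } ∷
                       Env-⊆ (∈-++⁺ʳ L) (env m<q) }
    where open Raised r

  -- The quantification over every shared `L` carries the induction for recursion, where `L` has to
  -- contain all results obtained so far; `q` must not see its length.
  SizeBound : ∀ {k} → Fun 𝔸 k → Vec ℕ k → ℕ → Poly 1 → Set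
  SizeBound f ps m q = ∀ {L s ts} → Shared L → Env L s m ps ts → Extension L (q at s) (f ts ∈ᴸ_)

  raised-bounded : ∀ {k s m p q} {f : Fun 𝔸 k} {ps : Vec ℕ k} {ts} → SizeBound f ps p q →
                   Raised s m ps ts → m < p → Bounded (k * s + q at s) (f ts)
  raised-bounded {k} {s} {q = q} sb r m<p with sb (Raised.shared r) (Raised.env r m<p)
  ... | extension sh _ le ft∈ = bounded sh
    (≤-trans le (≤-trans (+-monoʳ-≤ (q at s) (Raised.few r)) (≤-reflexive (+-comm (q at s) (k * s))))) ft∈

  -- An intermediate value of tier `m` is added to `L` at the cost `r i`. One of higher tier is
  -- bounded on its own by `k * s + r i`, through `raise`, and enlarges only the parameter of `q`.
  -- Of one of lower tier, `f` demands nothing.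
  comp-bound : ∀ {n k} {f : Fun 𝔸 n} {g : Fin n → Fun 𝔸 k} {ps : Vec ℕ n} {qs : Vec ℕ k} {m q r} →
    SizeBound f ps m q → (∀ i → SizeBound (g i) qs (lookup ps i) (r i)) →
    SizeBound (λ ts → f (tabulate λ i → g i ts)) qs m ((q ⊚ ∑ (λ i → (const k :* var zero) :+ r i)) :+ ∑ r)
  comp-bound {n} {k} {f} {g} {ps} {qs} {m} {q} {r} fb gb {L} {s} {ts} sh env
    with extendAll {s = s} r (λ i M → lookup ps i ≡ m → g i ts ∈ᴸ M) (λ i sub p eq → sub (p eq)) sh step
    where
    step : ∀ i {M} → Shared M → L ⊆ M → Extension M (r i at s) (λ M → lookup ps i ≡ m → g i ts ∈ᴸ M)
    step i sh sub with lookup ps i ≟ m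
    ... | no ≢m  = extension sh id (m≤n+m _ _) (λ eq → contradiction eq ≢m)
    ... | yes eq with gb i sh (subst (λ p → Env _ s p qs ts) (sym eq) (Env-⊆ sub env))
    ...   | extension sh′ sub′ le p = extension sh′ sub′ le (λ _ → p)
  ... | extension {M} sh₁ sub₁ le₁ p₁ with fb {s = s′} sh₁ env₁
    where
    s′ = ∑ (λ i → (const k :* var zero) :+ r i) at s
    env₁ : Env M s′ m ps (tabulate λ i → g i ts)
    env₁ = subst (λ ps → Env M s′ m ps (tabulate λ i → g i ts)) (Vec.tabulate∘lookup ps)
      (Pointwise.tabulate⁺ λ i → record
        { equal  = p₁ i
        ; higher = λ m<p → bounded-≤ (≤-∑ (λ i → (const k :* var zero) :+ r i) i s)
                     (raised-bounded {q = r i} {g i} (gb i) (raise env) m<p) })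
  ...   | extension sh₂ sub₂ le₂ p₂ = extension sh₂ (sub₂ ∘ sub₁)
    (≤-trans le₂ (≤-trans (+-mono-≤ (≤-reflexive (sym (eval-⊚ q (∑ λ i → (const k :* var zero) :+ r i) (s ∷ [])))) le₁)
      (≤-reflexive (sym (+-assoc ((q ⊚ ∑ λ i → (const k :* var zero) :+ r i) at s) (∑ r at s) (length L)))))) p₂

  children-env : ∀ {L s m p c ts} → Shared L → Arg L s m p (con c ts) → Env L s m (replicate (ar 𝔸 c) p) ts
  children-env {L} {s} {m} {p} {c} {ts} sh a = replicated (VAll.lookup⁻ λ i → record
    { equal  = λ eq → VAll.lookup⁺ (children-∈ sh (equal a eq)) i
    ; higher = λ m<p → VAll.lookup⁺ (children-bounded (higher a m<p)) i })

  case-bound : ∀ {k} {f : (i : Fin (K 𝔸)) → SimRec 𝔸 (ar 𝔸 i + k)} {p qs m} {q : Fin (K 𝔸) → Poly 1} →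
    (∀ i → SizeBound ⟦ f i ⟧ (replicate (ar 𝔸 i) p Vec.++ qs) m (q i)) →
    SizeBound ⟦ case f ⟧ (p ∷ qs) m (∑ q)
  case-bound {q = q} fb {ts = con i xs ∷ ys} sh (a ∷ as) with fb i sh (Pointwise.++⁺ (children-env sh a) as)
  ... | extension sh′ sub le p = extension sh′ sub (≤-trans le (+-monoˡ-≤ _ (≤-∑ q i _))) p

  module _ {n m : ℕ} (f : (i : Fin (K 𝔸)) → Fin n → Fun 𝔸 (ar 𝔸 i + (n * ar 𝔸 i + m))) (ys : Vec (Term 𝔸) m) where

    simrecOns-All : ∀ {P : Term 𝔸 → Set} j {a} {xs : Vec (Term 𝔸) a} →
                    VAll (P ∘ simrecOn f ys j) xs → VAll P (simrecOns f ys j xs)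
    simrecOns-All j []       = []
    simrecOns-All j (p ∷ ps) = p ∷ simrecOns-All j ps

    results : ∀ {a} → Vec (Term 𝔸) a → Vec (Term 𝔸) (n * a)
    results xs = Vec.concat (tabulate λ j → simrecOns f ys j xs)

    results-All : ∀ {P : Term 𝔸 → Set} {a} {xs : Vec (Term 𝔸) a} →
                  VAll (λ x → ∀ j → P (simrecOn f ys j x)) xs → VAll P (results xs)
    results-All ps = VAll.concat⁺ (VAll.tabulate⁺ λ j → simrecOns-All j (VAll.map (λ p → p j) ps))

  -- The induction is along the list `X` that witnesses the bound of the recursion argument,
  -- available because its tier exceeds `m`. Each of its at most `s` entries costs at most `B`, a
  -- number fixed before any result is added.
  simrec-bound : ∀ {n l} {f : (i : Fin (K 𝔸)) → Fin n → SimRec 𝔸 (ar 𝔸 i + (n * ar 𝔸 i + l))} {p qs m}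
    {q : Fin (K 𝔸) → Fin n → Poly 1} (j : Fin n) → m < p →
    (∀ i j → SizeBound ⟦ f i j ⟧ (replicate (ar 𝔸 i) p Vec.++ (replicate (n * ar 𝔸 i) m Vec.++ qs)) m (q i j)) →
    SizeBound ⟦ simrec f j ⟧ (p ∷ qs) m (var zero :* ∑ (λ i → ∑ (q i)))
  simrec-bound {n} {l} {f} {p} {qs} {m} {q} j m<p fb {L} {s} {x ∷ ys} sh (a ∷ as)
    with bounded {terms} shX few x∈ ← higher a m<p =
    let extension sh′ sub le ps = evaluated shX few in
    extension sh′ sub (≤-trans le (+-monoˡ-≤ (length L) (*-monoˡ-≤ B few))) (All.lookup ps x∈ j)
    where
    B = ∑ (λ i → ∑ (q i)) at s
    g : Fin n → Term 𝔸 → Term 𝔸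
    g = simrecOn (λ i j → ⟦ f i j ⟧) ys
    Done : List (Term 𝔸) → Term 𝔸 → Set
    Done M t = ∀ j → g j t ∈ᴸ M
    evaluated : ∀ {X} → Shared X → length X ≤ s → Extension L (length X * B) (λ M → All (Done M) X)
    evaluated [] le = extension sh id ≤-refl []
    evaluated {con c xs ∷ X} (xs∈ ∷ shX) le with evaluated shX (≤-trans (n≤1+n _) le)
    ... | extension {M} sh₁ sub₁ le₁ ps₁
      with extendAll {s = s} (q c) (λ j M → g j (con c xs) ∈ᴸ M) (λ _ sub → sub) sh₁
        (λ j sh₂ sub₂ → fb c j sh₂ (Pointwise.++⁺
          (replicated (VAll.map (λ x∈ → above m<p (bounded shX (≤-trans (n≤1+n _) le) x∈)) xs∈))
          (Pointwise.++⁺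
            -- The children come later in the list, so their results have been added already. Having
            -- tier exactly `m`, they need to be in the list but need no bound by `s`.
            (replicated (results-All (λ i j → ⟦ f i j ⟧) ys
              (VAll.map (λ x∈ j → same (sub₂ (All.lookup ps₁ x∈ j))) xs∈)))
            (Env-⊆ (sub₂ ∘ sub₁) as))))
    ...   | extension sh₂ sub₂ le₂ p₂ = extension sh₂ (sub₂ ∘ sub₁)
      (≤-trans le₂ (≤-trans (+-mono-≤ (≤-∑ (λ i → ∑ (q i)) c s) le₁) (≤-reflexive (sym (+-assoc B _ (length L))))))
      (p₂ ∷ All.map (λ d j → sub₂ (d j)) ps₁)

  sizePoly : ∀ {k} {f : SimRec 𝔸 k} {ps m} → f ▷ ps ⟶ m → Poly 1
  sizePoly constr              = const 1
  sizePoly proj                = const 0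
  sizePoly (comp {l = k} d ds) =
    (sizePoly d ⊚ ∑ (λ i → (const k :* var zero) :+ sizePoly (ds i))) :+ ∑ (λ i → sizePoly (ds i))
  sizePoly (case ds)           = ∑ (λ i → sizePoly (ds i))
  sizePoly (simrec j m<p ds)   = var zero :* ∑ (λ i → ∑ (λ j → sizePoly (ds i j)))

  size-bound : ∀ {k} {f : SimRec 𝔸 k} {ps m} (d : f ▷ ps ⟶ m) → SizeBound ⟦ f ⟧ ps m (sizePoly d)
  size-bound constr sh env =
    extension (VAll.map (λ a → equal a refl) (unreplicated env) ∷ sh) there ≤-refl (here refl)
  size-bound (proj {i = i}) sh env = extension sh id ≤-refl (equal (Pointwise.lookup env i) refl)
  size-bound (comp {f = f} {g} d ds) = comp-bound {f = ⟦ f ⟧} {λ i → ⟦ g i ⟧} {q = sizePoly d}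
    {λ i → sizePoly (ds i)} (size-bound d) (λ i → size-bound (ds i))
  size-bound (case {f = f} ds) = case-bound {f = f} {q = λ i → sizePoly (ds i)} (λ i → size-bound (ds i))
  size-bound (simrec {f = f} j m<p ds) =
    simrec-bound {f = f} {q = λ i j → sizePoly (ds i j)} j m<p (λ i j → size-bound (ds i j))

  record Combined {k} (s m : ℕ) (ps : Vec ℕ k) (ts : Vec (Term 𝔸) k) : Set where
    field
      {terms} : List (Term 𝔸)
      shared  : Shared terms
      few     : length terms ≤ k * s
      env     : Env terms s m ps ts

  combine : ∀ {k s m} {ps : Vec ℕ k} {ts : Vec (Term 𝔸) k} → VAll (Bounded s) ts → Combined s m ps ts
  combine {ps = []}     []                          = record { shared = [] ; few = z≤n ; env = [] }
  combine {ps = p ∷ ps} (bounded {L} sh le t∈ ∷ bs) = record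
    { shared = Shared-++ sh shared
    ; few    = ≤-trans (≤-reflexive (List.length-++ L)) (+-mono-≤ le few)
    ; env    = record { equal = λ _ → ∈-++⁺ˡ t∈ ; higher = λ _ → bounded sh le t∈ } ∷ Env-⊆ (∈-++⁺ʳ L) env }
    where open Combined (combine {ps = ps} bs)

  -- During evaluation all arguments are bounded, whatever their tiers, so an initial list for any
  -- tier can be assembled from their witnesses. This supplies the size parameter for intermediate
  -- values in `comp-computes` and for recursive results in `simrec-computes`.
  bounded-value : ∀ {k s} {f : Fun 𝔸 k} {ps m q} {ts} → SizeBound f ps m q → VAll (Bounded s) ts →
                  Bounded (k * s + q at s) (f ts)
  bounded-value {k} {s} {q = q} sb bs with combine bs
  ... | r with sb (Combined.shared r) (Combined.env r)
  ...   | extension sh _ le ft∈ = bounded sh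
    (≤-trans le (≤-trans (+-monoʳ-≤ (q at s) (Combined.few r)) (≤-reflexive (+-comm (q at s) (k * s))))) ft∈

-- Evaluation

module Evaluation (𝔸 : Signature) where

  open Reachability 𝔸 public
  open Sharing 𝔸 public

  private variable
    N : ℕ
    s e τ q : List Sym

  block : ℕ → (n : ℕ) → Vec ℕ n
  block d n = tabulate (λ i → d + toℕ i)

  module _ (J : ℕ) where

    drops : ℕ → Prog 7
    drops zero    = nop
    drops (suc n) = dropItem J tE ⨾ drops n

    nip : ℕ → Prog 7
    nip n = moveItem J tE tY ⨾ drops n ⨾ moveItem J tY tE

    drops! : ∀ {n y} (is : Vec ℕ n) → All (_< N) (toList is) →
             Run N (drops n) (st s (toList is ◂ e) τ q [] y) (st s e τ q [] y)
    drops! []       []         = nop!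
    drops! (i ∷ is) (i< ∷ is<) = call (tE ∷ []) (dropItem₁! (idw i) (idw-short J i<)) ▸ drops! is is<

    nip! : ∀ {n i} (is : Vec ℕ n) → i < N → All (_< N) (toList is) →
           Run N (nip n) (st s (idw i ∙ toList is ◂ e) τ q [] []) (st s (idw i ∙ e) τ q [] [])
    nip! {i = i} is i< is< =
      call (tE ∷ tY ∷ tC ∷ []) (moveItem₃! (idw i) (idw-short J i<)) ▸ drops! is is< ▸
      call (tY ∷ tE ∷ tC ∷ []) (moveItem₃! (idw i) (idw-short J i<))

    block! : ∀ {d n} (is : List ℕ) (js : Vec ℕ n) → length is ≡ d → All (_< N) is → All (_< N) (toList js) →
             Run N (build J (block d n)) (st s (is ◂ toList js ◂ e) τ q [] [])
                                         (st s (toList js ◂ is ◂ toList js ◂ e) τ q [] [])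
    block! {N} {s} {e} {τ} {q} {n = n} is js refl is< js< =
      subst (λ z → Run N (build J (block (length is) n)) (st s (proj₁ z) τ q [] []) (st s (proj₂ z) τ q [] []))
        (cong₂ _,_ (◂-++ is (toList js))
          (trans (◂-++ (toList js) (is ++ toList js)) (cong (toList js ◂_) (◂-++ is (toList js)))))
        (build! J at-block (All.++⁺ is< js<))
      where
      at-block : Pointwise (At (is ++ toList js)) (block (length is) n) js
      at-block = subst (Pointwise _ _) (Vec.tabulate∘lookup js) (Pointwise.tabulate⁺ λ i →
        At-shift is (subst (λ js′ → At js′ (toℕ i) (lookup js i)) (List.++-identityʳ (toList js)) (At-lookup js i)))

  evalAll : ∀ {n} → ℕ → (Fin n → Prog 7) → Prog 7
  evalAll {zero}  l P = nop
  -- The offset `n` skips the results of the later functions, which lie above the inputs.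
  evalAll {suc n} l P = evalAll l (P ∘ suc) ⨾ build 0 (block n l) ⨾ P zero

  module _ (n : ℕ) where

    -- A key and a value for each of the `n` functions at each of at most `N` nodes.
    tableItems : Poly 1
    tableItems = const (2 * n) :* var zero

    seps : ℕ → Prog 7
    seps zero    = nop
    seps (suc j) = seps j ⨾ push tE (inj₁ sep)

    recall : ℕ → Prog 7
    recall j = seps (suc j) ⨾ assoc n tT tableItems

    recallAll : ∀ {a} → Vec (ℕ × ℕ) a → Prog 7
    recallAll []                   = nop
    recallAll {suc a} ((p , j) ∷ ps) = recallAll ps ⨾ pick n (a + p) ⨾ recall j

    -- Below the value lie `a` children and then the index of the current node, which `pick n a`
    -- fetches for the key. The value is moved first so that it ends up behind its key.
    memoize : ℕ → ℕ → Prog 7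
    memoize a j = moveItem n tE tT ⨾ pick n a ⨾ seps (suc j) ⨾ moveItem n tE tT

    resultIndices : (d a : ℕ) → Vec (ℕ × ℕ) (n * a)
    resultIndices d a = Vec.concat (tabulate {n = n} λ j → tabulate {n = a} λ i → d + toℕ i , toℕ j)

    -- With a children of the current node on top of its index, the recursion
    -- argument and m parameters.
    row : (a m : ℕ) → Fin n → Prog 7 → Prog 7
    row a m j P =
      build n (block (a + 2) m) ⨾ recallAll (resultIndices m a) ⨾ build n (block (n * a + m) a) ⨾
      P ⨾ memoize a (toℕ j)

    rows : ∀ {n′} → (Fin n′ → Prog 7) → Prog 7
    rows {zero}   P = nop
    rows {suc n′} P = P zero ⨾ rows (P ∘ suc)

    process : (m : ℕ) → (Fin (K 𝔸) → Fin n → Prog 7) → Prog 7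
    process m P =
      moveItem n tQ tE ⨾ pick n 0 ⨾ fetch n ⨾
      onNode n (λ c → rows (λ j → row (ar 𝔸 c) m j (P c j)) ⨾ drops n (ar 𝔸 c + 1))

    opaque

      -- The functions `P` may themselves contain recursions. The `end` marks pushed on `tQ` and
      -- `tT` shield the queue and the table of the enclosing recursions: both the main loop and the
      -- final clearing stop there.
      recursion : (m : ℕ) → (Fin (K 𝔸) → Fin n → Prog 7) → Fin n → Prog 7
      recursion m P j =
        push tQ end ⨾ reach n ⨾ push tT end ⨾
        while (on tQ letter?) (var zero) (process m P) ⨾
        pop tQ ⨾ recall (toℕ j) ⨾ rename (tT ∷ []) (clear₁ (wordLength n) tableItems) ⨾ pop tT ⨾ nip n m

  code : ∀ {k} → SimRec 𝔸 k → Prog 7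
  code (constr c)               = makeNode 0 c
  code (proj {m} i)             = pick 0 (toℕ i) ⨾ nip 0 m
  code (comp {m = m} f g)       = evalAll m (λ i → code (g i)) ⨾ code f ⨾ nip 0 m
  code (case f)                 = fetch 0 ⨾ onNode 0 (λ c → code (f c))
  code (simrec {n} {m} f j)     = recursion n m (λ c j → code (f c j)) j

  -- The resulting store is fixed before `N`, and `runs` holds for every `N` at least its length. As
  -- stores only grow, runs compose under the single condition on the last store.
  record Outcome (P : Prog 7) (G : List StoreNode) (e e′ : List Sym) {k} (ts : Vec (Term 𝔸) k) (w : ℕ) : Set where
    constructor outcome
    field
      {after}  : List StoreNode
      {values} : Vec ℕ k
      store    : Store after
      extends  : G ⊑ after
      growth   : length after ≤ w + length G
      unfs     : Pointwise (Unf after) values ts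
      runs     : ∀ {N τ q} → length after ≤ N →
                 Run N P (st (storeTape G) e τ q [] []) (st (storeTape after) (toList values ◂ e′) τ q [] [])

  Computes : ∀ {k} → Prog 7 → Fun 𝔸 k → Poly 1 → Set
  Computes {k} P f w = ∀ {G} {is : Vec ℕ k} {ts e s} → Store G → Pointwise (Unf G) is ts → VAll (Bounded s) ts →
                   Outcome P G (toList is ◂ e) e (f ts ∷ []) (w at s)

  ids-valid : ∀ {G H n} {is : Vec ℕ n} {ts} → Pointwise (Unf G) is ts → G ⊑ H → length H ≤ N → All (_< N) (toList is)
  ids-valid us sub le = All.map (λ i< → ≤-trans i< (≤-trans (⊑-length sub) le)) (Unfs-< us)

  evalAll-computes : ∀ {n l} {P : Fin n → Prog 7} {f : Fin n → Fun 𝔸 l} (w : Fin n → Poly 1) →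
    (∀ i → Computes (P i) (f i) (w i)) →
    ∀ {G} {is : Vec ℕ l} {ts e s} → Store G → Pointwise (Unf G) is ts → VAll (Bounded s) ts →
    Outcome (evalAll l P) G (toList is ◂ e) (toList is ◂ e) (tabulate λ i → f i ts) (∑ w at s)
  evalAll-computes {zero}  w cs store us bs = outcome store ⊑-refl ≤-refl [] (λ _ → nop!)
  evalAll-computes {suc n} w cs {G} {is} {e = e} {s} store us bs
    with evalAll-computes (w ∘ suc) (cs ∘ suc) {e = e} store us bs
  ... | outcome {H} {rs} store₁ sub₁ le₁ us₁ run₁ with cs zero {e = toList rs ◂ toList is ◂ e} store₁ (Unfs-⊑ sub₁ us) bs
  ...   | outcome {I} {r ∷ []} store₂ sub₂ le₂ (u ∷ []) run₂ = outcome store₂ (⊑-trans sub₁ sub₂)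
    (≤-trans le₂ (≤-trans (+-monoʳ-≤ (w zero at s) le₁) (≤-reflexive (sym (+-assoc (w zero at s) _ (length G))))))
    (u ∷ Unfs-⊑ sub₂ us₁)
    λ le → run₁ (≤-trans (⊑-length sub₂) le) ▸
           block! 0 (toList rs) is (Vec.length-toList rs) (ids-valid us₁ sub₂ le) (ids-valid us (⊑-trans sub₁ sub₂) le) ▸
           run₂ le

  constr-computes : ∀ c → Computes (makeNode 0 c) (con c) (const 1)
  constr-computes c store us bs with makeNode! 0 store us
  ... | H , i , store′ , sub , le , u , r = outcome store′ sub le (u ∷ []) (λ le → r le)

  proj-computes : ∀ {m} (i : Fin m) → Computes (code (proj i)) ⟦ proj i ⟧ (const 0)
  proj-computes i {G} {is} {e = e} store us bs = outcome store ⊑-refl ≤-refl (Pointwise.lookup us i ∷ []) λ {N} {τ} {q} le →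
    pick! 0 (subst (λ is′ → At is′ (toℕ i) (lookup is i)) (List.++-identityʳ (toList is)) (At-lookup is i)) (ids-valid us ⊑-refl le) ▸
    nip! 0 is (≤-trans (Unf-< (Pointwise.lookup us i)) le) (ids-valid us ⊑-refl le)

  comp-computes : ∀ {n m} {P : Prog 7} {f : Fun 𝔸 n} {Ps : Fin n → Prog 7} {g : Fin n → Fun 𝔸 m} {w} {ws r : Fin n → Poly 1}
    {ps : Fin n → Vec ℕ m} {p : Fin n → ℕ} →
    Computes P f w → (∀ i → Computes (Ps i) (g i) (ws i)) → (∀ i → SizeBound (g i) (ps i) (p i) (r i)) →
    Computes (evalAll m Ps ⨾ P ⨾ nip 0 m) (λ ts → f (tabulate λ i → g i ts))
      ((w ⊚ ∑ (λ i → (const m :* var zero) :+ r i)) :+ ∑ ws)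
  comp-computes {n} {m} {P} {f} {Ps} {g} {w} {ws} {r} c cs sbs {G} {is} {ts} {e} {s} store us bs
    with evalAll-computes ws cs {e = e} store us bs
  ... | outcome {H} {rs} store₁ sub₁ le₁ us₁ run₁
    with c {e = toList is ◂ e} {s = ∑ (λ i → (const m :* var zero) :+ r i) at s} store₁ us₁
      (VAll.tabulate⁺ λ i → bounded-≤ (≤-∑ (λ i → (const m :* var zero) :+ r i) i s) (bounded-value {q = r i} (sbs i) bs))
  ...   | outcome {I} {v ∷ []} store₂ sub₂ le₂ (u ∷ []) run₂ = outcome store₂ (⊑-trans sub₁ sub₂)
    (≤-trans le₂ (≤-trans (+-mono-≤ (≤-reflexive (sym (eval-⊚ w (∑ λ i → (const m :* var zero) :+ r i) (s ∷ [])))) le₁)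
      (≤-reflexive (sym (+-assoc ((w ⊚ ∑ λ i → (const m :* var zero) :+ r i) at s) (∑ ws at s) (length G))))))
    (u ∷ [])
    λ le → run₁ (≤-trans (⊑-length sub₂) le) ▸ run₂ le ▸
           nip! 0 is (≤-trans (Unf-< u) le) (ids-valid us (⊑-trans sub₁ sub₂) le)

  case-computes : ∀ {k} {P : Fin (K 𝔸) → Prog 7} {f : (i : Fin (K 𝔸)) → SimRec 𝔸 (ar 𝔸 i + k)} {w : Fin (K 𝔸) → Poly 1} →
    (∀ i → Computes (P i) ⟦ f i ⟧ (w i)) →
    Computes (fetch 0 ⨾ onNode 0 P) ⟦ case f ⟧ (∑ w)
  case-computes {P = P} {f} {w} cs {G} {x ∷ is} {con c ts ∷ us} {e} {s} store (unf {is = js} a vs ∷ vs′) (b ∷ bs)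
    with cs c {e = e} store (Pointwise.++⁺ vs vs′) (VAll.++⁺ (children-bounded b) bs)
  ... | outcome {H} {v ∷ []} store₁ sub le u run₁ = outcome store₁ sub (≤-trans le (+-monoˡ-≤ (length G) (≤-∑ w c s))) u
    λ {N} {τ} {q} le →
      fetch! 0 store (≤-trans (⊑-length sub) le) a ▸
      onNode! 0 {P = P} {c} (ids-valid vs sub le)
        (subst (λ z → Run N (P c) (st (storeTape G) z τ q [] []) (st (storeTape H) (idw v ∙ e) τ q [] []))
          (trans (cong (_◂ e) (Vec.toList-++ js is)) (◂-++ (toList js) (toList is)))
          (run₁ le))

-- Simultaneous recursion by tabulation

module Recursion (𝔸 : Signature) where

  open Evaluation 𝔸 public

  -- A table lists, newest first, the values r of the j-th function at the node i.
  Table : ℕ → Set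
  Table n = List (Fin n × ℕ × ℕ)

  tableWords : ∀ {n} → Table n → List Word
  tableWords []                  = []
  tableWords ((j , i , r) ∷ tab) = key (toℕ j) i ∷ idw r ∷ tableWords tab

  -- The entry that the linear search hits. Working with it avoids proving that keys occur only
  -- once: all entries are valid, so whichever is found is correct.
  data Newest {n} (j : Fin n) (i r : ℕ) : Table n → Set where
    here  : ∀ {tab} → Newest j i r ((j , i , r) ∷ tab)
    there : ∀ {j′ i′ r′ tab} → ¬ (j′ ≡ j × i′ ≡ i) → Newest j i r tab → Newest j i r ((j′ , i′ , r′) ∷ tab)

  Entry : ∀ {n} → Fin n → ℕ → Table n → Set
  Entry j i tab = ∃[ r ] (j , i , r) ∈ᴸ tab

  newest : ∀ {n} {j : Fin n} {i tab} → Entry j i tab → ∃[ r ] Newest j i r tab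
  newest {j = j} {i} {(j′ , i′ , r′) ∷ tab} (r , p) with j′ Fin.≟ j | i′ ≟ i
  ... | yes refl | yes refl = r′ , here
  newest (r , here refl) | no j≢  | _     = contradiction refl j≢
  newest (r , here refl) | yes _  | no i≢ = contradiction refl i≢
  newest (r , there p)   | no j≢  | _     = let r , f = newest (r , p) in r , there (j≢ ∘ proj₁) f
  newest (r , there p)   | yes _  | no i≢ = let r , f = newest (r , p) in r , there (i≢ ∘ proj₂) f

  newest-∈ : ∀ {n} {j : Fin n} {i r tab} → Newest j i r tab → (j , i , r) ∈ᴸ tab
  newest-∈ here        = here refl
  newest-∈ (there _ f) = there (newest-∈ f)

  InRange : ℕ → ∀ {n} → Fin n × ℕ × ℕ → Set
  InRange N (j , i , r) = i < N × r < N

  newest-maps : ∀ {N n} {j : Fin n} {i r tab} → All (InRange N) tab → Newest j i r tab →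
                Maps (wordLength n at N) (length tab * 2) (key (toℕ j) i) (idw r) (tableWords tab)
  newest-maps {n = n} {j} ((i< , r<) ∷ vs) here =
    maps {pre = []} refl [] [] (key-short n (Fin.toℕ<n j) i<) (idw-short n r<) z≤n
  newest-maps {n = n} {j} ((i< , r<) ∷ vs) (there {j′} ≢ f) =
    Maps-∷ (λ eq → let p , q = key-injective (toℕ j′) (toℕ j) eq in ≢ (Fin.toℕ-injective p , q))
      (key-short n (Fin.toℕ<n j′) i<) (Maps-∷ (λ ()) (idw-short n r<) (newest-maps vs f))

  tableWords-short : ∀ {N n} {tab : Table n} → All (InRange N) tab → All (Short (wordLength n at N)) (tableWords tab)
  tableWords-short []                              = []
  tableWords-short {n = n} {(j , _) ∷ _} ((i< , r<) ∷ vs) =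
    key-short n (Fin.toℕ<n j) i< ∷ idw-short n r< ∷ tableWords-short vs

  tableWords-nonempty : ∀ {n} (tab : Table n) → All (_≢ []) (tableWords tab)
  tableWords-nonempty []        = []
  tableWords-nonempty (_ ∷ tab) = (λ ()) ∷ (λ ()) ∷ tableWords-nonempty tab

  length-tableWords : ∀ {n} (tab : Table n) → length (tableWords tab) ≡ length tab * 2
  length-tableWords []        = refl
  length-tableWords (_ ∷ tab) = cong (2 +_) (length-tableWords tab)

  tableItems-bound : ∀ {N n l} → l ≤ n * N → l * 2 ≤ tableItems n at N
  tableItems-bound {N} {n} {l} le = begin
    l * 2       ≤⟨ *-monoˡ-≤ 2 le ⟩
    n * N * 2   ≡⟨ *-comm (n * N) 2 ⟩
    2 * (n * N) ≡⟨ sym (*-assoc 2 n N) ⟩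
    2 * n * N   ∎
    where open ≤-Reasoning

  recast : ∀ {N} {P : Prog 7} {s s′ τ τ′ q q′ x x′ y y′ e₁ e₂ e₁′ e₂′} → e₁ ≡ e₂ → e₁′ ≡ e₂′ →
           Run N P (st s e₁ τ q x y) (st s′ e₁′ τ′ q′ x′ y′) → Run N P (st s e₂ τ q x y) (st s′ e₂′ τ′ q′ x′ y′)
  recast refl refl r = r

  module _ {n : ℕ} where

    seps! : ∀ {N} j {v s e τ q x y} → Run N (seps n j) (st s (v ∙ e) τ q x y) (st s ((List.replicate j sep ++ v) ∙ e) τ q x y)
    seps! zero    = nop!
    seps! (suc j) = seps! j ▸ push!

    recall! : ∀ {N s e τ q y} j {i r ws} →
      Maps (wordLength n at N) (tableItems n at N) (key j i) (idw r) ws →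
      Run N (recall n j) (st s (idw i ∙ e) (ws ◁ τ) q [] y) (st s (idw r ∙ e) (ws ◁ τ) q [] y)
    recall! j {i} {r} {ws} f = seps! (suc j) ▸ call (tT ∷ tE ∷ tX ∷ tC ∷ []) (assoc₄! (key j i) (idw r) ws f)

    record Recalled (N : ℕ) (ws : List Word) (is : List ℕ) (pj : ℕ × ℕ) (r : ℕ) : Set where
      constructor recalled
      field
        {i}  : ℕ
        at-p : At is (proj₁ pj) i
        r<   : r < N
        found : Maps (wordLength n at N) (tableItems n at N) (key (proj₂ pj) i) (idw r) ws

    recallAll! : ∀ {N s e τ q y ws is a} {ps : Vec (ℕ × ℕ) a} {rs : Vec ℕ a} →
      All (_< N) is → Pointwise (Recalled N ws is) ps rs →
      Run N (recallAll n ps) (st s (is ◂ e) (ws ◁ τ) q [] y) (st s ((toList rs ++ is) ◂ e) (ws ◁ τ) q [] y)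
    recallAll! is< []                                    = nop!
    recallAll! {rs = r ∷ rs} is< (_∷_ {x = p , j} (recalled a r< f) fs) =
      recallAll! is< fs ▸ pick! n (At-shift′ n rs a) (All.++⁺ (valid fs) is<) ▸ recall! j f
      where
      valid : ∀ {N ws is a} {ps : Vec (ℕ × ℕ) a} {rs : Vec ℕ a} → Pointwise (Recalled N ws is) ps rs → All (_< N) (toList rs)
      valid []       = []
      valid (f ∷ fs) = Recalled.r< f ∷ valid fs

    memoize! : ∀ {N s e τ q is a} (j : Fin n) {i r} → All (_< N) is → r < N → At is a i →
      Run N (memoize n a (toℕ j)) (st s (idw r ∙ is ◂ e) τ q [] []) (st s (is ◂ e) (key (toℕ j) i ∙ idw r ∙ τ) q [] [])
    memoize! j {i} {r} is< r< a =
      call (tE ∷ tT ∷ tC ∷ []) (moveItem₃! (idw r) (idw-short n r<)) ▸ pick! n a is< ▸ seps! (suc (toℕ j)) ▸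
      call (tE ∷ tT ∷ tC ∷ []) (moveItem₃! (key (toℕ j) i) (key-short n (Fin.toℕ<n j) (At-All n a is<)))

  _≼_ : ∀ {n} → Table n → Table n → Set
  tab ≼ tab′ = ∃[ new ] tab′ ≡ new ++ tab

  ≼-trans : ∀ {n} {t u v : Table n} → t ≼ u → u ≼ v → t ≼ v
  ≼-trans {t = t} (x , refl) (y , refl) = y ++ x , sym (List.++-assoc y x t)

  ≼-length : ∀ {n} {t u : Table n} → t ≼ u → length t ≤ length u
  ≼-length {t = t} (x , refl) = ≤-trans (m≤n+m _ (length x)) (≤-reflexive (sym (List.length-++ x)))

  Entry-≼ : ∀ {n} {t u : Table n} → t ≼ u → ∀ {j i} → Entry j i t → Entry j i u
  Entry-≼ (x , refl) (r , p) = r , ∈-++⁺ʳ x p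

  -- Applied to the children of the current node `i`: they are visited by closedness and have
  -- smaller indices, so their table entries exist.
  ascending-before : ∀ (past : List ℕ) {i k todo} → AllPairs _<_ (past ++ i ∷ todo) → k ∈ᴸ past ++ i ∷ todo →
                     k < i → k ∈ᴸ past
  ascending-before []         _          (here refl) k<i = contradiction k<i (n≮n _)
  ascending-before []         (i< ∷ _)   (there p)   k<i = contradiction (<-trans k<i (All.lookup i< p)) (n≮n _)
  ascending-before (_ ∷ past) _          (here eq)   k<i = here eq
  ascending-before (_ ∷ past) (_ ∷ asc)  (there p)   k<i = there (ascending-before past asc p k<i)

  lookup-All : ∀ {A : ℕ → Set} {k} {is : Vec ℕ k} → All A (toList is) → ∀ l → A (lookup is l)
  lookup-All {is = _ ∷ _} (p ∷ _)  zero    = p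
  lookup-All {is = _ ∷ _} (_ ∷ ps) (suc l) = lookup-All ps l

  module _ {n m : ℕ} {f : (c : Fin (K 𝔸)) → Fin n → SimRec 𝔸 (ar 𝔸 c + (n * ar 𝔸 c + m))}
           (P : Fin (K 𝔸) → Fin n → Prog 7) (w : Fin (K 𝔸) → Fin n → Poly 1)
           (P-computes : ∀ c j → Computes (P c j) ⟦ f c j ⟧ (w c j))
           {us : Vec (Term 𝔸) m} where

    private
      φ : (c : Fin (K 𝔸)) → Fin n → Fun 𝔸 (ar 𝔸 c + (n * ar 𝔸 c + m))
      φ c j = ⟦ f c j ⟧

      g : Fin n → Term 𝔸 → Term 𝔸
      g = simrecOn φ us

    Valid : List StoreNode → Fin n × ℕ × ℕ → Set
    Valid H (j , i , r) = ∃[ t ] (Unf H i t × Unf H r (g j t))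

    Valid-⊑ : ∀ {H I e} → H ⊑ I → Valid H e → Valid I e
    Valid-⊑ sub (t , u , v) = t , Unf-⊑ sub u , Unf-⊑ sub v

    Valid-range : ∀ {H N tab} → length H ≤ N → All (Valid H) tab → All (InRange N) tab
    Valid-range le = All.map λ (t , u , v) → ≤-trans (Unf-< u) le , ≤-trans (Unf-< v) le

    record Grown (Q : Prog 7) (H : List StoreNode) (tab : Table n) (e e′ : List Sym) (b k : ℕ) (C : Table n → Set) : Set where
      constructor grown
      field
        {after}  : List StoreNode
        {table}  : Table n
        store    : Store after
        extends  : H ⊑ after
        growth   : length after ≤ b + length H
        valid    : All (Valid after) table
        longer   : tab ≼ table
        length-t : length table ≡ k + length tab
        covers   : C table
        runs     : ∀ {N τ q} → length after ≤ N → length table ≤ n * N →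
                   Run N Q (st (storeTape H) e (tableWords tab ◁ end ∷ τ) q [] [])
                           (st (storeTape after) e′ (tableWords table ◁ end ∷ τ) q [] [])

    -- The embedding `ι` of the functions still to be evaluated makes induction on their number
    -- possible while the table keeps all `n`.
    rows-grow : ∀ {n′} (Q : Fin n′ → Prog 7) (ι : Fin n′ → Fin n) (b : Fin n′ → Poly 1) {s i e H tab} →
      Store H → All (Valid H) tab →
      (∀ j {I tab′} → Store I → H ⊑ I → All (Valid I) tab′ → tab ≼ tab′ →
        Grown (Q j) I tab′ e e (b j at s) 1 (Entry (ι j) i)) →
      Grown (rows n Q) H tab e e (∑ b at s) n′ (λ tab → ∀ j → Entry (ι j) i tab)
    rows-grow {zero}  Q ι b store valid grow =
      grown store ⊑-refl ≤-refl valid ([] , refl) refl (λ ()) (λ _ _ → nop!)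
    rows-grow {suc n′} Q ι b {s} {H = H} {tab} store valid grow with grow zero store ⊑-refl valid ([] , refl)
    ... | grown {I} {t₁} store₁ sub₁ le₁ valid₁ longer₁ len₁ c₁ run₁
      with rows-grow (Q ∘ suc) (ι ∘ suc) (b ∘ suc) store₁ valid₁
             (λ j st sub v lo → grow (suc j) st (⊑-trans sub₁ sub) v (≼-trans longer₁ lo))
    ...   | grown store₂ sub₂ le₂ valid₂ longer₂ len₂ c₂ run₂ =
      grown store₂ (⊑-trans sub₁ sub₂)
        (≤-trans le₂ (≤-trans (+-monoʳ-≤ (∑ (b ∘ suc) at s) le₁)
          (≤-reflexive (trans (sym (+-assoc (∑ (b ∘ suc) at s) (b zero at s) (length H)))
            (cong (_+ length H) (+-comm (∑ (b ∘ suc) at s) (b zero at s)))))))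
        valid₂ (≼-trans longer₁ longer₂)
        (trans len₂ (trans (cong (n′ +_) len₁) (+-suc n′ (length tab))))
        (λ { zero → Entry-≼ longer₂ c₁ ; (suc j) → c₂ j })
        λ le le′ → run₁ (≤-trans (⊑-length sub₂) le) (≤-trans (≼-length longer₂) le′) ▸ run₂ le le′

    simrecOns-Unf : ∀ {H a} j (ts : Vec (Term 𝔸) a) {r : Fin a → ℕ} →
      (∀ l → Unf H (r l) (g j (lookup ts l))) → Pointwise (Unf H) (tabulate r) (simrecOns φ us j ts)
    simrecOns-Unf j []       us = []
    simrecOns-Unf j (t ∷ ts) us = us zero ∷ simrecOns-Unf j ts (us ∘ suc)

    row-grows : ∀ c j {s H tab i x e} {is : Vec ℕ (ar 𝔸 c)} {ts} {ys : Vec ℕ m} →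
      Store H → Pointwise (Unf H) is ts → Unf H i (con c ts) → x < length H → Pointwise (Unf H) ys us →
      VAll (Bounded s) ts → (∀ j → VAll (Bounded s) (simrecOns φ us j ts)) → VAll (Bounded s) us →
      All (Valid H) tab → (∀ l j → Entry j (lookup is l) tab) →
      let base = toList is ◂ idw i ∙ idw x ∙ toList ys ◂ e in
      Grown (row n (ar 𝔸 c) m j (P c j)) H tab base base (w c j at s) 1 (Entry j i)
    row-grows c j {s} {H} {tab} {i} {x} {e} {is} {ts} {ys} store vs v x< yv bs gs ub valid entries′ =
      evaluated (P-computes c j {e = base} store (Pointwise.++⁺ vs (Pointwise.++⁺ rv yv))
        (VAll.++⁺ bs (VAll.++⁺ (VAll.concat⁺ (VAll.tabulate⁺ gs)) ub)))
      where
      a = ar 𝔸 c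
      base = toList is ◂ idw i ∙ idw x ∙ toList ys ◂ e
      base-ids = toList is ++ i ∷ x ∷ toList ys
      recent : ∀ j l → ∃[ r ] Newest j (lookup is l) r tab
      recent j l = newest (entries′ l j)
      -- An entry is valid for some term at the child's index; as unfolding is functional, that term
      -- is the child itself.
      recent-unf : ∀ j l → Unf H (proj₁ (recent j l)) (g j (lookup ts l))
      recent-unf j l with recent j l
      ... | r , f with All.lookup valid (newest-∈ f)
      ...   | t , u , v rewrite Unf-functional (Pointwise.lookup vs l) u = v
      rs : Vec ℕ (n * a)
      rs = Vec.concat (tabulate λ j → tabulate λ l → proj₁ (recent j l))
      rv : Pointwise (Unf H) rs (results φ us ts)
      rv = Pointwise.concat⁺ (Pointwise.tabulate⁺ λ j → simrecOns-Unf j ts (recent-unf j))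
      unfold₁ : ∀ {z} → (toList is ++ i ∷ x ∷ []) ◂ z ≡ toList is ◂ idw i ∙ idw x ∙ z
      unfold₁ = ◂-++ (toList is) (i ∷ x ∷ [])
      unfold₂ : (toList ys ++ base-ids) ◂ e ≡ toList ys ◂ base
      unfold₂ = trans (◂-++ (toList ys) base-ids) (cong (toList ys ◂_) (◂-++ (toList is) (i ∷ x ∷ toList ys)))
      unfold₃ : ∀ {z} → toList (is Vec.++ (rs Vec.++ ys)) ◂ z ≡ toList is ◂ (toList rs ++ toList ys) ◂ z
      unfold₃ {z} = trans (cong (_◂ z) (trans (Vec.toList-++ is (rs Vec.++ ys)) (cong (toList is ++_) (Vec.toList-++ rs ys))))
        (◂-++ (toList is) (toList rs ++ toList ys))
      evaluated : Outcome (P c j) H (toList (is Vec.++ (rs Vec.++ ys)) ◂ base) base (g j (con c ts) ∷ []) (w c j at s) →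
                  Grown (row n a m j (P c j)) H tab base base (w c j at s) 1 (Entry j i)
      evaluated (outcome {I} {r ∷ []} store′ sub le (u ∷ []) runs) =
        grown {table = (j , i , r) ∷ tab} store′ sub le
          ((con c ts , Unf-⊑ sub v , u) ∷ All.map (Valid-⊑ sub) valid) ([ j , i , r ] , refl) refl (r , here refl)
          λ {N} le le′ →
            let is< = ids-valid vs sub le
                ys< = ids-valid yv sub le
                rs< = ids-valid rv sub le
                i<  = ≤-trans (Unf-< v) (≤-trans (⊑-length sub) le)
                x<′ = ≤-trans x< (≤-trans (⊑-length sub) le)
                b<  = All.++⁺ is< (i< ∷ x<′ ∷ ys<)
            in
            recast unfold₁ (cong (toList ys ◂_) unfold₁)
              (block! n (toList is ++ i ∷ x ∷ []) ys
                (trans (List.length-++ (toList is)) (cong (_+ 2) (Vec.length-toList is)))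
                (All.++⁺ is< (i< ∷ x<′ ∷ [])) ys<) ▸
            recast unfold₂ (trans (◂-++ (toList rs) (toList ys ++ base-ids)) (cong (toList rs ◂_) unfold₂))
              (recallAll! (All.++⁺ ys< b<) (Pointwise.concat⁺ (Pointwise.tabulate⁺ λ j → Pointwise.tabulate⁺ λ l →
                recalled (At-shift′ n ys (At-lookup is l)) (≤-trans (Unf-< (recent-unf j l)) (≤-trans (⊑-length sub) le))
                  (Maps-≤ (tableItems-bound {N} {n} (≤-trans (n≤1+n _) le′))
                    (newest-maps (Valid-range (≤-trans (⊑-length sub) le) valid) (proj₂ (recent j l))))))) ▸
            recast (◂-++ (toList rs) (toList ys)) (sym unfold₃)
              (block! n (toList rs ++ toList ys) is
                (trans (List.length-++ (toList rs)) (cong₂ _+_ (Vec.length-toList rs) (Vec.length-toList ys)))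
                (All.++⁺ rs< ys<) is<) ▸
            runs le ▸
            recast (cong (idw r ∙_) (◂-++ (toList is) (i ∷ x ∷ toList ys))) (◂-++ (toList is) (i ∷ x ∷ toList ys))
              (memoize! j b< (≤-trans (Unf-< u) le)
                (subst (λ k → At base-ids k i) (trans (cong (_+ 0) (Vec.length-toList is)) (+-identityʳ a))
                  (At-shift (toList is) here)))

    module _ {G : List StoreNode} {x : ℕ} {Q : List ℕ} {X : List (Term 𝔸)} {s : ℕ} {ys : Vec ℕ m}
             (G-store : Store G) (reachable : Reachable G x Q)
             (Q-terms : All (λ i → ∃[ t ] (Unf G i t × t ∈ᴸ X)) Q)
             (X-shared : Shared X) (X-bounded : ∀ {t} → t ∈ᴸ X → Bounded s t × (∀ j → Bounded s (g j t)))
             (ys-unfs : Pointwise (Unf G) ys us) (us-bounded : VAll (Bounded s) us) where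

      private
        W : ℕ
        W = ∑ (λ c → ∑ (w c)) at s

      record Loop (H : List StoreNode) (tab : Table n) (e : List Sym) (todo : List ℕ) : Set where
        constructor loop
        field
          {after}  : List StoreNode
          {table}  : Table n
          store    : Store after
          extends  : H ⊑ after
          growth   : length after ≤ length todo * W + length H
          valid    : All (Valid after) table
          longer   : tab ≼ table
          length-t : length table ≡ length todo * n + length tab
          covers   : ∀ {i} → i ∈ᴸ Q → ∀ j → Entry j i table
          iterates : ∀ {N τ q} → length after ≤ N → length table ≤ n * N →
                     Iter N (on tQ letter?) (process n m P)
                       (st (storeTape H) e (tableWords tab ◁ end ∷ τ) (todo ◂ end ∷ q) [] []) (length todo)
                       (st (storeTape after) e (tableWords table ◁ end ∷ τ) (end ∷ q) [] [])

      simrecOns-Bounded : ∀ {a} j {ts : Vec (Term 𝔸) a} → VAll (_∈ᴸ X) ts → VAll (Bounded s) (simrecOns φ us j ts)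
      simrecOns-Bounded j ts∈ = simrecOns-All φ us j (VAll.map (λ t∈ → proj₂ (X-bounded t∈) j) ts∈)

      -- The same `W` bounds every round: `X-bounded` covers, in advance, the children and their
      -- recursive results at all nodes. The growth is therefore linear in the number of nodes to be
      -- visited.
      process-all : ∀ past todo {H tab e} → past ++ todo ≡ Q → Store H → G ⊑ H → x < length H → All (Valid H) tab →
        (∀ {i} → i ∈ᴸ past → ∀ j → Entry j i tab) → Loop H tab (idw x ∙ toList ys ◂ e) todo
      process-all past [] eq store G⊑H x< valid entries′ =
        loop store ⊑-refl ≤-refl valid ([] , refl) refl
          (λ p → entries′ (subst (_ ∈ᴸ_) (sym (trans (sym (List.++-identityʳ past)) eq)) p)) (λ _ _ → done)
      process-all past (i ∷ todo) {H} {tab} {e} refl store G⊑H x< valid entries′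
        with All.lookup Q-terms (∈-++⁺ʳ past (here refl))
      ... | con c ts , unf {is = is} a vs , t∈X
        with rows-grow (λ j → row n (ar 𝔸 c) m j (P c j)) id (w c) {s = s} {i = i}
               {e = toList is ◂ idw i ∙ idw x ∙ toList ys ◂ e} store valid
               (λ j st sub v lo → row-grows c j st (Unfs-⊑ (⊑-trans G⊑H sub) vs) (Unf-⊑ (⊑-trans G⊑H sub) (unf a vs))
                 (≤-trans x< (⊑-length sub)) (Unfs-⊑ (⊑-trans G⊑H sub) ys-unfs)
                 (children-bounded (proj₁ (X-bounded t∈X))) (λ j → simrecOns-Bounded j (children-∈ X-shared t∈X)) us-bounded
                 v (λ l j → Entry-≼ lo (child-entries l j)))
        where
        child-entries : ∀ l j → Entry j (lookup is l) tab
        child-entries l = entries′ (ascending-before past (Reachable.ascending reachable)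
          (lookup-All (Reachable.closed reachable (∈-++⁺ʳ past (here refl)) a) l) (lookup-All (Store.below G-store a) l))
      ...   | grown {I} {tab₁} store₁ sub₁ le₁ valid₁ longer₁ len₁ covers₁ run₁
        with process-all (past ++ [ i ]) todo (List.++-assoc past [ i ] todo) store₁ (⊑-trans G⊑H sub₁)
               (≤-trans x< (⊑-length sub₁)) valid₁ entries₁
        where
        entries₁ : ∀ {k} → k ∈ᴸ past ++ [ i ] → ∀ j → Entry j k tab₁
        entries₁ p j with ∈-++⁻ past p
        ... | inj₁ q           = Entry-≼ longer₁ (entries′ q j)
        ... | inj₂ (here refl) = covers₁ j
      ...     | loop {J} {tab₂} store₂ sub₂ le₂ valid₂ longer₂ len₂ covers₂ iter₂ =
        loop store₂ (⊑-trans sub₁ sub₂)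
          (≤-trans le₂ (≤-trans (+-monoʳ-≤ (length todo * W) (≤-trans le₁ (+-monoˡ-≤ (length H) (≤-∑ (λ c → ∑ (w c)) c s))))
            (≤-reflexive (trans (sym (+-assoc (length todo * W) W (length H)))
              (cong (_+ length H) (+-comm (length todo * W) W))))))
          valid₂ (≼-trans longer₁ longer₂)
          (trans len₂ (trans (cong (length todo * n +_) len₁) (trans (sym (+-assoc (length todo * n) n (length tab)))
            (cong (_+ length tab) (+-comm (length todo * n) n)))))
          covers₂
          λ {N} {τ} {q} le le′ →
            let leI = ≤-trans (⊑-length sub₂) le
                leH = ≤-trans (⊑-length sub₁) leI
                is< = ids-valid vs (⊑-trans G⊑H sub₁) leI
                i<  = ≤-trans (Unf-< (unf a vs)) (≤-trans (⊑-length G⊑H) leH)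
            in
            (refl ,
              (call (tQ ∷ tE ∷ tC ∷ []) (moveItem₃! (idw i) (idw-short n i<)) ▸
               pick! n {is = [ i ]} here (i< ∷ []) ▸
               fetch! n store leH (At-⊑ G⊑H a) ▸
               onNode! n {c = c} is<
                 (run₁ leI (≤-trans (≼-length longer₂) le′) ▸
                  recast {e₁′ = idw x ∙ toList ys ◂ e}
                    (trans (cong (_◂ idw x ∙ toList ys ◂ e) (Vec.toList-++ is (i ∷ []))) (◂-++ (toList is) [ i ])) refl
                    (drops! n (is Vec.++ i ∷ [])
                      (subst (All (_< N)) (sym (Vec.toList-++ is (i ∷ []))) (All.++⁺ is< (i< ∷ [])))))))
            ▹ iter₂ le le′

-- Correctness and growth of the evaluation

module Correctness (𝔸 : Signature) where

  open Recursion 𝔸 public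

  ascending-injective : ∀ {Q} → AllPairs _<_ Q → ∀ p p′ → List.lookup Q p ≡ List.lookup Q p′ → p ≡ p′
  ascending-injective (x< ∷ asc) zero    zero     eq = refl
  ascending-injective (x< ∷ asc) zero    (suc p′) eq = contradiction eq (<⇒≢ (All.lookup x< (∈-lookup p′)))
  ascending-injective (x< ∷ asc) (suc p) zero     eq = contradiction (sym eq) (<⇒≢ (All.lookup x< (∈-lookup p)))
  ascending-injective (x< ∷ asc) (suc p) (suc p′) eq = cong suc (ascending-injective asc p p′ eq)

  -- The pigeonhole principle, since a strictly increasing list has no repetitions. Counting against
  -- the store bounds the iterations by `N`; counting against a list of terms bounds the growth by
  -- `s`.
  ascending-length : ∀ {k Q} (R : ℕ → Fin k → Set) → (∀ {i j v} → R i v → R j v → i ≡ j) →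
                     AllPairs _<_ Q → All (λ i → ∃ (R i)) Q → length Q ≤ k
  ascending-length {k} {Q} R inj asc hs = Fin.injective⇒≤ {f = image} image-injective
    where
    image : Fin (length Q) → Fin k
    image p = proj₁ (All.lookup hs (∈-lookup p))
    image-injective : ∀ {p p′} → image p ≡ image p′ → p ≡ p′
    image-injective {p} {p′} eq = ascending-injective asc p p′
      (inj (proj₂ (All.lookup hs (∈-lookup p)))
           (subst (R _) (sym eq) (proj₂ (All.lookup hs (∈-lookup p′)))))

  reachable-< : ∀ {G x Q} → Store G → x < length G → Reachable G x Q → All (_< length G) Q
  reachable-< store x< reachable = Reachable.least reachable _ x< (λ _ → store-children 0 store ≤-refl)

  length-reachable : ∀ {G x Q} → Store G → x < length G → Reachable G x Q → length Q ≤ length G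
  length-reachable {G} store x< reachable = ascending-length (λ i v → toℕ v ≡ i) (λ p q → trans (sym p) q)
    (Reachable.ascending reachable) (All.map (λ i< → fromℕ< i< , Fin.toℕ-fromℕ< i<) (reachable-< store x< reachable))

  Unfs-toList : ∀ {G k} {is : Vec ℕ k} {ts : Vec (Term 𝔸) k} {L} → Pointwise (Unf G) is ts → VAll (_∈ᴸ L) ts →
                All (λ i → ∃[ t ] (Unf G i t × t ∈ᴸ L)) (toList is)
  Unfs-toList []       []       = []
  Unfs-toList (u ∷ us) (p ∷ ps) = (_ , u , p) ∷ Unfs-toList us ps

  reachable-terms : ∀ {G x Q t L} → Reachable G x Q → Unf G x t → Shared L → t ∈ᴸ L →
                    All (λ i → ∃[ t ] (Unf G i t × t ∈ᴸ L)) Q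
  reachable-terms {G} {L = L} reachable u sh t∈ = Reachable.least reachable _ (_ , u , t∈) closed
    where
    closed : Closed G (λ i → ∃[ t ] (Unf G i t × t ∈ᴸ L))
    closed (con c ts , unf a vs , t∈) a′ with refl ← At-functional a a′ = Unfs-toList vs (children-∈ sh t∈)

  -- Here maximal sharing pays off: distinct nodes unfold to distinct terms, so a recursion visits
  -- at most as many nodes as its argument has distinct subterms, however large the store is.
  length-reachable-terms : ∀ {G Q L} → Store G → AllPairs _<_ Q → All (λ i → ∃[ t ] (Unf G i t × t ∈ᴸ L)) Q →
                           length Q ≤ length L
  length-reachable-terms {G} {L = L} store asc us = ascending-length (λ i v → Unf G i (List.lookup L v))
    (Unf-injective store) asc
    (All.map (λ { (t , u , t∈) → index t∈ , subst (Unf G _) (lookup-index t∈) u }) us)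

  opaque
    unfolding recursion

    recursion-run! : ∀ {N n m} {P : Fin (K 𝔸) → Fin n → Prog 7} (j : Fin n) {G H x Q tab e τ q r} {ys : Vec ℕ m} →
      length Q ≤ N → length tab ≤ n * N → All (InRange N) tab → Newest j x r tab → r < N → All (_< N) (toList ys) →
      Run N (reach n) (st (storeTape G) (idw x ∙ toList ys ◂ e) τ (end ∷ q) [] [])
                      (st (storeTape G) (idw x ∙ toList ys ◂ e) τ (Q ◂ end ∷ q) [] []) →
      Iter N (on tQ letter?) (process n m P)
        (st (storeTape G) (idw x ∙ toList ys ◂ e) (end ∷ τ) (Q ◂ end ∷ q) [] []) (length Q)
        (st (storeTape H) (idw x ∙ toList ys ◂ e) (tableWords tab ◁ end ∷ τ) (end ∷ q) [] []) →
      Run N (recursion n m P j) (st (storeTape G) (idw x ∙ toList ys ◂ e) τ q [] []) (st (storeTape H) (idw r ∙ e) τ q [] [])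
    recursion-run! {N} {n} j {tab = tab} {ys = ys} Q≤N tab≤N in-range found r< ys< reach-runs iterates =
      push! ▸ reach-runs ▸ push! ▸ while! iterates refl Q≤N ▸ pop! refl ▸
      recall! (toℕ j) (Maps-≤ (tableItems-bound {N} {n} tab≤N) (newest-maps in-range found)) ▸
      call (tT ∷ []) (clear₁! (tableWords tab) (tableWords-short in-range) (tableWords-nonempty tab) refl
        (≤-trans (≤-reflexive (length-tableWords tab)) (tableItems-bound {N} {n} tab≤N))) ▸
      pop! refl ▸ nip! n ys r< ys<

  -- The size bound `sb` of the whole recursion is applied to every subterm of the argument. It
  -- bounds all results to be tabulated, and only then can the growth bounds of the functions
  -- `f c j` be invoked.
  simrec-computes : ∀ {n m} {f : (c : Fin (K 𝔸)) → Fin n → SimRec 𝔸 (ar 𝔸 c + (n * ar 𝔸 c + m))}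
    {P : Fin (K 𝔸) → Fin n → Prog 7} {w : Fin (K 𝔸) → Fin n → Poly 1} {ps p q} →
    (∀ c j → Computes (P c j) ⟦ f c j ⟧ (w c j)) → (∀ j → SizeBound ⟦ simrec f j ⟧ ps p q) → ∀ j →
    Computes (recursion n m P j) ⟦ simrec f j ⟧
      (var zero :* (∑ (λ c → ∑ (w c)) ⊚ (var zero :+ ((const (suc m) :* var zero) :+ q))))
  simrec-computes {n} {m} {f} {P} {w} {q = q} cs sb j {G} {x ∷ ys} {t ∷ us} {e} {s} store (u ∷ yv) (b ∷ bs)
    = visit-all (reach! n store (Unf-< u)) b
    where
    -- The summand `s` serves the subterms of the argument and the parameters; the rest is
    -- `bounded-value` for a function of `suc m` arguments and serves the results.
    r : Poly 1
    r = var zero :+ ((const (suc m) :* var zero) :+ q)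
    visit-all : ∃[ Q ] (Reachable G x Q × Reaches n store x Q) → Bounded s t →
                Outcome (recursion n m P j) G (toList (x ∷ ys) ◂ e) e (⟦ simrec f j ⟧ (t ∷ us) ∷ []) _
    visit-all (Q , reachable , reach-runs) (bounded {X} shared few t∈) = conclude
      (process-all {f = f} P w cs store reachable terms shared X-bounded yv (VAll.map (bounded-≤ (m≤m+n s _)) bs)
        [] Q {tab = []} refl store ⊑-refl (Unf-< u) [] (λ ()))
      where
      terms = reachable-terms reachable u shared t∈
      X-bounded : ∀ {t} → t ∈ᴸ X → Bounded (r at s) t × (∀ j → Bounded (r at s) (⟦ simrec f j ⟧ (t ∷ us)))
      X-bounded t∈ = bounded-≤ (m≤m+n s _) (bounded shared few t∈) ,
        λ j → bounded-≤ (m≤n+m _ s) (bounded-value {q = q} (sb j) (bounded shared few t∈ ∷ bs))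
      conclude : Loop {f = f} P w cs store reachable terms shared X-bounded yv _ G [] (idw x ∙ toList ys ◂ e) Q →
                 Outcome (recursion n m P j) G (toList (x ∷ ys) ◂ e) e (⟦ simrec f j ⟧ (t ∷ us) ∷ []) _
      conclude (loop {H} {table} store′ sub le valid _ len covers iterates)
        with v , found ← newest (covers (Reachable.source reachable) j)
        with t′ , u′ , u″ ← All.lookup valid (newest-∈ found)
        with refl ← Unf-functional u′ (Unf-⊑ sub u) =
        outcome store′ sub growth (u″ ∷ []) λ {N} {τ} {q} le →
          let leG = ≤-trans (⊑-length sub) le
              leQ = ≤-trans (length-reachable store (Unf-< u) reachable) leG
              le′ = ≤-trans (≤-reflexive (trans len (+-identityʳ _)))
                      (≤-trans (*-monoˡ-≤ n leQ) (≤-reflexive (*-comm N n)))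
              in-range = Valid-range {f = f} P w cs le valid
          in
          recursion-run! j {G = G} {H} {Q = Q} leQ le′ in-range found (≤-trans (Unf-< u″) le) (ids-valid yv sub le) (reach-runs leG) (iterates le le′)
        where
        W = ∑ (λ c → ∑ (w c))
        growth : length H ≤ s * ((W ⊚ r) at s) + length G
        growth = ≤-trans le (+-monoˡ-≤ (length G) (*-mono-≤
          (≤-trans (length-reachable-terms store (Reachable.ascending reachable) terms) few)
          (≤-reflexive (sym (eval-⊚ W r (s ∷ []))))))

  growthPoly : ∀ {k} {f : SimRec 𝔸 k} {ps m} → f ▷ ps ⟶ m → Poly 1
  growthPoly constr                        = const 1
  growthPoly proj                          = const 0
  growthPoly (comp {l = k} d ds)           =
    (growthPoly d ⊚ ∑ (λ i → (const k :* var zero) :+ sizePoly (ds i))) :+ ∑ (λ i → growthPoly (ds i))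
  growthPoly (case ds)                     = ∑ (λ i → growthPoly (ds i))
  growthPoly d@(simrec {l = m} j m<p ds)   =
    var zero :* (∑ (λ c → ∑ (λ j → growthPoly (ds c j))) ⊚ (var zero :+ ((const (suc m) :* var zero) :+ sizePoly d)))

  code-computes : ∀ {k} {f : SimRec 𝔸 k} {ps m} (d : f ▷ ps ⟶ m) → Computes (code f) ⟦ f ⟧ (growthPoly d)
  code-computes (constr {c})        = constr-computes c
  code-computes (proj {i = i})      = proj-computes i
  code-computes (comp {f = f} {g} d ds) =
    comp-computes {f = ⟦ f ⟧} {g = λ i → ⟦ g i ⟧} {w = growthPoly d} {λ i → growthPoly (ds i)} {λ i → sizePoly (ds i)}
      (code-computes d) (λ i → code-computes (ds i)) (λ i → size-bound (ds i))
  code-computes (case {f = f} ds)   =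
    case-computes {f = f} {w = λ i → growthPoly (ds i)} (λ i → code-computes (ds i))
  code-computes (simrec {f = f} j m<p ds) =
    simrec-computes {f = f} {w = λ c j → growthPoly (ds c j)} {q = sizePoly (simrec j m<p ds)}
      (λ c j → code-computes (ds c j)) (λ j → size-bound (simrec j m<p ds)) j

-- Reading the input

module Input (𝔸 : Signature) where

  open Correctness 𝔸 public

  sep? : Maybe Sym → Bool
  sep? (just (inj₁ sep)) = true
  sep? _                 = false

  -- The input arrives reversed, so Polish notation is read from its end: the arguments of a
  -- constructor are complete, the first one on top, when the constructor is met. Arities determine
  -- where terms end, and a separator is merely dropped.
  parseSymbol : Prog 7
  parseSymbol = branch (on tQ sep?) (pop tQ) (cases tQ id (λ c → pop tQ ⨾ makeNode 0 c))

  opaque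

    parse : Prog 7
    -- The `end` on `tS` is the empty word in front of the store, which makes the tape represent the
    -- empty store.
    parse = rename (tC ∷ tQ ∷ []) (transfer (var zero) nonempty?) ⨾ push tS end ⨾
            while (on tQ nonempty?) (var zero) parseSymbol

  record Parsed (G : List StoreNode) (w : Word) {k} (ts : Vec (Term 𝔸) k) (b l : ℕ) : Set where
    constructor parsed
    field
      {after}  : List StoreNode
      {values} : Vec ℕ k
      store    : Store after
      extends  : G ⊑ after
      growth   : length after ≤ b + length G
      unfs     : Pointwise (Unf after) values ts
      iterates : ∀ {N e τ q} → length after ≤ N →
                 Iter N (on tQ nonempty?) parseSymbol (st (storeTape G) e τ (map inj₁ w ʳ++ q) [] []) l
                      (st (storeTape after) (toList values ◂ e) τ q [] [])

  private
    spill-++ : ∀ (v w : Word) {x : List Sym} → map inj₁ (v ++ w) ʳ++ x ≡ map inj₁ w ʳ++ (map inj₁ v ʳ++ x)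
    spill-++ v w = trans (cong (_ʳ++ _) (List.map-++ inj₁ v w)) (List.++-ʳ++ (map inj₁ v))

  recount : ∀ {N b P σ σ′ l l′} → l ≡ l′ → Iter {7} N b P σ l σ′ → Iter N b P σ l′ σ′
  recount refl it = it

  parse-term  : ∀ {G} → Store G → ∀ t → Parsed G (encodeTerm t) (t ∷ []) (size t) (size t)
  parse-terms : ∀ {G} → Store G → ∀ {k} (ts : Vec (Term 𝔸) k) → Parsed G (encodeTerms ts) ts (sizes ts) (sizes ts)
  parse-term {G} store (con c ts) with parse-terms store ts
  ... | parsed {H} {is} store₁ sub₁ le₁ us₁ iter₁ with makeNode! 0 {c = c} store₁ us₁
  ...   | I , i , store₂ , sub₂ , le₂ , u , run₂ = parsed {values = i ∷ []} store₂ (⊑-trans sub₁ sub₂)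
    (≤-trans le₂ (s≤s le₁)) (u ∷ [])
    λ {N} {e} {τ} {q} le →
      recount (+-comm (sizes ts) 1)
        (iter₁ (≤-trans (⊑-length sub₂) le) ▹▹
          ((refl , else! refl (cases! tQ id _ id c refl (pop! refl ▸ run₂ le))) ▹ done))
  parse-terms store []       = parsed store ⊑-refl ≤-refl [] (λ _ → done)
  parse-terms {G} store (t ∷ ts) with parse-terms store ts
  ... | parsed {H} {is} store₁ sub₁ le₁ us₁ iter₁ with parse-term store₁ t
  ...   | parsed {I} {i ∷ []} store₂ sub₂ le₂ (u ∷ []) iter₂ = parsed store₂ (⊑-trans sub₁ sub₂)
    (≤-trans le₂ (≤-trans (+-monoʳ-≤ (size t) le₁) (≤-reflexive (sym (+-assoc (size t) (sizes ts) (length G))))))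
    (u ∷ Unfs-⊑ sub₂ us₁)
    λ {N} {e} {τ} {q} le →
      subst (λ z → Iter N (on tQ nonempty?) parseSymbol (st (storeTape G) e τ z [] []) (size t + sizes ts)
                     (st (storeTape I) (toList (i ∷ is) ◂ e) τ q [] []))
        (sym (spill-++ (encodeTerm t) (encodeTerms ts)))
        (recount (+-comm (sizes ts) (size t))
          (iter₁ (≤-trans (⊑-length sub₂) le) ▹▹ iter₂ le))

  parse-inputs : ∀ {G} → Store G → ∀ {k} (ts : Vec (Term 𝔸) k) → Parsed G (encodeInputs ts) ts (sizes ts) (sizes ts + k)
  parse-inputs store []       = parsed store ⊑-refl ≤-refl [] (λ _ → done)
  parse-inputs {G} store {suc k} (t ∷ ts) with parse-inputs store ts
  ... | parsed {H} {is} store₁ sub₁ le₁ us₁ iter₁ with parse-term store₁ t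
  ...   | parsed {I} {i ∷ []} store₂ sub₂ le₂ (u ∷ []) iter₂ = parsed store₂ (⊑-trans sub₁ sub₂)
    (≤-trans le₂ (≤-trans (+-monoʳ-≤ (size t) le₁) (≤-reflexive (sym (+-assoc (size t) (sizes ts) (length G))))))
    (u ∷ Unfs-⊑ sub₂ us₁)
    λ {N} {e} {τ} {q} le →
      subst (λ z → Iter N (on tQ nonempty?) parseSymbol (st (storeTape G) e τ z [] []) (size t + sizes ts + suc k)
                     (st (storeTape I) (toList (i ∷ is) ◂ e) τ q [] []))
        (sym (trans (spill-++ (encodeTerm t ++ [ sep ]) (encodeInputs ts))
                    (cong (map inj₁ (encodeInputs ts) ʳ++_) (spill-++ (encodeTerm t) [ sep ]))))
        (recount count-eq
          (iter₁ (≤-trans (⊑-length sub₂) le) ▹▹ ((refl , then! refl (pop! refl)) ▹ iter₂ le)))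
    where
    count-eq : sizes ts + k + suc (size t) ≡ size t + sizes ts + suc k
    count-eq = begin
      sizes ts + k + suc (size t)   ≡⟨ +-comm (sizes ts + k) (suc (size t)) ⟩
      suc (size t + (sizes ts + k)) ≡⟨ cong suc (sym (+-assoc (size t) (sizes ts) k)) ⟩
      suc (size t + sizes ts + k)   ≡⟨ sym (+-suc (size t + sizes ts) k) ⟩
      size t + sizes ts + suc k     ∎
      where open ≡-Reasoning

  length-encodeTerm  : ∀ (t : Term 𝔸) → length (encodeTerm t) ≡ size t
  length-encodeTerms : ∀ {k} (ts : Vec (Term 𝔸) k) → length (encodeTerms ts) ≡ sizes ts
  length-encodeTerm (con c ts)  = cong suc (length-encodeTerms ts)
  length-encodeTerms []         = refl
  length-encodeTerms (t ∷ ts)   =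
    trans (List.length-++ (encodeTerm t)) (cong₂ _+_ (length-encodeTerm t) (length-encodeTerms ts))

  length-encodeInputs : ∀ {k} (ts : Vec (Term 𝔸) k) → length (encodeInputs ts) ≡ sizes ts + k
  length-encodeInputs []               = refl
  length-encodeInputs {suc k} (t ∷ ts) = begin
    length ((encodeTerm t ++ [ sep ]) ++ encodeInputs ts) ≡⟨ List.length-++ (encodeTerm t ++ [ sep ]) ⟩
    length (encodeTerm t ++ [ sep ]) + length (encodeInputs ts)
      ≡⟨ cong₂ _+_ (trans (List.length-++ (encodeTerm t)) (cong (_+ 1) (length-encodeTerm t))) (length-encodeInputs ts) ⟩
    size t + 1 + (sizes ts + k)   ≡⟨ +-assoc (size t) 1 _ ⟩
    size t + suc (sizes ts + k)   ≡⟨ cong (size t +_) (sym (+-suc (sizes ts) k)) ⟩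
    size t + (sizes ts + suc k)   ≡⟨ sym (+-assoc (size t) (sizes ts) (suc k)) ⟩
    size t + sizes ts + suc k     ∎
    where open ≡-Reasoning

  bounded-term  : ∀ t → Bounded (size t) t
  bounded-terms : ∀ {k} (ts : Vec (Term 𝔸) k) → Σ[ L ∈ List (Term 𝔸) ] (Shared L × length L ≤ sizes ts × VAll (_∈ᴸ L) ts)
  bounded-term (con c ts) =
    let L , sh , le , ts∈ = bounded-terms ts in bounded (ts∈ ∷ sh) (s≤s le) (here refl)
  bounded-terms []       = [] , [] , z≤n , []
  bounded-terms (t ∷ ts) with bounded-term t | bounded-terms ts
  ... | bounded {L} sh le t∈ | M , sh′ , le′ , ts∈ =
    L ++ M , Shared-++ sh sh′ , ≤-trans (≤-reflexive (List.length-++ L)) (+-mono-≤ le le′) ,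
    ∈-++⁺ˡ t∈ ∷ VAll.map (∈-++⁺ʳ L) ts∈

  Parses : ∀ {k} → Vec (Term 𝔸) k → Set
  Parses {k} ts = ∃[ G ] Σ[ is ∈ Vec ℕ k ] (Store G × length G ≤ sizes ts × Pointwise (Unf G) is ts ×
    (∀ {N} → length G ≤ N → sizes ts + k ≤ N →
      Run N parse (map inj₁ (encodeInputs ts) , blanks) (st (storeTape G) (toList is ◂ []) [] [] [] [])))

  opaque
    unfolding parse

    parse! : ∀ {k} (ts : Vec (Term 𝔸) k) → Parses ts
    parse! {k} ts with parse-inputs empty-store ts
    ... | parsed {G} {is} store _ le us iter = G , is , store , ≤-trans le (≤-reflexive (+-identityʳ _)) , us , λ {N} leG leN →
      call (tC ∷ tQ ∷ [])
        (subst (λ w → Run N (transfer (var zero) nonempty?) (w , [] , tt) ([] , map inj₁ (encodeInputs ts) ʳ++ [] , tt))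
          (List.++-identityʳ (map inj₁ (encodeInputs ts)))
          (transfer! {p = nonempty?} (map inj₁ (encodeInputs ts)) (all-nonempty (map inj₁ (encodeInputs ts))) refl
            (≤-trans (≤-reflexive (trans (List.length-map inj₁ (encodeInputs ts)) (length-encodeInputs ts))) leN))) ▸
      push! ▸ while! (iter leG) refl leN

-- Writing the output

module Output (𝔸 : Signature) where

  open Input 𝔸 public

  private
    ℓ : Poly 1
    ℓ = wordLength 1

  -- The prescribed output format, with one tick less per index than `body`; `writeArgs` pops the
  -- surplus tick.
  argsText : ∀ {n} → Vec ℕ n → Word
  argsText []       = []
  argsText (p ∷ ps) = List.replicate p tick ++ sep ∷ argsText ps

  nodeText : StoreNode → Word
  nodeText (c , ps) = ctr c ∷ argsText ps

  text : List StoreNode → Word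
  text = concatMap nodeText

  writeArgs : ℕ → Prog 2
  writeArgs zero    = nop
  writeArgs (suc n) = pop t0 ⨾ transfer ℓ letter? ⨾ pop t0 ⨾ push t1 (inj₁ sep) ⨾ writeArgs n

  writeNode : Fin (K 𝔸) → Prog 7
  writeNode c =
    recallAll 1 (tabulate {n = ar 𝔸 c} λ l → toℕ l , 0) ⨾
    push tY (inj₁ (ctr c)) ⨾ rename (tE ∷ tY ∷ []) (writeArgs (ar 𝔸 c)) ⨾ drops 1 (ar 𝔸 c)

  -- The index of the next node to be written is kept below the current node.
  emit : Prog 7
  emit =
    moveItem 1 tQ tE ⨾ pick 1 0 ⨾ fetch 1 ⨾ onNode 1 writeNode ⨾
    pick 1 1 ⨾ moveItem 1 tE tT ⨾ seps 1 1 ⨾ moveItem 1 tE tT ⨾ push tE (inj₁ tick)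

  opaque

    -- The tape `tC` is the scratch space of all item operations, so the text gathers in reverse on
    -- `tY` and reaches `tC` only after the last of them. The root comes first in the encoding and
    -- is therefore pushed last.
    output : Prog 7
    output =
      -- The last two pushes write `idw 0`, the number of the first node of the copy.
      push tQ end ⨾ reach 1 ⨾ push tE end ⨾ push tE (inj₁ tick) ⨾
      while (on tQ letter?) (var zero) emit ⨾
      dropItem 1 tE ⨾ recall 1 0 ⨾
      rename (tY ∷ tC ∷ []) (transfer (var zero :* ℓ) nonempty?) ⨾
      push tC (inj₁ sep) ⨾ pop tE ⨾ rename (tE ∷ tC ∷ []) (transfer ℓ letter?)

  writeArgs! : ∀ {N n e y} (ps : Vec ℕ n) → All (_< N) (toList ps) →
               Run N (writeArgs n) (toList ps ◂ e , y , tt) (e , map inj₁ (argsText ps) ʳ++ y , tt)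
  writeArgs! []       []         = nop!
  writeArgs! {N} {e = e} {y} (p ∷ ps) (p< ∷ ps<) =
    pop! refl ▸ transferWord! (List.replicate p tick) (≤-trans (n≤1+n _) (idw-short 1 p<)) ▸ pop! refl ▸ push! ▸
    subst (λ z → Run N (writeArgs _) (toList ps ◂ e , inj₁ sep ∷ (map inj₁ (List.replicate p tick) ʳ++ y) , tt) (e , z , tt))
      (sym (spilled 1 (List.replicate p tick) (argsText ps))) (writeArgs! ps ps<)

  argsText-short : ∀ {n} (ps : Vec ℕ n) → length (argsText ps) ≤ length (body ps)
  argsText-short []       = z≤n
  argsText-short (p ∷ ps) = begin
    length (List.replicate p tick ++ sep ∷ argsText ps) ≡⟨ List.length-++ (List.replicate p tick) ⟩
    length (List.replicate p tick) + suc (length (argsText ps))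
      ≤⟨ +-monoʳ-≤ (length (List.replicate p tick)) (s≤s (argsText-short ps)) ⟩
    length (List.replicate p tick) + suc (length (body ps))
      ≤⟨ n≤1+n _ ⟩
    suc (length (List.replicate p tick) + suc (length (body ps)))
      ≡⟨ cong suc (sym (List.length-++ (List.replicate p tick))) ⟩
    length (body (p ∷ ps)) ∎
    where open ≤-Reasoning

  text-length : ∀ {N} H → (∀ {i c is} → At H i (c , is) → All (_< N) (toList is)) →
                length (text H) ≤ length H * ℓ at N
  text-length []             is< = z≤n
  text-length ((c , ps) ∷ H) is< = ≤-trans (≤-reflexive (List.length-++ (nodeText (c , ps))))
    (+-mono-≤ (≤-trans (s≤s (argsText-short ps)) (nodew-short 1 c ps (is< here))) (text-length H (is< ∘ there)))

  spilledText : List StoreNode → List Sym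
  spilledText H = map inj₁ (text H) ʳ++ []

  spilledText-snoc : ∀ H n → spilledText (H ++ [ n ]) ≡ map inj₁ (nodeText n) ʳ++ spilledText H
  spilledText-snoc H n = begin
    map inj₁ (text (H ++ [ n ])) ʳ++ []
      ≡⟨ cong (λ w → map inj₁ w ʳ++ []) (trans (List.concatMap-++ nodeText H [ n ]) (cong (text H ++_) (List.++-identityʳ _))) ⟩
    map inj₁ (text H ++ nodeText n) ʳ++ []
      ≡⟨ cong (_ʳ++ []) (List.map-++ inj₁ (text H) (nodeText n)) ⟩
    (map inj₁ (text H) ++ map inj₁ (nodeText n)) ʳ++ []
      ≡⟨ List.++-ʳ++ (map inj₁ (text H)) ⟩
    map inj₁ (nodeText n) ʳ++ spilledText H ∎
    where open ≡-Reasoning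

  Same : (G H : List StoreNode) → ℕ → ℕ → Set
  Same G H i p = ∃[ t ] (Unf G i t × Unf H p t)

  -- `H` is the part `past` of the reachable nodes, renumbered consecutively, and `tab` is the
  -- renumbering in the form of a table for one function. That `H` contains nothing else,
  -- `originals`, is used twice: a node to be added is new, and the final graph is rooted.
  record Copy (G : List StoreNode) (past : List ℕ) (H : List StoreNode) (tab : Table 1) : Set where
    field
      store     : Store H
      length-H  : length H ≡ length past
      length-t  : length tab ≡ length past
      valid     : All (λ (_ , i , p) → Same G H i p) tab
      recorded  : ∀ {i} → i ∈ᴸ past → Entry zero i tab
      originals : ∀ {p} → p < length H → ∃[ i ] (i ∈ᴸ past × Same G H i p)

  module _ {G : List StoreNode} {x : ℕ} {Q : List ℕ} (G-store : Store G) (reachable : Reachable G x Q)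
           (Q-terms : All (λ i → ∃ (Unf G i)) Q) where

    Copies : List ℕ → List StoreNode → Table 1 → Set
    Copies todo H tab =
      ∃[ H′ ] ∃[ tab′ ] (Copy G Q H′ tab′ × H ⊑ H′ ×
        (∀ {N e q} → length G ≤ N → length H′ ≤ N →
          Iter N (on tQ letter?) emit
            (st (storeTape G) (idw (length H) ∙ e) (tableWords tab ◁ []) (todo ◂ end ∷ q) [] (spilledText H)) (length todo)
            (st (storeTape G) (idw (length H′) ∙ e) (tableWords tab′ ◁ []) (end ∷ q) [] (spilledText H′))))

    copy-all : ∀ past todo {H tab} → past ++ todo ≡ Q → Copy G past H tab → Copies todo H tab
    copy-all past [] {H} {tab} eq copy =
      H , tab , subst (λ past → Copy G past H tab) (trans (sym (List.++-identityʳ past)) eq) copy , ⊑-refl , λ _ _ → done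
    copy-all past (i ∷ todo) {H} {tab} refl copy
      with All.lookup Q-terms (∈-++⁺ʳ past (here refl))
    ... | con c ts , u@(unf {is = is} a vs) = continue (copy-all (past ++ [ i ]) todo (List.++-assoc past [ i ] todo) copied)
      where
      open Copy copy
      recent : ∀ l → ∃[ p ] Newest zero (lookup is l) p tab
      recent l = newest (recorded (ascending-before past (Reachable.ascending reachable)
        (lookup-All (Reachable.closed reachable (∈-++⁺ʳ past (here refl)) a) l) (lookup-All (Store.below G-store a) l)))
      recent-unf : ∀ l → Unf H (proj₁ (recent l)) (lookup ts l)
      recent-unf l with recent l
      ... | p , f with All.lookup valid (newest-∈ f)
      ...   | t , u , v rewrite Unf-functional (Pointwise.lookup vs l) u = v
      ps : Vec ℕ (ar 𝔸 c)
      ps = tabulate (proj₁ ∘ recent)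
      ps-unfs : Pointwise (Unf H) ps ts
      ps-unfs = subst (Pointwise (Unf H) ps) (Vec.tabulate∘lookup ts) (Pointwise.tabulate⁺ recent-unf)
      H₁ : List StoreNode
      H₁ = H ++ [ c , ps ]
      H⊑H₁ : H ⊑ H₁
      H⊑H₁ = _ , refl
      i∉past : ∀ (past : List ℕ) → AllPairs _<_ (past ++ i ∷ todo) → ¬ i ∈ᴸ past
      i∉past (_ ∷ past) (k< ∷ asc) (here refl) = n≮n _ (All.lookup k< (∈-++⁺ʳ past (here refl)))
      i∉past (_ ∷ past) (_ ∷ asc)  (there p)   = i∉past past asc p
      -- An equal node in `H` would have an original in `past` unfolding to the same term as `i`,
      -- hence `i` itself by sharing in `G`, against the strictly increasing order.
      new : ∀ {p} → ¬ At H p (c , ps)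
      new b with originals (At-< b)
      ... | i′ , i′∈ , t , v , v′ with refl ← Unf-functional v′ (unf b ps-unfs) with refl ← Unf-injective G-store u v =
        i∉past past (Reachable.ascending reachable) i′∈
      u₁ : Unf H₁ (length H) (con c ts)
      u₁ = unf (At-last H) (Unfs-⊑ H⊑H₁ ps-unfs)
      Same-⊑ : ∀ {i p} → Same G H i p → Same G H₁ i p
      Same-⊑ (t , v , v′) = t , v , Unf-⊑ H⊑H₁ v′
      length-H₁ : length H₁ ≡ suc (length H)
      length-H₁ = trans (List.length-++ H) (+-comm (length H) 1)
      length-past₁ : length (past ++ [ i ]) ≡ suc (length past)
      length-past₁ = trans (List.length-++ past) (+-comm (length past) 1)
      tab₁ : Table 1
      tab₁ = (zero , i , length H) ∷ tab
      recorded₁ : ∀ {k} → k ∈ᴸ past ++ [ i ] → Entry zero k tab₁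
      recorded₁ p with ∈-++⁻ past p
      ... | inj₁ q           = Entry-≼ ([ zero , i , length H ] , refl) (recorded q)
      ... | inj₂ (here refl) = length H , here refl
      originals₁ : ∀ {p} → p < length H₁ → ∃[ k ] (k ∈ᴸ past ++ [ i ] × Same G H₁ k p)
      originals₁ {p} p< with p <? length H
      ... | yes p<H = let k , k∈ , s = originals p<H in k , ∈-++⁺ˡ k∈ , Same-⊑ s
      ... | no p≮H with refl ← ≤-antisym (≤-pred (≤-trans p< (≤-reflexive length-H₁))) (≮⇒≥ p≮H) =
        i , ∈-++⁺ʳ past (here refl) , con c ts , u , u₁
      copied : Copy G (past ++ [ i ]) H₁ tab₁
      copied = record
        { store     = snoc-store store (Unfs-< ps-unfs) new
        ; length-H  = trans length-H₁ (trans (cong suc length-H) (sym length-past₁))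
        ; length-t  = trans (cong suc length-t) (sym length-past₁)
        ; valid     = (con c ts , u , u₁) ∷ All.map Same-⊑ valid
        ; recorded  = recorded₁
        ; originals = originals₁ }
      continue : Copies todo H₁ tab₁ → Copies (i ∷ todo) H tab
      continue (H′ , tab′ , copy′ , sub , iterates) = H′ , tab′ , copy′ , ⊑-trans H⊑H₁ sub , λ {N} {e} {q} leG leH →
        let H<N = ≤-trans (≤-reflexive (sym length-H₁)) (≤-trans (⊑-length sub) leH)
            i<  = ≤-trans (Unf-< u) leG
            is< = ids-valid vs ⊑-refl leG
            ps< = ids-valid ps-unfs ⊑-refl (<⇒≤ H<N)
            in-range : All (InRange N) tab
            in-range = All.map (λ (t , v , v′) → ≤-trans (Unf-< v) leG , ≤-trans (Unf-< v′) (<⇒≤ H<N)) valid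
            short-t  : length tab ≤ 1 * N
            short-t  = ≤-trans (≤-reflexive (trans length-t (sym length-H))) (≤-trans (<⇒≤ H<N) (≤-reflexive (sym (*-identityˡ N))))
        in
        (refl ,
          (call (tQ ∷ tE ∷ tC ∷ []) (moveItem₃! (idw i) (idw-short 1 i<)) ▸
           pick! 1 {is = [ i ]} here (i< ∷ []) ▸
           fetch! 1 G-store leG a ▸
           onNode! 1 {c = c} is<
             (recast refl (◂-++ (toList ps) (toList is))
               (recallAll! is< (Pointwise.tabulate⁺ λ l →
                  recalled (subst (λ js → At js (toℕ l) (lookup is l)) (List.++-identityʳ (toList is)) (At-lookup is l))
                    (≤-trans (Unf-< (recent-unf l)) (<⇒≤ H<N))
                    (Maps-≤ (tableItems-bound {N} {1} short-t) (newest-maps in-range (proj₂ (recent l)))))) ▸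
              push! ▸
              call (tE ∷ tY ∷ []) (writeArgs! ps ps<) ▸
              drops! 1 is is<) ▸
           pick! 1 {is = i ∷ length H ∷ []} (there here) (i< ∷ H<N ∷ []) ▸
           call (tE ∷ tT ∷ tC ∷ []) (moveItem₃! (idw (length H)) (idw-short 1 H<N)) ▸
           seps! {n = 1} 1 {idw i} {e = idw (length H) ∙ e} ▸
           call (tE ∷ tT ∷ tC ∷ []) (moveItem₃! (key 0 i) (key-short 1 (s≤s z≤n) i<)) ▸
           push!))
        ▹ subst (λ (y , k) → Iter N (on tQ letter?) emit
              (st (storeTape G) (idw k ∙ e) (tableWords tab₁ ◁ []) (todo ◂ end ∷ q) [] y) (length todo)
              (st (storeTape G) (idw (length H′) ∙ e) (tableWords tab′ ◁ []) (end ∷ q) [] (spilledText H′)))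
            (cong₂ _,_ (spilledText-snoc H (c , ps)) length-H₁) (iterates leG leH)

-- The written graph as a DAG, and the complete program

module Result (𝔸 : Signature) where

  open Output 𝔸 public

  fins : ∀ {n k} (ps : Vec ℕ k) → All (_< n) (toList ps) → Vec (Fin n) k
  fins []       []         = []
  fins (p ∷ ps) (p< ∷ ps<) = fromℕ< p< ∷ fins ps ps<

  toℕ-fins : ∀ {n k} (ps : Vec ℕ k) (ps< : All (_< n) (toList ps)) → Vec.map toℕ (fins ps ps<) ≡ ps
  toℕ-fins []       []         = refl
  toℕ-fins (p ∷ ps) (p< ∷ ps<) = cong₂ _∷_ (Fin.toℕ-fromℕ< p<) (toℕ-fins ps ps<)

  fins-< : ∀ {n k b} (ps : Vec ℕ k) (ps< : All (_< n) (toList ps)) → All (_< b) (toList ps) →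
           ∀ {w} → w ∈ᵛ fins ps ps< → toℕ w < b
  fins-< (p ∷ ps) (p< ∷ ps<) (b ∷ bs) (here refl) = ≤-trans (s≤s (≤-reflexive (Fin.toℕ-fromℕ< p<))) b
  fins-< (p ∷ ps) (p< ∷ ps<) (b ∷ bs) (there w∈)  = fins-< ps ps< bs w∈

  At-lookupᴸ : ∀ {A : Set} (xs : List A) v → At xs (toℕ v) (List.lookup xs v)
  At-lookupᴸ (x ∷ xs) zero    = here
  At-lookupᴸ (x ∷ xs) (suc v) = there (At-lookupᴸ xs v)

  module _ {H : List StoreNode} (store : Store H) where

    private
      N = length H

    children-< : ∀ v → All (_< N) (toList (proj₂ (List.lookup H v)))
    children-< v = store-children 0 store ≤-refl (At-lookupᴸ H v)

    graphNode : Fin N → Node 𝔸 N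
    graphNode v = proj₁ (List.lookup H v) , fins (proj₂ (List.lookup H v)) (children-< v)

    graph : Fin N → Graph 𝔸
    graph v = record { order = N ; node = graphNode ; root = v }

    storeNode : Node 𝔸 N → StoreNode
    storeNode (c , ws) = c , Vec.map toℕ ws

    storeNode-graphNode : ∀ v → storeNode (graphNode v) ≡ List.lookup H v
    storeNode-graphNode v = cong (proj₁ (List.lookup H v) ,_) (toℕ-fins (proj₂ (List.lookup H v)) (children-< v))

    graphNode-injective : ∀ {v w} → graphNode v ≡ graphNode w → v ≡ w
    graphNode-injective {v} {w} eq = Fin.toℕ-injective (Store.unique store (At-lookupᴸ H v)
      (subst (At H (toℕ w)) (trans (sym (storeNode-graphNode w)) (trans (cong storeNode (sym eq)) (storeNode-graphNode v)))
        (At-lookupᴸ H w)))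

    module _ (r : Fin N) where

      open Graph (graph r) using (Edge; UnfoldsTo; unfold)

      Edge-< : ∀ {v w} → Edge v w → toℕ w < toℕ v
      Edge-< {v} = fins-< (proj₂ (List.lookup H v)) (children-< v) (Store.below store (At-lookupᴸ H v))

      path-< : ∀ {v w} → TransClosure Edge v w → toℕ w < toℕ v
      path-< Plus.[ e ]     = Edge-< e
      path-< (e Plus.∷ p) = <-trans (path-< p) (Edge-< e)

      Unf-UnfoldsTo  : ∀ {t} v → Unf H (toℕ v) t → UnfoldsTo v t
      Unfs-UnfoldsTo : ∀ {k} {ts : Vec (Term 𝔸) k} (ps : Vec ℕ k) (ps< : All (_< N) (toList ps)) →
                       Pointwise (Unf H) ps ts → Pointwise UnfoldsTo (fins ps ps<) ts
      Unf-UnfoldsTo v (unf a us) with refl ← At-functional (At-lookupᴸ H v) a = unfold (Unfs-UnfoldsTo _ _ us)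
      Unfs-UnfoldsTo []       []         []       = []
      Unfs-UnfoldsTo (p ∷ ps) (p< ∷ ps<) (u ∷ us) =
        Unf-UnfoldsTo (fromℕ< p<) (subst (λ p → Unf H p _) (sym (Fin.toℕ-fromℕ< p<)) u) ∷ Unfs-UnfoldsTo ps ps< us

    encodeIndex-text : ∀ {k} (ps : Vec ℕ k) (ps< : All (_< N) (toList ps)) →
                       concatMap (encodeIndex {𝔸}) (toList (fins ps ps<)) ≡ argsText ps
    encodeIndex-text []       []         = refl
    encodeIndex-text (p ∷ ps) (p< ∷ ps<) = trans
      (cong₂ (λ q w → (List.replicate q tick ++ [ sep ]) ++ w) (Fin.toℕ-fromℕ< p<) (encodeIndex-text ps ps<))
      (List.++-assoc (List.replicate p tick) [ sep ] (argsText ps))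

    concatMap-tabulate : ∀ {A B : Set} (h : A → Word) (h′ : B → Word) (xs : List B) (k : Fin (length xs) → A) →
      (∀ v → h (k v) ≡ h′ (List.lookup xs v)) → concatMap h (toList (tabulate k)) ≡ concatMap h′ xs
    concatMap-tabulate h h′ []       k eq = refl
    concatMap-tabulate h h′ (x ∷ xs) k eq = cong₂ _++_ (eq zero) (concatMap-tabulate h h′ xs (k ∘ suc) (eq ∘ suc))

    encodeGraph-text : ∀ r → encodeGraph (graph r) ≡ (List.replicate (toℕ r) tick ++ [ sep ]) ++ text H
    encodeGraph-text r = cong ((List.replicate (toℕ r) tick ++ [ sep ]) ++_)
      (concatMap-tabulate encodeNode nodeText H graphNode
        (λ v → cong (ctr (proj₁ (List.lookup H v)) ∷_) (encodeIndex-text (proj₂ (List.lookup H v)) (children-< v))))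

  copy-dag : ∀ {G x Q H tab t r} → Store G → Reachable G x Q → (copy : Copy G Q H tab) →
             Unf G x t → Unf H (toℕ r) t → IsDAGOf t (graph (Copy.store copy) r)
  copy-dag {G} {x} {Q} {H} {t = t} {r} G-store reachable copy u v = record
    { acyclic       = λ v p → n≮n (toℕ v) (path-< store r p)
    ; rooted        = rooted
    ; maximalShared = graphNode-injective store
    ; rootUnfolds   = Unf-UnfoldsTo store r r v }
    where
    open Copy copy
    open Graph (graph store r) using (Edge)
    -- Paths of the copy are built by the induction principle `least` of the original: linked nodes
    -- form a closed set containing the source. Each node of the copy has an original, whose linked
    -- copy unfolds to the same term and so coincides with it.
    Linked : ℕ → Set
    Linked i = ∃[ w ] (Same G H i (toℕ w) × Star Edge r w)
    closed : Closed G Linked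
    closed {i} {c} {is} (w , (con _ ts , unf a us , unf b vs) , path) a′
      with refl ← At-functional a a′ with refl ← At-functional (At-lookupᴸ H w) b =
      children us vs (children-< store w) (λ e → path ◅◅ˢ (e ◅ ε))
      where
      children : ∀ {k} {is ps : Vec ℕ k} {ts : Vec (Term 𝔸) k} → Pointwise (Unf G) is ts → Pointwise (Unf H) ps ts →
                 (ps< : All (_< length H) (toList ps)) → (∀ {w′} → w′ ∈ᵛ fins ps ps< → Star Edge r w′) →
                 All Linked (toList is)
      children []       []       []         go = []
      children (u ∷ us) (v ∷ vs) (p< ∷ ps<) go =
        (fromℕ< p< , (_ , u , subst (λ p → Unf H p _) (sym (Fin.toℕ-fromℕ< p<)) v) , go (here refl)) ∷
        children us vs ps< (go ∘ there)
    rooted : ∀ w → Star Edge r w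
    rooted w with originals (Fin.toℕ<n w)
    ... | i , i∈ , t , u′ , v′ with All.lookup (Reachable.least reachable Linked (r , (_ , u , v) , ε) closed) i∈
    ...   | w′ , (t′ , u″ , v″) , path with refl ← Unf-functional u′ u″ =
      subst (Star Edge r) (Fin.toℕ-injective (Unf-injective store v″ v′)) path

  -- The output is read off the first tape alone, so the other tapes stay as they are.
  leftover : List StoreNode → Table 1 → St 6
  leftover G tab = storeTape G , end ∷ [] , tableWords tab ◁ [] , end ∷ [] , [] , [] , tt

  opaque
    unfolding output

    output-run! : ∀ {N G x Q H tab p} → length Q ≤ N → length H ≤ N → length tab ≤ N → Store H → All (InRange N) tab → Newest {1} zero x p tab → p < N →
      Run N (reach 1) (st (storeTape G) (idw x ∙ []) [] (end ∷ []) [] [])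
                      (st (storeTape G) (idw x ∙ []) [] (Q ◂ end ∷ []) [] []) →
      Iter N (on tQ letter?) emit
        (st (storeTape G) (idw 0 ∙ idw x ∙ []) [] (Q ◂ end ∷ []) [] []) (length Q)
        (st (storeTape G) (idw (length H) ∙ idw x ∙ []) (tableWords tab ◁ []) (end ∷ []) [] (spilledText H)) →
      Run N output (st (storeTape G) (idw x ∙ []) [] [] [] [])
        (map inj₁ (List.replicate p tick) ʳ++ inj₁ sep ∷ map inj₁ (text H) ++ [] , leftover G tab)
    output-run! {N} {G} {x} {Q} {H} {tab} {p} Q≤N H≤N tab≤N store in-range found p<N reach-runs iterates =
      push! ▸ reach-runs ▸ push! ▸ push! ▸ while! iterates refl Q≤N ▸
      -- The counter stands one past the last node and may equal `N`, so `idw-short` does not apply;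
      -- the slack in `wordLength 1` covers the extra tick.
      call (tE ∷ []) (dropItem₁! (idw (length H))
        (≤-trans (≤-reflexive (List.length-replicate (suc (length H)))) (s≤s (≤-trans H≤N (m≤m+n N _))))) ▸
      recall! 0 (Maps-≤ (tableItems-bound {N} {1} (≤-trans tab≤N (≤-reflexive (sym (*-identityˡ N))))) (newest-maps in-range found)) ▸
      call (tY ∷ tC ∷ []) (transferBack! (text H)
        (≤-trans (text-length H (store-children 1 store H≤N)) (*-monoˡ-≤ (wordLength 1 at N) H≤N))) ▸
      push! ▸ pop! refl ▸
      call (tE ∷ tC ∷ []) (transferWord! (List.replicate p tick) (≤-trans (n≤1+n _) (idw-short 1 p<N)))

  encoding : ∀ {H} (store : Store H) {p} (p< : p < length H) →
    map inj₁ (encodeGraph (graph store (fromℕ< p<))) ≡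
    map {B = Sym} inj₁ (List.replicate p tick) ʳ++ inj₁ sep ∷ map inj₁ (text H) ++ []
  encoding {H} store {p} p< = begin
    map inj₁ (encodeGraph (graph store r))
      ≡⟨ cong (map inj₁) (trans (encodeGraph-text store r) (List.++-assoc (List.replicate (toℕ r) tick) [ sep ] (text H))) ⟩
    map inj₁ (List.replicate (toℕ r) tick ++ sep ∷ text H)
      ≡⟨ cong (λ p → map inj₁ (List.replicate p tick ++ sep ∷ text H)) (Fin.toℕ-fromℕ< p<) ⟩
    map inj₁ (List.replicate p tick ++ sep ∷ text H)
      ≡⟨ List.map-++ inj₁ (List.replicate p tick) (sep ∷ text H) ⟩
    map inj₁ (List.replicate p tick) ++ inj₁ sep ∷ map inj₁ (text H)
      ≡⟨ cong (λ w → map inj₁ (List.replicate p tick) ++ inj₁ sep ∷ w) (sym (List.++-identityʳ _)) ⟩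
    map inj₁ (List.replicate p tick) ++ inj₁ sep ∷ map inj₁ (text H) ++ []
      ≡⟨ sym (ticks-ʳ++ 1 p) ⟩
    map inj₁ (List.replicate p tick) ʳ++ inj₁ sep ∷ map inj₁ (text H) ++ [] ∎
    where
    open ≡-Reasoning
    r = fromℕ< p<

  Written : Term 𝔸 → (G : List StoreNode) → ℕ → Set
  Written t G x = ∃[ D ] (IsDAGOf t D × (∀ {N} → length G ≤ N →
    ∃[ σ ] Run N output (st (storeTape G) (idw x ∙ []) [] [] [] []) (map inj₁ (encodeGraph D) , σ)))

  output! : ∀ {G x t} → Store G → Unf G x t → Written t G x
  output! {G} {x} {t} G-store u = copy-out (reach! 1 G-store (Unf-< u))
    where
    b = bounded-term t
    copy-out : ∃[ Q ] (Reachable G x Q × Reaches 1 G-store x Q) → Written t G x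
    copy-out (Q , reachable , reach-runs) = write-out (copy-all G-store reachable Q-terms [] Q refl
      (record { store = empty-store ; length-H = refl ; length-t = refl ; valid = [] ; recorded = λ () ; originals = λ () }))
      where
      Q-terms : All (λ i → ∃ (Unf G i)) Q
      Q-terms = All.map (λ (t , u , _) → t , u) (reachable-terms reachable u (Bounded.shared b) (Bounded.member b))
      write-out : Copies G-store reachable Q-terms Q [] [] → Written t G x
      write-out (H , tab , copy , _ , iterates)
        with p , found ← newest (Copy.recorded copy (Reachable.source reachable))
        with t , u′ , v ← All.lookup (Copy.valid copy) (newest-∈ found)
        with refl ← Unf-functional u u′ =
        graph store (fromℕ< p<) , copy-dag G-store reachable copy u (subst (λ p → Unf H p t) (sym (Fin.toℕ-fromℕ< p<)) v) ,
        λ {N} G≤N →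
          let Q≤N   = ≤-trans (length-reachable G-store (Unf-< u) reachable) G≤N
              H≤N   = ≤-trans (≤-reflexive length-H) Q≤N
              tab≤N = ≤-trans (≤-reflexive length-t) Q≤N
              in-range : All (InRange N) tab
              in-range = All.map (λ (t , v , v′) → ≤-trans (Unf-< v) G≤N , ≤-trans (Unf-< v′) H≤N) valid
          in leftover G tab ,
            subst (λ w → Run N output (st (storeTape G) (idw x ∙ []) [] [] [] []) (w , leftover G tab)) (sym (encoding store p<))
              (output-run! {G = G} {Q = Q} {tab = tab} Q≤N H≤N tab≤N store in-range found (≤-trans p< H≤N)
                (reach-runs G≤N) (iterates G≤N H≤N))
        where
        open Copy copy
        p< = Unf-< v

  run-outputs : ∀ (P : Prog 7) {N w u σ T} → Run N P (map inj₁ w , blanks) (map inj₁ u , σ) → cost P at N ≤ T →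
                OutputsWithin (machine P) w u T
  run-outputs P (run le e) cost≤T = machine-correct P e (≤-trans le cost≤T)

  opaque

    program : ∀ {k} → SimRec 𝔸 k → Prog 7
    program f = parse ⨾ code f ⨾ output

    program-run! : ∀ {k N σ σ′ σ″ σ‴} (f : SimRec 𝔸 k) → Run N parse σ σ′ → Run N (code f) σ′ σ″ → Run N output σ″ σ‴ →
                   Run N (program f) σ σ‴
    program-run! f r r′ r″ = r ▸ r′ ▸ r″

  -- The parameter N of the run of the program: the order of the final store plus
  -- the length of the input.
  parameter : ∀ {k} {f : SimRec 𝔸 k} {ps m} → f ▷ ps ⟶ m → Poly k
  parameter {k} d = (growthPoly d ⊚ ∑ var) :+ (∑ var :+ const k)

  eval-∑-var : ∀ {k n} (ι : Fin k → Fin n) xs (ts : Vec (Term 𝔸) k) →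
               (∀ i → lookup xs (ι i) ≡ size (lookup ts i)) → eval (∑ (var ∘ ι)) xs ≡ sizes ts
  eval-∑-var ι xs []       eq = refl
  eval-∑-var ι xs (t ∷ ts) eq = cong₂ _+_ (eq zero) (eval-∑-var (ι ∘ suc) xs ts (eq ∘ suc))

  module _ {k} {f : SimRec 𝔸 k} {ps m} (d : f ▷ ps ⟶ m) (vs : Vec (Term 𝔸) k) where

    private
      xs = Vec.map size vs

      N : ℕ
      N = eval (parameter d) xs

      parameter-eq : N ≡ growthPoly d at sizes vs + (sizes vs + k)
      parameter-eq = cong₂ _+_ (trans (eval-⊚ (growthPoly d) (∑ var) xs) (cong (growthPoly d at_) total)) (cong (_+ k) total)
        where
        total : eval (∑ var) xs ≡ sizes vs
        total = eval-∑-var id xs vs (λ i → Vec.lookup-map i size vs)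

    Solved : Set
    Solved = ∃[ D ] (IsDAGOf (⟦ f ⟧ vs) D ×
      ∃[ σ ] Run N (program f) (map inj₁ (encodeInputs vs) , blanks) (map inj₁ (encodeGraph D) , σ))

    program! : Solved
    program! = evaluate (parse! vs) (bounded-terms vs)
      where
      write : ∀ {G H r σ} → length G ≤ N → length H ≤ N →
        Run N parse (map inj₁ (encodeInputs vs) , blanks) σ → Run N (code f) σ (st (storeTape H) (idw r ∙ []) [] [] [] []) →
        Written (⟦ f ⟧ vs) H r → Solved
      write G≤N H≤N parse-run code-run (D , dag , output-runs) =
        let σ , output-run = output-runs H≤N in D , dag , σ , program-run! f parse-run code-run output-run
      conclude : ∀ {G} {is : Vec ℕ k} → length G ≤ sizes vs →
        (∀ {N} → length G ≤ N → sizes vs + k ≤ N →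
          Run N parse (map inj₁ (encodeInputs vs) , blanks) (st (storeTape G) (toList is ◂ []) [] [] [] [])) →
        Outcome (code f) G (toList is ◂ []) [] (⟦ f ⟧ vs ∷ []) (growthPoly d at sizes vs) → Solved
      conclude {G} G≤ parse-runs (outcome {H} {r ∷ []} store sub growth (u ∷ []) code-runs) =
        write {G} {H} G≤N H≤N (parse-runs G≤N input≤N) (code-runs H≤N) (output! store u)
        where
        input≤N : sizes vs + k ≤ N
        input≤N = ≤-trans (m≤n+m _ (growthPoly d at sizes vs)) (≤-reflexive (sym parameter-eq))
        H≤N : length H ≤ N
        H≤N = ≤-trans growth (≤-trans (+-monoʳ-≤ (growthPoly d at sizes vs) (≤-trans G≤ (m≤m+n _ k))) (≤-reflexive (sym parameter-eq)))
        G≤N : length G ≤ N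
        G≤N = ≤-trans (⊑-length sub) H≤N
      evaluate : Parses vs → Σ[ L ∈ List (Term 𝔸) ] (Shared L × length L ≤ sizes vs × VAll (_∈ᴸ L) vs) → Solved
      evaluate (G , is , store , G≤ , us , parse-runs) (L , shared , few , vs∈) =
        -- One list of all subterms of all inputs bounds each input, so the total input size serves
        -- as the common `s`.
        conclude {G} {is} G≤ parse-runs (code-computes d {e = []} {s = sizes vs} store us (VAll.map (bounded shared few) vs∈))

  computes-dag : ∀ {k} {f : SimRec 𝔸 k} {ps m} (d : f ▷ ps ⟶ m) →
                 ComputesDAGIn (machine (program f)) ⟦ f ⟧ (cost (program f) ⊚ parameter d)
  computes-dag {f = f} d vs = let D , dag , _ , r = program! d vs in
    D , dag , run-outputs (program f) r (≤-reflexive (sym (eval-⊚ (cost (program f)) (parameter d) (Vec.map size vs))))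

theorem5p3 : (𝔸 : Signature) (k : ℕ) (f : SimRec 𝔸 k) (ps : Vec ℕ k) (m : ℕ) →
    f ▷ ps ⟶ m →
    Σ[ p ∈ Poly k ] Σ[ M ∈ TM (letters 𝔸) ] ComputesDAGIn M ⟦ f ⟧ p
theorem5p3 𝔸 k f ps m d = cost (program f) ⊚ parameter d , machine (program f) , computes-dag d
  where open Result 𝔸
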